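{- Let $D \geq 2$ be a squarefree integer and $K = \mathbb{Q}(\sqrt{D})$. (i) Assume $D \equiv 2, 3 \pmod 4$. A binary $\mathbb{Z}$-universal generalized quadratic form over $K$ exists if and only if $D \in \{2,3,6,7,10\}$. (ii) Assume $D \equiv 1 \pmod 4$. A classical binary $\mathbb{Z}$-universal generalized quadratic form over $K$ exists if and only if $D = 5$.
   Context: $\mathcal{O}_K$ is the ring of integers of $K$ and $\tau: K\to K$, $a+b\sqrt{D}\mapsto a-b\sqrt{D}$ is the nontrivial automorphism. A generalized quadratic form in $n$ variables over $K$ is an expression $G(z_1,\dots,z_n)=\sum_{1\le i\le j\le n}\alpha_{ij}z_iz_j+\sum_{1\le i,j\le n}\beta_{ij}z_i\tau(z_j)+\sum_{1\le i\le j\le n}\gamma_{ij}\tau(z_i)\tau(z_j)$ with $\alpha_{ij},\beta_{ij},\gamma_{ij}\in K$; it is evaluated at $\mathbf{a}\in K^n$ by substituting $a_i$ for $z_i$ and $\tau(a_i)$ for $\tau(z_i)$. Binary means $n=2$. $G$ is integral if all $\alpha_{ij},\beta_{ij},\gamma_{ij}\in\mathcal{O}_K$; classical if it is integral and moreover $\alpha_{ij},\gamma_{ij}\in 2\mathcal{O}_K$ for $i<j$ and $\beta_{ij}\in 2\mathcal{O}_K$ for all $1\le i,j\le n$. $G$ is $\mathbb{Z}$-valued if $G(\mathbf{a})\in\mathbb{Z}$ for all $\mathbf{a}\in\mathcal{O}_K^n$, and positive definite if $G(\mathbf{a})>0$ for all nonzero $\mathbf{a}\in K^n$. $G$ is $\mathbb{Z}$-universal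 if it is positive definite, integral, $\mathbb{Z}$-valued, and for every positive integer $m$ there is $\mathbf{a}\in\mathcal{O}_K^n$ with $G(\mathbf{a})=m$. -}

module Defs where

open import Data.Nat as ℕ using (ℕ; _%_)
open import Data.Nat.Divisibility using (_∣_)
open import Data.Integer as ℤ using (ℤ; +_)
open import Data.Rational as ℚ using (ℚ; 0ℚ; 1ℚ; _<_; _≤_)
open import Data.Product using (_×_; _,_; ∃; ∃-syntax; Σ)
open import Data.Sum using (_⊎_)
open import Relation.Binary.PropositionalEquality using (_≡_)
open import Relation.Nullary using (¬_)

SquareFree : ℕ → Set
SquareFree d = ∀ (p : ℕ) → (p ℕ.* p) ∣ d → p ≡ 1

-- An element of K = ℚ(√D) is a pair (a , b) representing a + b √D.
K : Set
K = ℚ × ℚ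

ℤtoℚ : ℤ → ℚ
ℤtoℚ m = m ℚ./ 1

ℕtoℚ : ℕ → ℚ
ℕtoℚ n = ℤtoℚ (+ n)

ι : ℚ → K
ι q = q , 0ℚ

0K : K
0K = ι 0ℚ

_+K_ : K → K → K
(a , b) +K (c , d) = (a ℚ.+ c) , (b ℚ.+ d)

mulK : ℕ → K → K → K
mulK D (a , b) (c , d) = ((a ℚ.* c) ℚ.+ ((ℕtoℚ D ℚ.* b) ℚ.* d)) , ((a ℚ.* d) ℚ.+ (b ℚ.* c))

τ : K → K
τ (a , b) = a , ℚ.- b

ω : ℕ → K
ω D with D % 4
... | 1 = (+ 1 ℚ./ 2) , (+ 1 ℚ./ 2)
... | _ = 0ℚ , 1ℚ

InOK : ℕ → K → Set
InOK D x = ∃[ m ] ∃[ n ] (x ≡ (ι (ℤtoℚ m) +K mulK D (ι (ℤtoℚ n)) (ω D)))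

In2OK : ℕ → K → Set
In2OK D x = ∃[ y ] (InOK D y × x ≡ mulK D (ι (ℤtoℚ (+ 2))) y)

-- positivity of a + b√D as a real number (√D > 0 irrational, D ≥ 2 squarefree)
PosK : ℕ → K → Set
PosK D (a , b) =
  (0ℚ < a × 0ℚ ≤ b)
  ⊎ (0ℚ ≤ a × 0ℚ < b)
  ⊎ (0ℚ < a × b < 0ℚ × ((ℕtoℚ D ℚ.* b) ℚ.* b) < (a ℚ.* a))
  ⊎ (a < 0ℚ × 0ℚ < b × (a ℚ.* a) < ((ℕtoℚ D ℚ.* b) ℚ.* b))

-- A binary generalized quadratic form
-- G(z₁,z₂) = Σ_{i≤j} α_ij z_i z_j + Σ_{i,j} β_ij z_i τ(z_j) + Σ_{i≤j} γ_ij τ(z_i) τ(z_j)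
record BinGQF : Set where
  field
    α₁₁ α₁₂ α₂₂ : K
    β₁₁ β₁₂ β₂₁ β₂₂ : K
    γ₁₁ γ₁₂ γ₂₂ : K

open BinGQF public

eval : ℕ → BinGQF → K → K → K
eval D G z₁ z₂ =
  m (α₁₁ G) (m z₁ z₁) +K (m (α₁₂ G) (m z₁ z₂) +K (m (α₂₂ G) (m z₂ z₂)
  +K (m (β₁₁ G) (m z₁ (τ z₁)) +K (m (β₁₂ G) (m z₁ (τ z₂))
  +K (m (β₂₁ G) (m z₂ (τ z₁)) +K (m (β₂₂ G) (m z₂ (τ z₂))
  +K (m (γ₁₁ G) (m (τ z₁) (τ z₁)) +K (m (γ₁₂ G) (m (τ z₁) (τ z₂))
  +K m (γ₂₂ G) (m (τ z₂) (τ z₂))))))))))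
  where
  m : K → K → K
  m = mulK D

Integral : ℕ → BinGQF → Set
Integral D G =
  InOK D (α₁₁ G) × InOK D (α₁₂ G) × InOK D (α₂₂ G)
  × InOK D (β₁₁ G) × InOK D (β₁₂ G) × InOK D (β₂₁ G) × InOK D (β₂₂ G)
  × InOK D (γ₁₁ G) × InOK D (γ₁₂ G) × InOK D (γ₂₂ G)

Classical : ℕ → BinGQF → Set
Classical D G =
  Integral D G
  × In2OK D (α₁₂ G) × In2OK D (γ₁₂ G)
  × In2OK D (β₁₁ G) × In2OK D (β₁₂ G) × In2OK D (β₂₁ G) × In2OK D (β₂₂ G)

ZValued : ℕ → BinGQF → Set
ZValued D G = ∀ x y → InOK D x → InOK D y → ∃[ k ] (eval D G x y ≡ ι (ℤtoℚ k))

PositiveDefinite : ℕ → BinGQF → Set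
PositiveDefinite D G = ∀ x y → ¬ (x ≡ 0K × y ≡ 0K) → PosK D (eval D G x y)

ZUniversal : ℕ → BinGQF → Set
ZUniversal D G =
  PositiveDefinite D G × Integral D G × ZValued D G
  × (∀ (m : ℕ) → 1 ℕ.≤ m → ∃[ x ] ∃[ y ] (InOK D x × InOK D y × eval D G x y ≡ ι (ℕtoℚ m)))

{-# OPTIONS --safe #-}

-- Written in coordinates, a generalized binary form is a classical quaternary form over ℤ whose reduction modulo D
-- only involves two variables.  If it is universal, vectors of norm 1, 2 and then 3 or 5 (whichever the span of the
-- first two misses) have a positive Gram determinant of at most 10, and this determinant is divisible by D, as
-- every 3 × 3 Gram determinant of a binary form vanishes.  Hence D ≤ 10.
--
-- Conversely, explicit generalized forms become, in suitable bases, ⟨1,2,3,6⟩ (D = 2, 3, 6), ⟨1,2,5,10⟩ (D = 5, 10) and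
-- x² + 2y² + 2yz + 4z² + 7w² (D = 7).  Their universality is deduced from norm forms of quaternion orders of
-- discriminant 2, 5 and 7, for which Lagrange's descent works.  The step from the maximal order of discriminant 5
-- to ⟨1,2,5,10⟩ has an obstruction modulo 4, since the genus of that form has two classes; it is removed by
-- multiplying with elements of norm 3 on both sides, with a 3-adic descent when the element is scalar modulo 3.

module Submission where

-- D enters because y and w are coefficients of √D: in the rational part of a value, every term
-- containing y or w carries a second √D, hence a factor D. The delicate point is integrality of the
-- Gram matrix, whose off-diagonal entries are half-integral a priori. For D ≡ 2, 3 modulo 4 the
-- vanishing of the irrational parts supplies the missing factor 2; for D ≡ 1 this is the purpose of
-- classicality. In the descents, rounding alone suffices only in discriminant 5. For four squares
-- it fails when k is even. In discriminant 7 the rounding bound exceeds k², so the remainder is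
-- forced to have even norm and a factor 2 is removed afterwards. The obstruction for ⟨1,2,5,10⟩ is
-- the class of ±√-3 modulo 4, which multiplication by units cannot carry into the sublattice.
-- Conjugation by one element of norm 3 preserves this class, while two different elements of norm 3
-- on the two sides leave it. Two different ones are available as soon as the element is not scalar
-- modulo 3, and a member of the class cannot be scalar modulo every power of 3.

module Quaternions where
  open import Data.Integer using (ℤ; +_; _+_; _*_; _-_; -_; 0ℤ)
  open import Relation.Binary.PropositionalEquality using (_≡_; refl)
  open import Data.Product using (_×_; _,_)
  open import Data.Integer.Tactic.RingSolver using (ring)
  open import Tactic.RingSolver.NonReflective ring using (solve; _⊜_; Expr; Κ; _⊕_; _⊗_; ⊝_)

  record V4 (A : Set) : Set where
    constructor ⟨_,_,_,_⟩
    field c₁ c₂ c₃ c₄ : A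

  -- The carrier is abstract so that each formula can be read twice: over ℤ or ℚ as a value, and
  -- over solver expressions as the syntax of the identity to be proved.
  record Ops (A : Set) : Set where
    infixl 6 _⊞_ _⊟_ _⊟v_
    infixl 7 _⊠_ _•_
    field
      _⊞_ _⊠_ : A → A → A
      ⊟_ : A → A
      zer : A

    _⊟_ : A → A → A
    a ⊟ b = a ⊞ ⊟ b

    _⊟v_ : V4 A → V4 A → V4 A
    ⟨ x , y , z , w ⟩ ⊟v ⟨ x' , y' , z' , w' ⟩ = ⟨ x ⊟ x' , y ⊟ y' , z ⊟ z' , w ⊟ w' ⟩

    _•_ : A → V4 A → V4 A
    k • ⟨ x , y , z , w ⟩ = ⟨ k ⊠ x , k ⊠ y , k ⊠ z , k ⊠ w ⟩

    -- The order ℤ[ω] + ℤ[ω] g with ω² = εω − n, g² = −c and g e = μ im(e) + ē g, where im(x + yω) = y.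
    module Quaternion (ε n c μ : A) where
      norm : V4 A → A
      norm ⟨ x , y , z , w ⟩ =
        (x ⊠ x ⊞ ε ⊠ x ⊠ y ⊞ n ⊠ y ⊠ y) ⊞ c ⊠ (z ⊠ z ⊞ ε ⊠ z ⊠ w ⊞ n ⊠ w ⊠ w) ⊟ μ ⊠ (y ⊠ z ⊟ x ⊠ w)

      mul : V4 A → V4 A → V4 A
      mul ⟨ x , y , z , w ⟩ ⟨ x' , y' , z' , w' ⟩ = ⟨
        x ⊠ x' ⊟ n ⊠ y ⊠ y' ⊞ μ ⊠ z ⊠ y' ⊟ c ⊠ (z ⊠ (z' ⊞ ε ⊠ w') ⊞ n ⊠ w ⊠ w') ,
        x ⊠ y' ⊞ y ⊠ x' ⊞ ε ⊠ y ⊠ y' ⊞ μ ⊠ w ⊠ y' ⊟ c ⊠ (w ⊠ z' ⊟ z ⊠ w') ,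
        x ⊠ z' ⊟ n ⊠ y ⊠ w' ⊞ z ⊠ (x' ⊞ ε ⊠ y') ⊞ n ⊠ w ⊠ y' ⊞ μ ⊠ z ⊠ w' ,
        x ⊠ w' ⊞ y ⊠ z' ⊞ ε ⊠ y ⊠ w' ⊞ w ⊠ x' ⊟ z ⊠ y' ⊞ μ ⊠ w ⊠ w' ⟩

      conj : V4 A → V4 A
      conj ⟨ x , y , z , w ⟩ = ⟨ x ⊞ ε ⊠ y ⊞ μ ⊠ w , ⊟ y , ⊟ z , ⊟ w ⟩

      polar : V4 A → V4 A → A
      polar ⟨ x , y , z , w ⟩ ⟨ x' , y' , z' , w' ⟩ =
        (x ⊠ x' ⊞ x ⊠ x' ⊞ ε ⊠ (x ⊠ y' ⊞ x' ⊠ y) ⊞ n ⊠ (y ⊠ y' ⊞ y ⊠ y'))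
        ⊞ c ⊠ (z ⊠ z' ⊞ z ⊠ z' ⊞ ε ⊠ (z ⊠ w' ⊞ z' ⊠ w) ⊞ n ⊠ (w ⊠ w' ⊞ w ⊠ w'))
        ⊟ μ ⊠ (y ⊠ z' ⊞ y' ⊠ z ⊟ x ⊠ w' ⊟ x' ⊠ w)

  ℤOps : Ops ℤ
  ℤOps = record { _⊞_ = _+_ ; _⊠_ = _*_ ; ⊟_ = -_ ; zer = 0ℤ }

  exprOps : ∀ n → Ops (Expr ℤ n)
  exprOps n = record { _⊞_ = _⊕_ ; _⊠_ = _⊗_ ; ⊟_ = ⊝_ ; zer = Κ 0ℤ }

  open Ops ℤOps using (_•_; _⊟v_; module Quaternion)

  Vℤ : Set
  Vℤ = V4 ℤ

  norm-mul : ∀ ε n c μ u v → let open Quaternion ε n c μ in norm (mul u v) ≡ norm u * norm v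
  norm-mul ε n c μ ⟨ x , y , z , w ⟩ ⟨ x' , y' , z' , w' ⟩ =
    solve 12 (λ ε n c μ x y z w x' y' z' w' → let open Ops.Quaternion (exprOps 12) ε n c μ in
      norm (mul ⟨ x , y , z , w ⟩ ⟨ x' , y' , z' , w' ⟩)
        ⊜ (norm ⟨ x , y , z , w ⟩ ⊗ norm ⟨ x' , y' , z' , w' ⟩))
      refl ε n c μ x y z w x' y' z' w'

  norm-conj : ∀ ε n c μ v → let open Quaternion ε n c μ in norm (conj v) ≡ norm v
  norm-conj ε n c μ ⟨ x , y , z , w ⟩ =
    solve 8 (λ ε n c μ x y z w → let open Ops.Quaternion (exprOps 8) ε n c μ in
      norm (conj ⟨ x , y , z , w ⟩) ⊜ norm ⟨ x , y , z , w ⟩)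
      refl ε n c μ x y z w

  norm-• : ∀ ε n c μ k v → let open Quaternion ε n c μ in norm (k • v) ≡ k * k * norm v
  norm-• ε n c μ k ⟨ x , y , z , w ⟩ =
    solve 9 (λ ε n c μ k x y z w → let open Ops.Quaternion (exprOps 9) ε n c μ in
      norm (Ops._•_ (exprOps 9) k ⟨ x , y , z , w ⟩) ⊜ (k ⊗ k ⊗ norm ⟨ x , y , z , w ⟩))
      refl ε n c μ k x y z w

  norm-sub : ∀ ε n c μ k v q → let open Quaternion ε n c μ in
    norm (v ⊟v (k • q)) ≡ norm v + k * (k * norm q - polar v q)
  norm-sub ε n c μ k ⟨ x , y , z , w ⟩ ⟨ x' , y' , z' , w' ⟩ =
    solve 13 (λ ε n c μ k x y z w x' y' z' w' →
      let open Ops.Quaternion (exprOps 13) ε n c μ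
          v = ⟨ x , y , z , w ⟩ ; q = ⟨ x' , y' , z' , w' ⟩ in
      norm (Ops._⊟v_ (exprOps 13) v (Ops._•_ (exprOps 13) k q)) ⊜ (norm v ⊕ k ⊗ (k ⊗ norm q ⊕ ⊝ polar v q)))
      refl ε n c μ k x y z w x' y' z' w'

  vec-≡ : {a a' b b' c c' d d' : ℤ} → a ≡ a' → b ≡ b' → c ≡ c' → d ≡ d' → ⟨ a , b , c , d ⟩ ≡ ⟨ a' , b' , c' , d' ⟩
  vec-≡ refl refl refl refl = refl

  -- Conjugation is additive and v v̄ = `norm v`. Once k divides `norm v`, this makes every
  -- coordinate of v r̄ divisible by k, where r = v - k q.
  mul-conj-sub : ∀ ε n c μ k v q → let open Quaternion ε n c μ in
    mul v (conj (v ⊟v (k • q))) ≡ ⟨ norm v , 0ℤ , 0ℤ , 0ℤ ⟩ ⊟v (k • mul v (conj q))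
  mul-conj-sub ε n c μ k ⟨ x , y , z , w ⟩ ⟨ x' , y' , z' , w' ⟩ =
    vec-≡
      (solve 13 (λ ε n c μ k x y z w x' y' z' w' → E.side V4.c₁ ε n c μ k x y z w x' y' z' w') refl ε n c μ k x y z w x' y' z' w')
      (solve 13 (λ ε n c μ k x y z w x' y' z' w' → E.side V4.c₂ ε n c μ k x y z w x' y' z' w') refl ε n c μ k x y z w x' y' z' w')
      (solve 13 (λ ε n c μ k x y z w x' y' z' w' → E.side V4.c₃ ε n c μ k x y z w x' y' z' w') refl ε n c μ k x y z w x' y' z' w')
      (solve 13 (λ ε n c μ k x y z w x' y' z' w' → E.side V4.c₄ ε n c μ k x y z w x' y' z' w') refl ε n c μ k x y z w x' y' z' w')
    where
    module E where
      open Ops (exprOps 13) using (zer) renaming (_•_ to _•ₑ_; _⊟v_ to _⊟ₑ_)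
      side : (V4 (Expr ℤ 13) → Expr ℤ 13) → (ε n c μ k x y z w x' y' z' w' : Expr ℤ 13) → Expr ℤ 13 × Expr ℤ 13
      side π ε n c μ k x y z w x' y' z' w' =
        π (mul v (conj (v ⊟ₑ (k •ₑ q)))) ⊜ π (⟨ norm v , zer , zer , zer ⟩ ⊟ₑ (k •ₑ mul v (conj q)))
        where
        open Ops.Quaternion (exprOps 13) ε n c μ
        v = ⟨ x , y , z , w ⟩
        q = ⟨ x' , y' , z' , w' ⟩

-- Lagrange's method for norm forms: pigeonhole, descent, factorisation.

module LagrangeMethod where
  open Quaternions
  open import Data.Nat as ℕ using (ℕ; zero; suc; s≤s; z≤n)
  import Data.Nat.Properties as ℕₚ
  import Data.Nat.Divisibility as ℕ∣
  open import Data.Nat.Induction using (<-rec)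
  open import Data.Nat.Primality using (Prime; euclidsLemma; prime⇒irreducible)
  open import Data.Nat.Primality.Factorisation using (PrimeFactorisation; factorise)
  open import Data.Nat.ListAction using (product)
  open import Data.List using (List; []; _∷_)
  open import Data.List.Relation.Unary.All using (All; []; _∷_)
  open import Data.Fin using (Fin; toℕ; fromℕ<; splitAt; _↑ˡ_; _↑ʳ_)
  import Data.Fin.Properties as Finₚ
  open import Data.Integer as ℤ using (ℤ; +_; -[1+_]; _+_; _*_; _-_; -_; 0ℤ; 1ℤ; _%ℕ_; _/ℕ_)
  import Data.Integer.Properties as ℤₚ
  open import Data.Integer.DivMod using (n%ℕd<d; a≡a%ℕn+[a/ℕn]*n)
  open import Data.Integer.Divisibility.Signed using (_∣_; divides)
  open import Data.Product using (_×_; _,_; ∃-syntax; proj₁; proj₂)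
  open import Data.Sum using (_⊎_; inj₁; inj₂; [_,_]′)
  open import Relation.Binary.Definitions using (tri<; tri≈; tri>)
  open import Data.Empty using (⊥-elim)
  open import Relation.Nullary using (¬_)
  open import Relation.Binary.PropositionalEquality using (_≡_; _≢_; refl; sym; trans; cong; cong₂; subst; module ≡-Reasoning)
  open import Data.Integer.Tactic.RingSolver using (solve-∀)
  open Ops ℤOps using (_•_; _⊟v_; module Quaternion)

  ≤-by : ∀ {x y} d → 0ℤ ℤ.≤ d → y ≡ x + d → x ℤ.≤ y
  ≤-by {x} {y} d 0≤d eq = ℤₚ.0≤i-j⇒j≤i (subst (0ℤ ℤ.≤_) (trans (lem x d) (cong (_- x) (sym eq))) 0≤d)
    where
    lem : ∀ x d → d ≡ (x + d) - x
    lem = solve-∀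

  <-by : ∀ {x y} d → 0ℤ ℤ.≤ d → y ≡ (1ℤ + x) + d → x ℤ.< y
  <-by d 0≤d eq = ℤₚ.suc[i]≤j⇒i<j (≤-by d 0≤d eq)

  +-nonneg : ∀ {x y} → 0ℤ ℤ.≤ x → 0ℤ ℤ.≤ y → 0ℤ ℤ.≤ x + y
  +-nonneg = ℤₚ.+-mono-≤

  *-nonneg : ∀ {x y} → 0ℤ ℤ.≤ x → 0ℤ ℤ.≤ y → 0ℤ ℤ.≤ x * y
  *-nonneg {+ m} {+ n} _ _ = subst (0ℤ ℤ.≤_) (ℤₚ.pos-* m n) (ℤ.+≤+ z≤n)

  square-nonneg : ∀ x → 0ℤ ℤ.≤ x * x
  square-nonneg (+ n) = *-nonneg {+ n} (ℤ.+≤+ z≤n) (ℤ.+≤+ z≤n)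
  square-nonneg -[1+ n ] = ℤ.+≤+ z≤n

  square≡0 : ∀ x → x * x ≡ 0ℤ → x ≡ 0ℤ
  square≡0 x eq with ℤₚ.i*j≡0⇒i≡0∨j≡0 x eq
  ... | inj₁ p = p
  ... | inj₂ p = p

  nonneg-+≡0 : ∀ {x y} → 0ℤ ℤ.≤ x → 0ℤ ℤ.≤ y → x + y ≡ 0ℤ → x ≡ 0ℤ × y ≡ 0ℤ
  nonneg-+≡0 {+ zero} {+ n} _ _ eq = refl , eq
  nonneg-+≡0 {+ suc m} {+ n} _ _ ()

  ∣-bounded : ∀ (p a : ℕ) (q : ℤ) → 0 ℕ.< a → a ℕ.< p → + a ≢ q * + p
  ∣-bounded p a q 0<a a<p eq = ℕ∣.>⇒∤ {{ℕ.>-nonZero 0<a}} a<p (ℕ∣.divides ℤ.∣ q ∣ (trans (cong ℤ.∣_∣ eq) (ℤₚ.abs-* q (+ p))))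

  parity : ∀ n → ∃[ h ] (n ≡ h ℕ.+ h ⊎ n ≡ suc (h ℕ.+ h))
  parity zero = 0 , inj₁ refl
  parity (suc n) with parity n
  ... | h , inj₁ eq = h , inj₂ (cong suc eq)
  ... | h , inj₂ eq = suc h , inj₁ (cong suc (trans eq (sym (ℕₚ.+-suc h h))))

  -- Multiplicativity reduces everything to primes. Odd primes are written 2h + 1 because the
  -- pigeonhole argument uses h + 1 arguments; the prime 2 is supplied separately.
  module Universality
    (R : ℕ → Set)
    (R-1 : R 1) (R-2 : R 2)
    (R-* : ∀ {a b} → R a → R b → R (a ℕ.* b))
    (start : ∀ h → Prime (suc (h ℕ.+ h)) → ∃[ k ] (0 ℕ.< k × k ℕ.< suc (h ℕ.+ h) × R (k ℕ.* suc (h ℕ.+ h))))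
    (descend : ∀ p k → Prime p → 1 ℕ.< k → k ℕ.< p → R (k ℕ.* p) → ∃[ k′ ] (0 ℕ.< k′ × k′ ℕ.< k × R (k′ ℕ.* p)))
    where

    R-multiple⇒R : ∀ p → Prime p → ∀ k → 0 ℕ.< k → k ℕ.< p → R (k ℕ.* p) → R p
    R-multiple⇒R p pr = <-rec _ go
      where
      go : ∀ k → (∀ {j} → j ℕ.< k → 0 ℕ.< j → j ℕ.< p → R (j ℕ.* p) → R p) → 0 ℕ.< k → k ℕ.< p → R (k ℕ.* p) → R p
      go 1 _ _ _ r = subst R (ℕₚ.*-identityˡ p) r
      go (suc (suc k)) rec _ k<p r with descend p (suc (suc k)) pr (s≤s (s≤s z≤n)) k<p r
      ... | j , 0<j , j<k , r′ = rec j<k 0<j (ℕₚ.<-trans j<k k<p) r′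

    R-prime : ∀ p → Prime p → R p
    R-prime p pr with parity p
    ... | h , inj₂ refl with start h pr
    ...   | k , 0<k , k<p , r = R-multiple⇒R p pr k 0<k k<p r
    R-prime p pr | h , inj₁ eq with prime⇒irreducible pr (ℕ∣.divides h (trans eq (sym (trans (ℕₚ.*-comm h 2) (cong (h ℕ.+_) (ℕₚ.+-identityʳ h))))))
    ... | inj₂ refl = R-2

    R-product : ∀ ps → All Prime ps → R (product ps)
    R-product [] [] = R-1
    R-product (p ∷ ps) (pr ∷ prs) = R-* (R-prime p pr) (R-product ps prs)

    universal : ∀ m → 1 ℕ.≤ m → R m
    universal (suc m) _ = subst R (sym isFactorisation) (R-product factors factorsPrime)
      where open PrimeFactorisation (factorise (suc m))

  module Pigeonhole (h : ℕ) where
    p : ℕ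
    p = suc (h ℕ.+ h)

    residue : (ℕ → ℤ) → Fin (suc h) → Fin p
    residue e i = fromℕ< (n%ℕd<d (e (toℕ i)) p)

    same-residue : ∀ a b → a %ℕ p ≡ b %ℕ p → ∃[ q ] (a - b ≡ q * + p)
    same-residue a b eq = a /ℕ p - b /ℕ p , (begin
      a - b ≡⟨ cong₂ _-_ (a≡a%ℕn+[a/ℕn]*n a p) (a≡a%ℕn+[a/ℕn]*n b p) ⟩
      (+ (a %ℕ p) + a /ℕ p * + p) - (+ (b %ℕ p) + b /ℕ p * + p)
        ≡⟨ cong (λ r → (+ r + a /ℕ p * + p) - (+ (b %ℕ p) + b /ℕ p * + p)) eq ⟩
      (+ (b %ℕ p) + a /ℕ p * + p) - (+ (b %ℕ p) + b /ℕ p * + p) ≡⟨ lem (+ (b %ℕ p)) (a /ℕ p) (b /ℕ p) (+ p) ⟩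
      (a /ℕ p - b /ℕ p) * + p ∎)
      where
      open ≡-Reasoning
      lem : ∀ r q q' p → (r + q * p) - (r + q' * p) ≡ (q - q') * p
      lem = solve-∀

    residue-≡ : ∀ e e' i j → residue e i ≡ residue e' j → ∃[ q ] (e (toℕ i) - e' (toℕ j) ≡ q * + p)
    residue-≡ e e' i j eq = same-residue (e (toℕ i)) (e' (toℕ j))
      (trans (sym (Finₚ.toℕ-fromℕ< (n%ℕd<d (e (toℕ i)) p)))
        (trans (cong toℕ eq) (Finₚ.toℕ-fromℕ< (n%ℕd<d (e' (toℕ j)) p))))

    -- Arguments are given as i and d + i with d > 0 because, for the quadratic polynomials used
    -- here, the difference of values then has d or 2d as a visible factor.
    Injective : (ℕ → ℤ) → Set
    Injective e = ∀ i d → 0 ℕ.< d → d ℕ.+ i ℕ.≤ h → ∀ q → e (d ℕ.+ i) - e i ≢ q * + p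

    no-collision : ∀ e → Injective e → ∀ i j → toℕ i ℕ.< toℕ j → residue e j ≢ residue e i
    no-collision e inj i j i<j eq with residue-≡ e e j i eq
    ... | q , eq′ = inj (toℕ i) (toℕ j ℕ.∸ toℕ i) (ℕₚ.m<n⇒0<n∸m i<j)
                      (subst (ℕ._≤ h) (sym j≡) (Finₚ.toℕ≤pred[n] j)) q
                      (trans (cong (λ t → e t - e (toℕ i)) j≡) eq′)
      where
      j≡ : toℕ j ℕ.∸ toℕ i ℕ.+ toℕ i ≡ toℕ j
      j≡ = ℕₚ.m∸n+n≡m (ℕₚ.<⇒≤ i<j)

    residue-injective : ∀ e → Injective e → ∀ i j → residue e i ≡ residue e j → i ≡ j
    residue-injective e inj i j eq with ℕₚ.<-cmp (toℕ i) (toℕ j)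
    ... | tri≈ _ i≡j _ = Finₚ.toℕ-injective i≡j
    ... | tri< i<j _ _ = ⊥-elim (no-collision e inj i j i<j (sym eq))
    ... | tri> _ _ j<i = ⊥-elim (no-collision e inj j i j<i eq)

    -- The h + 1 values of f and the h + 1 values of g are 2h + 2 = p + 1 residues, so two coincide;
    -- injectivity forces one to come from f and the other from g.
    meet : ∀ f g → Injective f → Injective g → ∃[ x ] ∃[ y ] ∃[ q ] (x ℕ.≤ h × y ℕ.≤ h × f x - g y ≡ q * + p)
    meet f g f-inj g-inj with Finₚ.pigeonhole p<2h+2 F
      where
      F : Fin (suc h ℕ.+ suc h) → Fin p
      F i = [ residue f , residue g ]′ (splitAt (suc h) i)
      p<2h+2 : p ℕ.< suc h ℕ.+ suc h
      p<2h+2 = ℕₚ.≤-reflexive (cong suc (sym (ℕₚ.+-suc h h)))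
    ... | i , j , i<j , eq with splitAt (suc h) i in eqi | splitAt (suc h) j in eqj
    ... | inj₁ a | inj₁ b = ⊥-elim (Finₚ.<⇒≢ i<j (trans (sym (Finₚ.splitAt⁻¹-↑ˡ eqi))
                              (trans (cong (_↑ˡ suc h) (residue-injective f f-inj a b eq)) (Finₚ.splitAt⁻¹-↑ˡ eqj))))
    ... | inj₂ a | inj₂ b = ⊥-elim (Finₚ.<⇒≢ i<j (trans (sym (Finₚ.splitAt⁻¹-↑ʳ eqi))
                              (trans (cong (suc h ↑ʳ_) (residue-injective g g-inj a b eq)) (Finₚ.splitAt⁻¹-↑ʳ eqj))))
    ... | inj₁ a | inj₂ b = toℕ a , toℕ b , proj₁ r , Finₚ.toℕ≤pred[n] a , Finₚ.toℕ≤pred[n] b , proj₂ r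
      where r = residue-≡ f g a b eq
    ... | inj₂ a | inj₁ b = toℕ b , toℕ a , proj₁ r , Finₚ.toℕ≤pred[n] b , Finₚ.toℕ≤pred[n] a , proj₂ r
      where r = residue-≡ f g b a (sym eq)

  prime∤product : ∀ {p} → Prime p → ∀ a b → 0 ℕ.< a → a ℕ.< p → 0 ℕ.< b → b ℕ.< p → ∀ q → + (a ℕ.* b) ≢ q * + p
  prime∤product {p} pr a b 0<a a<p 0<b b<p q eq
    with euclidsLemma a b pr (ℕ∣.divides ℤ.∣ q ∣ (trans (cong ℤ.∣_∣ eq) (ℤₚ.abs-* q (+ p))))
  ... | inj₁ p∣a = ℕ∣.>⇒∤ {{ℕ.>-nonZero 0<a}} a<p p∣a
  ... | inj₂ p∣b = ℕ∣.>⇒∤ {{ℕ.>-nonZero 0<b}} b<p p∣b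

  -- The difference (d + i)² - i² is d (d + 2i), and both factors lie strictly between 0 and p
  -- because d + i ≤ h.
  squares-injective : ∀ h → Prime (suc (h ℕ.+ h)) → Pigeonhole.Injective h (λ x → + x * + x)
  squares-injective h pr i d 0<d d+i≤h q eq =
    prime∤product pr d (d ℕ.+ (i ℕ.+ i)) 0<d (s≤s (ℕₚ.≤-trans (ℕₚ.m≤m+n d i) (ℕₚ.≤-trans d+i≤h (ℕₚ.m≤m+n h h))))
      (ℕₚ.≤-trans 0<d (ℕₚ.m≤m+n d _)) (s≤s d+2i≤2h) q (trans lem′ eq)
    where
    d+2i≤2h : d ℕ.+ (i ℕ.+ i) ℕ.≤ h ℕ.+ h
    d+2i≤2h = ℕₚ.≤-trans (ℕₚ.≤-reflexive (sym (ℕₚ.+-assoc d i i))) (ℕₚ.+-mono-≤ d+i≤h (ℕₚ.≤-trans (ℕₚ.m≤n+m i d) d+i≤h))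
    lem : ∀ d i → d * (d + (i + i)) ≡ (d + i) * (d + i) - i * i
    lem = solve-∀
    lem′ : + (d ℕ.* (d ℕ.+ (i ℕ.+ i))) ≡ + (d ℕ.+ i) * + (d ℕ.+ i) - + i * + i
    lem′ = trans (ℤₚ.pos-* d _) (lem (+ d) (+ i))

  module Descent (ε n c μ : ℤ) where
    open Quaternion ε n c μ public

    Represented : ℕ → Set
    Represented m = ∃[ v ] (norm v ≡ + m)

    represented-* : ∀ {a b} → Represented a → Represented b → Represented (a ℕ.* b)
    represented-* {a} {b} (u , eu) (v , ev) =
      mul u v , trans (norm-mul ε n c μ u v) (trans (cong₂ _*_ eu ev) (sym (ℤₚ.pos-* a b)))

    module _ (k p : ℤ) .{{_ : ℤ.NonZero k}} (v q : Vℤ) (normv : norm v ≡ k * p) where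
      private
        r = v ⊟v (k • q)
        -- This is `norm r` divided by k; k divides `norm r` because it divides `norm v`.
        κ = p + (k * norm q - polar v q)

      norm-remainder : norm r ≡ k * κ
      norm-remainder = trans (norm-sub ε n c μ k v q)
        (trans (cong (_+ k * (k * norm q - polar v q)) normv) (sym (ℤₚ.*-distribˡ-+ k p (k * norm q - polar v q))))

      remainder≡0 : r ≡ ⟨ 0ℤ , 0ℤ , 0ℤ , 0ℤ ⟩ → p ≡ k * norm q
      remainder≡0 eq = ℤₚ.*-cancelˡ-≡ k _ _ (begin
        k * p              ≡⟨ normv ⟨
        norm v             ≡⟨ cong norm v≡k•q ⟩
        norm (k • q)       ≡⟨ norm-• ε n c μ k q ⟩
        k * k * norm q     ≡⟨ ℤₚ.*-assoc k k (norm q) ⟩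
        k * (k * norm q)   ∎)
        where
        open ≡-Reasoning
        diff : ∀ a b → a - b ≡ 0ℤ → a ≡ b
        diff = ℤₚ.i-j≡0⇒i≡j
        v≡k•q : v ≡ k • q
        v≡k•q = vec-≡ (diff _ _ (cong V4.c₁ eq)) (diff _ _ (cong V4.c₂ eq)) (diff _ _ (cong V4.c₃ eq)) (diff _ _ (cong V4.c₄ eq))

      -- v r̄ = k (p − v q̄), so p − v q̄ has norm (norm v)(norm r)/k².
      norm-quotient : ∃[ u ] (norm u ≡ κ * p)
      norm-quotient = u , ℤₚ.*-cancelˡ-≡ k _ _ (ℤₚ.*-cancelˡ-≡ k _ _ (begin
        k * (k * norm u)             ≡⟨ ℤₚ.*-assoc k k (norm u) ⟨
        k * k * norm u               ≡⟨ norm-• ε n c μ k u ⟨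
        norm (k • u)                 ≡⟨ cong norm scaled ⟨
        norm (mul v (conj r))        ≡⟨ norm-mul ε n c μ v (conj r) ⟩
        norm v * norm (conj r)       ≡⟨ cong (norm v *_) (norm-conj ε n c μ r) ⟩
        norm v * norm r              ≡⟨ cong₂ _*_ normv norm-remainder ⟩
        (k * p) * (k * κ)            ≡⟨ lem k p κ ⟩
        k * (k * (κ * p))            ∎))
        where
        open ≡-Reasoning
        lem : ∀ k p x → (k * p) * (k * x) ≡ k * (k * (x * p))
        lem = solve-∀
        s = mul v (conj q)
        u = ⟨ p , 0ℤ , 0ℤ , 0ℤ ⟩ ⊟v s
        lem₁ : ∀ k p x → k * p - k * x ≡ k * (p - x)
        lem₁ = solve-∀
        lem₀ : ∀ k x → 0ℤ - k * x ≡ k * (0ℤ - x)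
        lem₀ = solve-∀
        scaled : mul v (conj r) ≡ k • u
        scaled = trans (mul-conj-sub ε n c μ k v q) (vec-≡
          (trans (cong (_- k * V4.c₁ s) normv) (lem₁ k p (V4.c₁ s)))
          (lem₀ k (V4.c₂ s)) (lem₀ k (V4.c₃ s)) (lem₀ k (V4.c₄ s)))

    module Reduction
      (norm≥0 : ∀ v → 0ℤ ℤ.≤ norm v)
      (norm≡0 : ∀ v → norm v ≡ 0ℤ → v ≡ ⟨ 0ℤ , 0ℤ , 0ℤ , 0ℤ ⟩)
      where

      -- The new multiplier k′ is the norm of r = v - k q divided by k. It is nonzero because r = 0
      -- would give p = k · `norm q`, impossible for 1 < k < p. The equation for the norm of r is
      -- returned so that a choice of q making it smaller than k² yields k′ < k.
      reduce : ∀ p k v q → Prime p → 1 ℕ.< k → k ℕ.< p → norm v ≡ + (k ℕ.* p) →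
               ∃[ k′ ] (0 ℕ.< k′ × norm (v ⊟v (+ k • q)) ≡ + k * + k′ × Represented (k′ ℕ.* p))
      reduce p k v q pr 1<k k<p normv = go _ (norm≥0 (v ⊟v (+ k • q))) (norm-remainder (+ k) (+ p) v q normv′) (norm-quotient (+ k) (+ p) v q normv′)
        where
        instance
          k≢0 : ℕ.NonZero k
          k≢0 = ℕ.>-nonZero (ℕₚ.<-trans (s≤s z≤n) 1<k)
        normv′ : norm v ≡ + k * + p
        normv′ = trans normv (ℤₚ.pos-* k p)

        k∤p : ∀ x → + p ≢ + k * x
        k∤p x eq with prime⇒irreducible pr (ℕ∣.divides ℤ.∣ x ∣ (trans (cong ℤ.∣_∣ eq) (trans (ℤₚ.abs-* (+ k) x) (ℕₚ.*-comm k _))))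
        ... | inj₁ eq′ = ℕₚ.<⇒≢ 1<k (sym eq′)
        ... | inj₂ eq′ = ℕₚ.<⇒≢ k<p eq′

        go : ∀ t → 0ℤ ℤ.≤ norm (v ⊟v (+ k • q)) → norm (v ⊟v (+ k • q)) ≡ + k * t → ∃[ u ] (norm u ≡ t * + p) →
             ∃[ k′ ] (0 ℕ.< k′ × norm (v ⊟v (+ k • q)) ≡ + k * + k′ × Represented (k′ ℕ.* p))
        go (+ zero) _ eq _ = ⊥-elim (k∤p (norm q) (remainder≡0 (+ k) (+ p) v q normv′ (norm≡0 _ (trans eq (ℤₚ.*-zeroʳ (+ k))))))
        go (+ suc k′) _ eq (u , normu) = suc k′ , s≤s z≤n , eq , u , trans normu (sym (ℤₚ.pos-* (suc k′) p))
        go -[1+ m ] 0≤ eq _ = ⊥-elim (negative k k≢0 (subst (0ℤ ℤ.≤_) eq 0≤))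
          where
          negative : ∀ k → ℕ.NonZero k → ¬ (0ℤ ℤ.≤ + k * -[1+ m ])
          negative (suc _) _ ()

-- Sums of four squares and the form ⟨1,2,3,6⟩.

module FourSquareForms where
  open Quaternions
  open LagrangeMethod
  open import Data.Nat as ℕ using (ℕ; zero; suc; s≤s; z≤n)
  import Data.Nat.Properties as ℕₚ
  open import Data.Nat.Primality using (Prime; ¬prime[1])
  import Data.Nat.Tactic.RingSolver as ℕ-Solver
  open import Data.Integer as ℤ using (ℤ; +_; _+_; _*_; _-_; -_; 0ℤ; 1ℤ; _%ℕ_; _/ℕ_)
  import Data.Integer.Properties as ℤₚ
  open import Data.Integer.DivMod using (n%ℕd<d; a≡a%ℕn+[a/ℕn]*n)
  open import Data.Product using (_×_; _,_; ∃-syntax; proj₁; proj₂)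
  open import Data.Sum using (_⊎_; inj₁; inj₂)
  open import Data.Empty using (⊥-elim)
  open import Relation.Binary.PropositionalEquality using (_≡_; _≢_; refl; sym; trans; cong; cong₂; subst; subst₂)
  open import Data.Integer.Tactic.RingSolver using (ring; solve-∀)
  open import Tactic.RingSolver.NonReflective ring using (solve; _⊜_; Κ; _⊕_; _⊗_)
  open Ops ℤOps using (_•_; _⊟v_; module Quaternion)

  Even Odd : ℤ → Set
  Even x = ∃[ f ] (x ≡ f + f)
  Odd x = ∃[ f ] (x ≡ f + f + 1ℤ)

  even⊎odd : ∀ x → Even x ⊎ Odd x
  even⊎odd x with x %ℕ 2 | n%ℕd<d x 2 | a≡a%ℕn+[a/ℕn]*n x 2
  ... | 0 | _ | eq = inj₁ (x /ℕ 2 , trans eq (lem (x /ℕ 2)))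
    where
    lem : ∀ q → 0ℤ + q * + 2 ≡ q + q
    lem = solve-∀
  ... | 1 | _ | eq = inj₂ (x /ℕ 2 , trans eq (lem (x /ℕ 2)))
    where
    lem : ∀ q → 1ℤ + q * + 2 ≡ q + q + 1ℤ
    lem = solve-∀
  ... | suc (suc _) | s≤s (s≤s ()) | _

  double-injective : ∀ {x y} → x + x ≡ y + y → x ≡ y
  double-injective {x} {y} eq = ℤₚ.*-cancelˡ-≡ (+ 2) x y (trans (lem x) (trans eq (sym (lem y))))
    where
    lem : ∀ x → + 2 * x ≡ x + x
    lem = solve-∀

  even≢odd : ∀ x y → x + x ≢ y + y + 1ℤ
  even≢odd x y eq = ∣-bounded 2 1 (x - y) (s≤s z≤n) (s≤s (s≤s z≤n)) (trans (lem₁ y) (trans (cong (_- (y + y)) (sym eq)) (lem₂ x y)))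
    where
    lem₁ : ∀ y → 1ℤ ≡ (y + y + 1ℤ) - (y + y)
    lem₁ = solve-∀
    lem₂ : ∀ x y → (x + x) - (y + y) ≡ (x - y) * + 2
    lem₂ = solve-∀

  -- Dividing a + c instead of a by M gives a remainder between 0 and M - 1 ≤ 2c; subtracting c
  -- centres it in the interval from -c to c.
  centred : ∀ (a : ℤ) (c M : ℕ) .{{_ : ℕ.NonZero M}} → M ℕ.≤ suc (c ℕ.+ c) →
            ∃[ q ] (0ℤ ℤ.≤ + c + (a - + M * q) × 0ℤ ℤ.≤ + c - (a - + M * q))
  centred a c M M≤ = q ,
      subst (0ℤ ℤ.≤_) (trans (lem₁ (+ c) (+ r)) (cong (λ t → + c + t) e≡)) (ℤ.+≤+ z≤n) ,
      subst (0ℤ ℤ.≤_) (trans (lem₂ (+ c) (+ r)) (cong (λ t → + c - t) e≡))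
        (ℤₚ.i≤j⇒0≤j-i (ℤ.+≤+ (ℕₚ.≤-pred (ℕₚ.≤-trans (n%ℕd<d (a + + c) M) M≤))))
    where
    r = (a + + c) %ℕ M
    q = (a + + c) /ℕ M
    lem₁ : ∀ c r → r ≡ c + (r - c)
    lem₁ = solve-∀
    lem₂ : ∀ c r → (c + c) - r ≡ c - (r - c)
    lem₂ = solve-∀
    lem₃ : ∀ a c → (a + c) - c ≡ a
    lem₃ = solve-∀
    lem₄ : ∀ c r q M → r - c ≡ ((r + q * M) - c) - M * q
    lem₄ = solve-∀
    e≡ : + r - + c ≡ a - + M * q
    e≡ = trans (lem₄ (+ c) (+ r) q (+ M)) (cong (_- + M * q)
           (trans (cong (_- + c) (sym (a≡a%ℕn+[a/ℕn]*n (a + + c) M))) (lem₃ a (+ c))))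

  square-≤ : ∀ c e → 0ℤ ℤ.≤ c + e → 0ℤ ℤ.≤ c - e → e * e ℤ.≤ c * c
  square-≤ c e p q = ≤-by ((c + e) * (c - e)) (*-nonneg p q) (lem c e)
    where
    lem : ∀ c e → c * c ≡ e * e + (c + e) * (c - e)
    lem = solve-∀

  small-multiple : ∀ V p q → 0 ℕ.< V → V ℕ.< p ℕ.* p → + V ≡ q * + p → ∃[ k ] (0 ℕ.< k × k ℕ.< p × V ≡ k ℕ.* p)
  small-multiple V p q 0<V V<pp eq = k , 0<k , ℕₚ.*-cancelʳ-< p k p (subst (ℕ._< p ℕ.* p) V≡ V<pp) , V≡
    where
    k = ℤ.∣ q ∣
    V≡ : V ≡ k ℕ.* p
    V≡ = trans (cong ℤ.∣_∣ eq) (ℤₚ.abs-* q (+ p))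
    0<k : 0 ℕ.< k
    0<k = ℕₚ.n≢0⇒n>0 (λ k≡0 → ℕₚ.<⇒≢ 0<V (sym (trans V≡ (cong (ℕ._* p) k≡0))))

  quotient-< : ∀ k k′ x → x ≡ + k * + k′ → x ℤ.< + k * + k → k′ ℕ.< k
  quotient-< k k′ x eq lt = ℕₚ.*-cancelˡ-< k k′ k
    (ℤₚ.drop‿+<+ (subst₂ ℤ._<_ (trans eq (sym (ℤₚ.pos-* k k′))) (sym (ℤₚ.pos-* k k)) lt))

  half-bounds : ∀ {h x} → x ℕ.≤ h → x ℕ.* x ℕ.≤ h ℕ.* h
  half-bounds x≤h = ℕₚ.*-mono-≤ x≤h x≤h

  module FourSquares where
    open Descent 0ℤ 1ℤ 1ℤ 0ℤ

    norm-≡ : ∀ v → let open V4 v renaming (c₁ to x; c₂ to y; c₃ to z; c₄ to w) in norm v ≡ x * x + y * y + z * z + w * w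
    norm-≡ ⟨ x , y , z , w ⟩ = solve 4 (λ x y z w →
      Ops.Quaternion.norm (exprOps 4) (Κ 0ℤ) (Κ 1ℤ) (Κ 1ℤ) (Κ 0ℤ) ⟨ x , y , z , w ⟩ ⊜ (x ⊗ x ⊕ y ⊗ y ⊕ z ⊗ z ⊕ w ⊗ w))
      refl x y z w

    norm≥0 : ∀ v → 0ℤ ℤ.≤ norm v
    norm≥0 v@(⟨ x , y , z , w ⟩) = subst (0ℤ ℤ.≤_) (sym (norm-≡ v))
      (+-nonneg (+-nonneg (+-nonneg (square-nonneg x) (square-nonneg y)) (square-nonneg z)) (square-nonneg w))

    norm≡0 : ∀ v → norm v ≡ 0ℤ → v ≡ ⟨ 0ℤ , 0ℤ , 0ℤ , 0ℤ ⟩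
    norm≡0 v@(⟨ x , y , z , w ⟩) eq
      with nonneg-+≡0 (+-nonneg (+-nonneg (square-nonneg x) (square-nonneg y)) (square-nonneg z)) (square-nonneg w) (trans (sym (norm-≡ v)) eq)
    ... | eq₃ , w≡ with nonneg-+≡0 (+-nonneg (square-nonneg x) (square-nonneg y)) (square-nonneg z) eq₃
    ... | eq₂ , z≡ with nonneg-+≡0 (square-nonneg x) (square-nonneg y) eq₂
    ... | x≡ , y≡ = vec-≡ (square≡0 x x≡) (square≡0 y y≡) (square≡0 z z≡) (square≡0 w w≡)

    open Reduction norm≥0 norm≡0

    SumOf4 : ℤ → Set
    SumOf4 m = ∃[ x ] ∃[ y ] ∃[ z ] ∃[ w ] (x * x + y * y + z * z + w * w ≡ m)

    -- An even number of the coordinates is odd, so they pair off by parity, and (a² + b²)/2 = ((a +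
    -- b)/2)² + ((a - b)/2)².
    halve : ∀ a b c d m → a * a + b * b + c * c + d * d ≡ m + m → SumOf4 m
    halve a b c d m eq = cases (even⊎odd (a - b)) (even⊎odd (c - d)) (even⊎odd (a - c))
      where
      paired : ∀ a b c d → a * a + b * b + c * c + d * d ≡ m + m → Even (a - b) → Even (c - d) → SumOf4 m
      paired a b c d eq (f , eqf) (h , eqh) = a - f , f , c - h , h ,
        double-injective (trans (lem a f c h) (trans (cong₂ (λ b d → a * a + b * b + c * c + d * d) (back a b f eqf) (back c d h eqh)) eq))
        where
        lem : ∀ a f c h → ((a - f) * (a - f) + f * f + (c - h) * (c - h) + h * h) + ((a - f) * (a - f) + f * f + (c - h) * (c - h) + h * h)
              ≡ a * a + (a - (f + f)) * (a - (f + f)) + c * c + (c - (h + h)) * (c - (h + h))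
        lem = solve-∀
        flip : ∀ a b → a - (a - b) ≡ b
        flip = solve-∀
        back : ∀ a b f → a - b ≡ f + f → a - (f + f) ≡ b
        back a b f e = trans (cong (λ t → a - t) (sym e)) (flip a b)
      odd-sum : ∀ a b c d f h → a - b ≡ f + f → c - d ≡ h + h + 1ℤ → a * a + b * b + c * c + d * d ≢ m + m
      odd-sum a b c d f h eqf eqh e = even≢odd m (a * a - a * (f + f) + (f + f) * f + c * c - c * (h + h + 1ℤ) + (h + h) * (h + 1ℤ))
        (trans (sym e) (trans (cong₂ (λ b d → a * a + b * b + c * c + d * d) (sym (back a b _ eqf)) (sym (back c d _ eqh))) (lem a f c h)))
        where
        lem : ∀ a f c h → a * a + (a - (f + f)) * (a - (f + f)) + c * c + (c - (h + h + 1ℤ)) * (c - (h + h + 1ℤ))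
          ≡ (a * a - a * (f + f) + (f + f) * f + c * c - c * (h + h + 1ℤ) + (h + h) * (h + 1ℤ)) + (a * a - a * (f + f) + (f + f) * f + c * c - c * (h + h + 1ℤ) + (h + h) * (h + 1ℤ)) + 1ℤ
        lem = solve-∀
        flip : ∀ a b → a - (a - b) ≡ b
        flip = solve-∀
        back : ∀ a b f → a - b ≡ f → a - f ≡ b
        back a b f e = trans (cong (λ t → a - t) (sym e)) (flip a b)
      swap₁ : ∀ a b c d → c * c + d * d + a * a + b * b ≡ a * a + b * b + c * c + d * d
      swap₁ = solve-∀
      swap₂ : ∀ a b c d → a * a + c * c + b * b + d * d ≡ a * a + b * b + c * c + d * d
      swap₂ = solve-∀
      swap₃ : ∀ a b c d → a * a + d * d + b * b + c * c ≡ a * a + b * b + c * c + d * d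
      swap₃ = solve-∀
      comb₁ : ∀ a b c d → b - d ≡ ((a - c) - (a - b)) + (c - d)
      comb₁ = solve-∀
      comb₁′ : ∀ g f h → ((g + g) - (f + f + 1ℤ)) + (h + h + 1ℤ) ≡ (g - f + h) + (g - f + h)
      comb₁′ = solve-∀
      comb₂ : ∀ a c d → a - d ≡ (a - c) + (c - d)
      comb₂ = solve-∀
      comb₂′ : ∀ g h → (g + g + 1ℤ) + (h + h + 1ℤ) ≡ (g + h + 1ℤ) + (g + h + 1ℤ)
      comb₂′ = solve-∀
      comb₃ : ∀ a b c → b - c ≡ (a - c) - (a - b)
      comb₃ = solve-∀
      comb₃′ : ∀ g f → (g + g + 1ℤ) - (f + f + 1ℤ) ≡ (g - f) + (g - f)
      comb₃′ = solve-∀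
      cases : Even (a - b) ⊎ Odd (a - b) → Even (c - d) ⊎ Odd (c - d) → Even (a - c) ⊎ Odd (a - c) → SumOf4 m
      cases (inj₁ eab) (inj₁ ecd) _ = paired a b c d eq eab ecd
      cases (inj₁ (f , ef)) (inj₂ (h , eh)) _ = ⊥-elim (odd-sum a b c d f h ef eh eq)
      cases (inj₂ (f , ef)) (inj₁ (h , eh)) _ = ⊥-elim (odd-sum c d a b h f eh ef (trans (swap₁ a b c d) eq))
      cases (inj₂ (f , ef)) (inj₂ (h , eh)) (inj₁ (g , eg)) = paired a c b d (trans (swap₂ a b c d) eq) (g , eg)
        (g - f + h , trans (comb₁ a b c d) (trans (cong₂ _+_ (cong₂ _-_ eg ef) eh) (comb₁′ g f h)))
      cases (inj₂ (f , ef)) (inj₂ (h , eh)) (inj₂ (g , eg)) = paired a d b c (trans (swap₃ a b c d) eq)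
        (g + h + 1ℤ , trans (comb₂ a c d) (trans (cong₂ _+_ eg eh) (comb₂′ g h)))
        (g - f , trans (comb₃ a b c) (trans (cong₂ _-_ eg ef) (comb₃′ g f)))

    halve-represented : ∀ j p → Represented ((j ℕ.+ j) ℕ.* p) → Represented (j ℕ.* p)
    halve-represented j p (v@(⟨ a , b , c , d ⟩) , eq)
      with halve a b c d (+ (j ℕ.* p)) (trans (sym (norm-≡ v)) (trans eq (cong +_ (ℕₚ.*-distribʳ-+ p j j))))
    ... | x , y , z , w , e = ⟨ x , y , z , w ⟩ , trans (norm-≡ ⟨ x , y , z , w ⟩) e

    -- The values x² and -y² - 1 meet modulo p, so some x² + y² + 1² + 0² is a multiple of p. With
    -- x, y ≤ h it is less than p².
    start : ∀ h → Prime (suc (h ℕ.+ h)) → ∃[ k ] (0 ℕ.< k × k ℕ.< suc (h ℕ.+ h) × Represented (k ℕ.* suc (h ℕ.+ h)))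
    start zero pr = ⊥-elim (¬prime[1] pr)
    start h@(suc h′) pr with Pigeonhole.meet h (λ x → + x * + x) (λ y → - (+ y * + y + 1ℤ)) (squares-injective h pr)
      (λ i d 0<d d+i≤h q eq → squares-injective h pr i d 0<d d+i≤h (- q) (trans (lem (+ (d ℕ.+ i) * + (d ℕ.+ i)) (+ i * + i)) (trans (cong -_ eq) (ℤₚ.neg-distribˡ-* q _))))
      where
      lem : ∀ s t → s - t ≡ - (- (s + 1ℤ) - - (t + 1ℤ))
      lem = solve-∀
    ... | x , y , q , x≤h , y≤h , eq with small-multiple (x ℕ.* x ℕ.+ y ℕ.* y ℕ.+ 1) (suc (h ℕ.+ h)) q (ℕₚ.m≤n+m 1 _) bound value
      where
      value : + (x ℕ.* x ℕ.+ y ℕ.* y ℕ.+ 1) ≡ q * + suc (h ℕ.+ h)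
      value = trans (cong (_+ 1ℤ) (cong₂ _+_ (ℤₚ.pos-* x x) (ℤₚ.pos-* y y))) (trans (lem (+ x * + x) (+ y * + y)) eq)
        where
        lem : ∀ s t → s + t + 1ℤ ≡ s - - (t + 1ℤ)
        lem = solve-∀
      bound : x ℕ.* x ℕ.+ y ℕ.* y ℕ.+ 1 ℕ.< suc (h ℕ.+ h) ℕ.* suc (h ℕ.+ h)
      bound = ℕₚ.≤-trans (s≤s (ℕₚ.+-monoˡ-≤ 1 (ℕₚ.+-mono-≤ (half-bounds x≤h) (half-bounds y≤h))))
                (ℕₚ.≤-trans (ℕₚ.m≤m+n _ (h′ ℕ.* h′ ℕ.* 2 ℕ.+ h′ ℕ.* 8 ℕ.+ 5)) (ℕₚ.≤-reflexive (lem h′)))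
        where
        lem : ∀ h′ → suc (suc h′ ℕ.* suc h′ ℕ.+ suc h′ ℕ.* suc h′ ℕ.+ 1) ℕ.+ (h′ ℕ.* h′ ℕ.* 2 ℕ.+ h′ ℕ.* 8 ℕ.+ 5) ≡ suc (suc h′ ℕ.+ suc h′) ℕ.* suc (suc h′ ℕ.+ suc h′)
        lem = ℕ-Solver.solve-∀
    ... | k , 0<k , k<p , V≡ = k , 0<k , k<p , ⟨ + x , + y , 1ℤ , 0ℤ ⟩ ,
      trans (norm-≡ ⟨ + x , + y , 1ℤ , 0ℤ ⟩) (trans (lem (+ x) (+ y)) (trans (cong (_+ 1ℤ) (sym (cong₂ _+_ (ℤₚ.pos-* x x) (ℤₚ.pos-* y y)))) (cong +_ V≡)))
      where
      lem : ∀ x y → x * x + y * y + 1ℤ * 1ℤ + 0ℤ * 0ℤ ≡ x * x + y * y + 1ℤ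
      lem = solve-∀

    -- Remainders up to k/2 in absolute value only give norm at most k², and equality can occur for
    -- even k. So even k is halved by parity, while for k = 2j + 1 four remainders bounded by j give
    -- 4j² < k².
    descend : ∀ p k → Prime p → 1 ℕ.< k → k ℕ.< p → Represented (k ℕ.* p) →
              ∃[ k′ ] (0 ℕ.< k′ × k′ ℕ.< k × Represented (k′ ℕ.* p))
    descend p k pr 1<k k<p rep = split (parity k)
      where
      Goal : Set
      Goal = ∃[ k′ ] (0 ℕ.< k′ × k′ ℕ.< k × Represented (k′ ℕ.* p))

      module _ (j : ℕ) (k≡ : k ≡ suc (j ℕ.+ j)) where
        instance
          k≢0 : ℕ.NonZero k
          k≢0 = ℕ.>-nonZero (ℕₚ.<-trans (s≤s z≤n) 1<k)

        round : ∀ a → ∃[ q ] ((a - + k * q) * (a - + k * q) ℤ.≤ + j * + j)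
        round a = let q , lo , hi = centred a j k (ℕₚ.≤-reflexive k≡) in q , square-≤ (+ j) (a - + k * q) lo hi

        nearest : Vℤ → Vℤ
        nearest ⟨ a , b , c , d ⟩ = ⟨ proj₁ (round a) , proj₁ (round b) , proj₁ (round c) , proj₁ (round d) ⟩

        lem : ∀ j → (1ℤ + (j + j)) * (1ℤ + (j + j)) ≡ (1ℤ + (j * j + j * j + j * j + j * j)) + (+ 4 * j)
        lem = solve-∀

        bound : ∀ v → norm (v ⊟v (+ k • nearest v)) ℤ.< + k * + k
        bound v@(⟨ a , b , c , d ⟩) = ℤₚ.≤-<-trans
          (subst (ℤ._≤ + j * + j + + j * + j + + j * + j + + j * + j) (sym (norm-≡ (v ⊟v (+ k • nearest v))))
            (ℤₚ.+-mono-≤ (ℤₚ.+-mono-≤ (ℤₚ.+-mono-≤ (proj₂ (round a)) (proj₂ (round b))) (proj₂ (round c))) (proj₂ (round d))))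
          (<-by (+ 4 * + j) (*-nonneg {+ 4} {+ j} (ℤ.+≤+ z≤n) (ℤ.+≤+ z≤n)) (trans (cong (λ t → + t * + t) k≡) (lem (+ j))))

        odd-case : Represented (k ℕ.* p) → Goal
        odd-case (v , normv) = let k′ , 0<k′ , normr , rep′ = reduce p k v (nearest v) pr 1<k k<p normv in
          k′ , 0<k′ , quotient-< k k′ _ normr (bound v) , rep′

      even-case : ∀ j → k ≡ j ℕ.+ j → Goal
      even-case zero eq = ⊥-elim (ℕₚ.n≮0 (subst (1 ℕ.<_) eq 1<k))
      even-case j@(suc j′) eq = j , s≤s z≤n , subst (j ℕ.<_) (sym eq) (s≤s (ℕₚ.m≤n+m j j′)) ,
        halve-represented j p (subst (λ k → Represented (k ℕ.* p)) eq rep)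

      split : ∃[ h ] (k ≡ h ℕ.+ h ⊎ k ≡ suc (h ℕ.+ h)) → Goal
      split (j , inj₁ eq) = even-case j eq
      split (j , inj₂ eq) = odd-case j eq rep

    four-squares : ∀ m → 1 ℕ.≤ m → SumOf4 (+ m)
    four-squares m 1≤m = unpack (universal m 1≤m)
      where
      open Universality Represented (⟨ 1ℤ , 0ℤ , 0ℤ , 0ℤ ⟩ , refl) (⟨ 1ℤ , 1ℤ , 0ℤ , 0ℤ ⟩ , refl) (λ {a} {b} → represented-* {a} {b}) start descend
      unpack : Represented m → SumOf4 (+ m)
      unpack (v@(⟨ x , y , z , w ⟩) , eq) = x , y , z , w , trans (sym (norm-≡ v)) eq

  open FourSquares using (SumOf4; four-squares)

  module Form1236 where

    Form : ℤ → Set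
    Form m = ∃[ x ] ∃[ y ] ∃[ z ] ∃[ w ] (x * x + + 2 * (y * y) + + 3 * (z * z) + + 6 * (w * w) ≡ m)

    -- If a + b + c = 3k and b − c = 2f then b, c = k + s ± f and a = k − 2s.
    paired : ∀ a b c d k m → a + b + c ≡ + 3 * k → Even (b - c) → a * a + b * b + c * c + d * d ≡ m → Form m
    paired a b c d k m sum (f , eqf) eq = d , f , k , b - f - k , trans (lem b d f k) (trans (cong₂ (λ a c → a * a + b * b + c * c + d * d) a≡ c≡) eq)
      where
      lem : ∀ b d f k → d * d + + 2 * (f * f) + + 3 * (k * k) + + 6 * ((b - f - k) * (b - f - k))
            ≡ (+ 3 * k - b - (b - (f + f))) * (+ 3 * k - b - (b - (f + f))) + b * b + (b - (f + f)) * (b - (f + f)) + d * d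
      lem = solve-∀
      flip : ∀ b c → b - (b - c) ≡ c
      flip = solve-∀
      c≡ : b - (f + f) ≡ c
      c≡ = trans (cong (λ t → b - t) (sym eqf)) (flip b c)
      cancel : ∀ a b c → a + b + c - b - c ≡ a
      cancel = solve-∀
      a≡ : + 3 * k - b - (b - (f + f)) ≡ a
      a≡ = trans (cong₂ (λ s t → s - b - t) (sym sum) c≡) (cancel a b c)

    -- Two of the three integers a, b, c have the same parity; a permutation moves them to the
    -- places where `paired` wants them.
    fromSum : ∀ a b c d k m → a + b + c ≡ + 3 * k → a * a + b * b + c * c + d * d ≡ m → Form m
    fromSum a b c d k m sum eq = cases (even⊎odd (b - c)) (even⊎odd (a - b))
      where
      swap₁ : ∀ a b c → c + a + b ≡ a + b + c
      swap₁ = solve-∀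
      swap₂ : ∀ a b c d → c * c + a * a + b * b + d * d ≡ a * a + b * b + c * c + d * d
      swap₂ = solve-∀
      swap₃ : ∀ a b c → b + a + c ≡ a + b + c
      swap₃ = solve-∀
      swap₄ : ∀ a b c d → b * b + a * a + c * c + d * d ≡ a * a + b * b + c * c + d * d
      swap₄ = solve-∀
      comb : ∀ a b c → a - c ≡ (a - b) + (b - c)
      comb = solve-∀
      comb′ : ∀ g h → (g + g + 1ℤ) + (h + h + 1ℤ) ≡ (g + h + 1ℤ) + (g + h + 1ℤ)
      comb′ = solve-∀
      cases : Even (b - c) ⊎ Odd (b - c) → Even (a - b) ⊎ Odd (a - b) → Form m
      cases (inj₁ e) _ = paired a b c d k m sum e eq
      cases (inj₂ _) (inj₁ e) = paired c a b d k m (trans (swap₁ a b c) sum) e (trans (swap₂ a b c d) eq)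
      cases (inj₂ (h , eh)) (inj₂ (g , eg)) = paired b a c d k m (trans (swap₃ a b c) sum)
        (g + h + 1ℤ , trans (comb a b c) (trans (cong₂ _+_ eg eh) (comb′ g h))) (trans (swap₄ a b c d) eq)

    -- Only the square of a matters, so its sign is normalised: residue 2 is turned into residue 1
    -- by passing to -a.
    data Mod3 (a : ℤ) : Set where
      zero : ∀ q → a * a ≡ (+ 3 * q) * (+ 3 * q) → Mod3 a
      unit : ∀ q → a * a ≡ (+ 3 * q + 1ℤ) * (+ 3 * q + 1ℤ) → Mod3 a

    mod3 : ∀ a → Mod3 a
    mod3 a = go (a %ℕ 3) (n%ℕd<d a 3) (a≡a%ℕn+[a/ℕn]*n a 3)
      where
      lem₀ : ∀ q → (0ℤ + q * + 3) * (0ℤ + q * + 3) ≡ (+ 3 * q) * (+ 3 * q)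
      lem₀ = solve-∀
      lem₁ : ∀ q → (1ℤ + q * + 3) * (1ℤ + q * + 3) ≡ (+ 3 * q + 1ℤ) * (+ 3 * q + 1ℤ)
      lem₁ = solve-∀
      lem₂ : ∀ q → (+ 2 + q * + 3) * (+ 2 + q * + 3) ≡ (+ 3 * (- q - 1ℤ) + 1ℤ) * (+ 3 * (- q - 1ℤ) + 1ℤ)
      lem₂ = solve-∀
      go : ∀ r → r ℕ.< 3 → a ≡ + r + a /ℕ 3 * + 3 → Mod3 a
      go 0 _ eq = zero (a /ℕ 3) (trans (cong₂ _*_ eq eq) (lem₀ (a /ℕ 3)))
      go 1 _ eq = unit (a /ℕ 3) (trans (cong₂ _*_ eq eq) (lem₁ (a /ℕ 3)))
      go 2 _ eq = unit (- (a /ℕ 3) - 1ℤ) (trans (cong₂ _*_ eq eq) (lem₂ (a /ℕ 3)))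
      go (suc (suc (suc _))) (s≤s (s≤s (s≤s ()))) _

    SquaresTo : ℤ → ℤ → ℤ → ℤ → ℤ → Set
    SquaresTo a b c d m = a * a + b * b + c * c + d * d ≡ m

    -- Three of the four squares can be given roots with sum divisible by 3.
    fromMod3 : ∀ {a b c d m} → Mod3 a → Mod3 b → Mod3 c → Mod3 d → SquaresTo a b c d m → Form m
    fromMod3 {a} {b} {c} {d} {m} = go
      where
      zzz : ∀ x y z → + 3 * x + + 3 * y + + 3 * z ≡ + 3 * (x + y + z)
      zzz = solve-∀
      uuu : ∀ x y z → (+ 3 * x + 1ℤ) + (+ 3 * y + 1ℤ) + (+ 3 * z + 1ℤ) ≡ + 3 * (x + y + z + 1ℤ)
      uuu = solve-∀
      zuu : ∀ x y z → + 3 * x + (+ 3 * y + 1ℤ) + - (+ 3 * z + 1ℤ) ≡ + 3 * (x + y - z)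
      zuu = solve-∀
      neg² : ∀ x → - x * - x ≡ x * x
      neg² = solve-∀

      rewrites : ∀ {a b c d a′ b′ c′ d′} → a * a ≡ a′ → b * b ≡ b′ → c * c ≡ c′ → d * d ≡ d′ → SquaresTo a b c d m → a′ + b′ + c′ + d′ ≡ m
      rewrites refl refl refl refl eq = eq

      three-zeros : ∀ {a b c} d x y z → a * a ≡ _ → b * b ≡ _ → c * c ≡ _ → SquaresTo a b c d m → Form m
      three-zeros {a} {b} {c} d x y z ea eb ec eq =
        fromSum (+ 3 * x) (+ 3 * y) (+ 3 * z) d (x + y + z) m (zzz x y z) (rewrites {a} {b} {c} {d} ea eb ec refl eq)

      three-units : ∀ {a b c} d x y z → a * a ≡ _ → b * b ≡ _ → c * c ≡ _ → SquaresTo a b c d m → Form m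
      three-units {a} {b} {c} d x y z ea eb ec eq =
        fromSum (+ 3 * x + 1ℤ) (+ 3 * y + 1ℤ) (+ 3 * z + 1ℤ) d (x + y + z + 1ℤ) m (uuu x y z) (rewrites {a} {b} {c} {d} ea eb ec refl eq)

      zero-units : ∀ {a b c} d x y z → a * a ≡ (+ 3 * x) * (+ 3 * x) → b * b ≡ (+ 3 * y + 1ℤ) * (+ 3 * y + 1ℤ) → c * c ≡ (+ 3 * z + 1ℤ) * (+ 3 * z + 1ℤ) → SquaresTo a b c d m → Form m
      zero-units {a} {b} {c} d x y z ea eb ec eq =
        fromSum (+ 3 * x) (+ 3 * y + 1ℤ) (- (+ 3 * z + 1ℤ)) d (x + y - z) m (zuu x y z)
          (rewrites {a} {b} {c} {d} ea eb (trans ec (sym (neg² (+ 3 * z + 1ℤ)))) refl eq)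

      s-bac : ∀ a b c d → b * b + a * a + c * c + d * d ≡ a * a + b * b + c * c + d * d
      s-bac = solve-∀
      s-cab : ∀ a b c d → c * c + a * a + b * b + d * d ≡ a * a + b * b + c * c + d * d
      s-cab = solve-∀
      s-abd : ∀ a b c d → a * a + b * b + d * d + c * c ≡ a * a + b * b + c * c + d * d
      s-abd = solve-∀
      s-acd : ∀ a b c d → a * a + c * c + d * d + b * b ≡ a * a + b * b + c * c + d * d
      s-acd = solve-∀
      s-bcd : ∀ a b c d → b * b + c * c + d * d + a * a ≡ a * a + b * b + c * c + d * d
      s-bcd = solve-∀

      -- Four residues from {0, 1} contain three equal ones or two of each kind; in the latter case
      -- 0 + 1 - 1 = 0 works after changing one sign.
      go : Mod3 a → Mod3 b → Mod3 c → Mod3 d → SquaresTo a b c d m → Form m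
      go (zero x ex) (zero y ey) (zero z ez) _ eq = three-zeros {a} {b} {c} d x y z ex ey ez eq
      go (unit x ex) (unit y ey) (unit z ez) _ eq = three-units {a} {b} {c} d x y z ex ey ez eq
      go (zero x ex) (unit y ey) (unit z ez) _ eq = zero-units {a} {b} {c} d x y z ex ey ez eq
      go (unit x ex) (zero y ey) (unit z ez) _ eq = zero-units {b} {a} {c} d y x z ey ex ez (trans (s-bac a b c d) eq)
      go (unit x ex) (unit y ey) (zero z ez) _ eq = zero-units {c} {a} {b} d z x y ez ex ey (trans (s-cab a b c d) eq)
      go (zero x ex) (zero y ey) (unit z ez) (zero t et) eq = three-zeros {a} {b} {d} c x y t ex ey et (trans (s-abd a b c d) eq)
      go (zero x ex) (unit y ey) (zero z ez) (zero t et) eq = three-zeros {a} {c} {d} b x z t ex ez et (trans (s-acd a b c d) eq)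
      go (unit x ex) (zero y ey) (zero z ez) (zero t et) eq = three-zeros {b} {c} {d} a y z t ey ez et (trans (s-bcd a b c d) eq)
      go (zero x ex) (zero y ey) (unit z ez) (unit t et) eq = zero-units {a} {c} {d} b x z t ex ez et (trans (s-acd a b c d) eq)
      go (zero x ex) (unit y ey) (zero z ez) (unit t et) eq = zero-units {a} {b} {d} c x y t ex ey et (trans (s-abd a b c d) eq)
      go (unit x ex) (zero y ey) (zero z ez) (unit t et) eq = zero-units {b} {a} {d} c y x t ey ex et (trans (s-bad a b c d) eq)
        where
        s-bad : ∀ a b c d → b * b + a * a + d * d + c * c ≡ a * a + b * b + c * c + d * d
        s-bad = solve-∀

    universal : ∀ m → 1 ℕ.≤ m → Form (+ m)
    universal m 1≤m = let a , b , c , d , eq = four-squares m 1≤m in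
      fromMod3 {a} {b} {c} {d} (mod3 a) (mod3 b) (mod3 c) (mod3 d) eq

-- The order of discriminant 7 and the form x² + 2y² + 2yz + 4z² + 7w².

module SqrtMinusSeven where
  open Quaternions
  open LagrangeMethod
  open FourSquareForms
  open import Data.Nat as ℕ using (ℕ; zero; suc; s≤s; z≤n)
  import Data.Nat.Properties as ℕₚ
  open import Data.Nat.Induction using (<-rec)
  open import Data.Nat.Primality using (Prime; ¬prime[1])
  import Data.Nat.Tactic.RingSolver as ℕ-Solver
  open import Data.Integer as ℤ using (ℤ; +_; _+_; _*_; _-_; -_; 0ℤ; 1ℤ)
  import Data.Integer.Properties as ℤₚ
  open import Data.Product using (_×_; _,_; ∃-syntax; proj₁; proj₂)
  open import Data.Sum using (_⊎_; inj₁; inj₂)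
  open import Data.Empty using (⊥; ⊥-elim)
  open import Relation.Binary.PropositionalEquality using (_≡_; _≢_; refl; sym; trans; cong; cong₂; subst; subst₂)
  open import Data.Integer.Tactic.RingSolver using (ring; solve-∀)
  open import Tactic.RingSolver.NonReflective ring using (solve; _⊜_; Κ; _⊕_; _⊗_)
  open Ops ℤOps using (_•_; _⊟v_; module Quaternion)

  odd-*-even : ∀ {k x} → Odd k → Even (k * x) → Even x
  odd-*-even {k} {x} (j , ek) (f , ef) = f - j * x , trans (lem₁ j x) (trans (cong (λ k → k * x - (j * x + j * x)) (sym ek)) (trans (cong (_- (j * x + j * x)) ef) (lem₂ f j x)))
    where
    lem₁ : ∀ j x → x ≡ (j + j + 1ℤ) * x - (j * x + j * x)
    lem₁ = solve-∀
    lem₂ : ∀ f j x → (f + f) - (j * x + j * x) ≡ (f - j * x) + (f - j * x)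
    lem₂ = solve-∀

  even+even : ∀ {x y} → Even x → Even y → Even (x + y)
  even+even (f , ef) (g , eg) = f + g , trans (cong₂ _+_ ef eg) (lem f g)
    where
    lem : ∀ f g → (f + f) + (g + g) ≡ (f + g) + (f + g)
    lem = solve-∀

  odd+odd : ∀ {x y} → Odd x → Odd y → Even (x + y)
  odd+odd (f , ef) (g , eg) = f + g + 1ℤ , trans (cong₂ _+_ ef eg) (lem f g)
    where
    lem : ∀ f g → (f + f + 1ℤ) + (g + g + 1ℤ) ≡ (f + g + 1ℤ) + (f + g + 1ℤ)
    lem = solve-∀

  ¬even∧odd : ∀ {x} → Even x → Odd x → ⊥
  ¬even∧odd (f , ef) (g , eg) = even≢odd f g (trans (sym ef) eg)

  module Form7 where
    open Descent 1ℤ (+ 2) 1ℤ 0ℤ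

    n₇ : ℤ → ℤ → ℤ
    n₇ s t = s * s + s * t + + 2 * (t * t)

    norm-≡ : ∀ s t s′ t′ → norm ⟨ s , t , s′ , t′ ⟩ ≡ n₇ s t + n₇ s′ t′
    norm-≡ = solve 4 (λ x y z w →
      Ops.Quaternion.norm (exprOps 4) (Κ 1ℤ) (Κ (+ 2)) (Κ 1ℤ) (Κ 0ℤ) ⟨ x , y , z , w ⟩
        ⊜ (x ⊗ x ⊕ x ⊗ y ⊕ Κ (+ 2) ⊗ (y ⊗ y) ⊕ (z ⊗ z ⊕ z ⊗ w ⊕ Κ (+ 2) ⊗ (w ⊗ w)))) refl

    4n₇ : ∀ s t → + 4 * n₇ s t ≡ (+ 2 * s + t) * (+ 2 * s + t) + + 7 * (t * t)
    4n₇ = lem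
      where
      lem : ∀ s t → + 4 * (s * s + s * t + + 2 * (t * t)) ≡ (+ 2 * s + t) * (+ 2 * s + t) + + 7 * (t * t)
      lem = solve-∀

    n₇≥0 : ∀ s t → 0ℤ ℤ.≤ n₇ s t
    n₇≥0 s t = ℤₚ.*-cancelˡ-≤-pos 0ℤ (n₇ s t) (+ 4) (subst (0ℤ ℤ.≤_) (sym (4n₇ s t))
      (+-nonneg (square-nonneg (+ 2 * s + t)) (*-nonneg {+ 7} (ℤ.+≤+ z≤n) (square-nonneg t))))

    n₇≡0 : ∀ s t → n₇ s t ≡ 0ℤ → s ≡ 0ℤ × t ≡ 0ℤ
    n₇≡0 s t eq = s≡0 , t≡0
      where
      split = nonneg-+≡0 (square-nonneg (+ 2 * s + t)) (*-nonneg {+ 7} (ℤ.+≤+ z≤n) (square-nonneg t)) (trans (sym (4n₇ s t)) (cong (+ 4 *_) eq))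
      t≡0 : t ≡ 0ℤ
      t≡0 = square≡0 t (ℤₚ.*-cancelˡ-≡ (+ 7) (t * t) 0ℤ (proj₂ split))
      s≡0 : s ≡ 0ℤ
      s≡0 = ℤₚ.*-cancelˡ-≡ (+ 2) s 0ℤ (trans (sym (ℤₚ.+-identityʳ (+ 2 * s))) (trans (cong (λ t → + 2 * s + t) (sym t≡0)) (square≡0 (+ 2 * s + t) (proj₁ split))))

    norm≥0 : ∀ v → 0ℤ ℤ.≤ norm v
    norm≥0 ⟨ s , t , s′ , t′ ⟩ = subst (0ℤ ℤ.≤_) (sym (norm-≡ s t s′ t′)) (+-nonneg (n₇≥0 s t) (n₇≥0 s′ t′))

    norm≡0 : ∀ v → norm v ≡ 0ℤ → v ≡ ⟨ 0ℤ , 0ℤ , 0ℤ , 0ℤ ⟩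
    norm≡0 ⟨ s , t , s′ , t′ ⟩ eq =
      let p , q = nonneg-+≡0 (n₇≥0 s t) (n₇≥0 s′ t′) (trans (sym (norm-≡ s t s′ t′)) eq)
          s≡ , t≡ = n₇≡0 s t p
          s′≡ , t′≡ = n₇≡0 s′ t′ q
      in vec-≡ s≡ t≡ s′≡ t′≡

    open Reduction norm≥0 norm≡0

    -- Modulo 2 the form is s (s + t).
    n₇-odd : ∀ s t → Odd (n₇ s t) → Odd s × Even t
    n₇-odd s t o = cases (even⊎odd s) (even⊎odd t)
      where
      lem₁ : ∀ f t → (f + f) * (f + f) + (f + f) * t + + 2 * (t * t) ≡ (+ 2 * (f * f) + f * t + t * t) + (+ 2 * (f * f) + f * t + t * t)
      lem₁ = solve-∀
      lem₂ : ∀ f g → (f + f + 1ℤ) * (f + f + 1ℤ) + (f + f + 1ℤ) * (g + g + 1ℤ) + + 2 * ((g + g + 1ℤ) * (g + g + 1ℤ))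
             ≡ ((f + f + 1ℤ) * (f + g + 1ℤ) + (g + g + 1ℤ) * (g + g + 1ℤ)) + ((f + f + 1ℤ) * (f + g + 1ℤ) + (g + g + 1ℤ) * (g + g + 1ℤ))
      lem₂ = solve-∀
      cases : Even s ⊎ Odd s → Even t ⊎ Odd t → Odd s × Even t
      cases (inj₂ os) (inj₁ et) = os , et
      cases (inj₁ (f , refl)) _ = ⊥-elim (¬even∧odd (+ 2 * (f * f) + f * t + t * t , lem₁ f t) o)
      cases (inj₂ (f , refl)) (inj₂ (g , refl)) = ⊥-elim (¬even∧odd ((f + f + 1ℤ) * (f + g + 1ℤ) + (g + g + 1ℤ) * (g + g + 1ℤ) , lem₂ f g) o)

    odd-t⇒even : ∀ s t → Odd t → Even (n₇ s t)
    odd-t⇒even s t ot with even⊎odd (n₇ s t)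
    ... | inj₁ e = e
    ... | inj₂ o = ⊥-elim (¬even∧odd (proj₂ (n₇-odd s t o)) ot)

    even-s⇒even : ∀ s t → Even s → Even (n₇ s t)
    even-s⇒even s t es with even⊎odd (n₇ s t)
    ... | inj₁ e = e
    ... | inj₂ o = ⊥-elim (¬even∧odd es (proj₁ (n₇-odd s t o)))

    -- Division by a prime of ℤ[(1+√−7)/2] above 2, after conjugation if necessary.
    halve-n₇ : ∀ s t → Even (n₇ s t) → ∃[ s′ ] ∃[ t′ ] (n₇ s t ≡ n₇ s′ t′ + n₇ s′ t′)
    halve-n₇ s t e = cases (even⊎odd s) (even⊎odd t)
      where
      lem₁ : ∀ f t → (f + f) * (f + f) + (f + f) * t + + 2 * (t * t) ≡
        ((t + f) * (t + f) + (t + f) * (- f) + + 2 * (- f * - f)) + ((t + f) * (t + f) + (t + f) * (- f) + + 2 * (- f * - f))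
      lem₁ = solve-∀
      lem₂ : ∀ s t → (s + t) * (s + t) + (s + t) * (- t) + + 2 * (- t * - t) ≡ s * s + s * t + + 2 * (t * t)
      lem₂ = solve-∀
      even-s : ∀ s t → Even s → ∃[ s′ ] ∃[ t′ ] (n₇ s t ≡ n₇ s′ t′ + n₇ s′ t′)
      even-s s t (f , refl) = t + f , - f , lem₁ f t
      lem₃ : ∀ f g → (f + f + 1ℤ) * (f + f + 1ℤ) + (f + f + 1ℤ) * (g + g) + + 2 * ((g + g) * (g + g)) ≡
        (+ 2 * (f * f) + + 2 * f + (f + f + 1ℤ) * g + + 2 * ((g + g) * g)) + (+ 2 * (f * f) + + 2 * f + (f + f + 1ℤ) * g + + 2 * ((g + g) * g)) + 1ℤ
      lem₃ = solve-∀
      cases : Even s ⊎ Odd s → Even t ⊎ Odd t → ∃[ s′ ] ∃[ t′ ] (n₇ s t ≡ n₇ s′ t′ + n₇ s′ t′)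
      cases (inj₁ es) _ = even-s s t es
      cases (inj₂ os) (inj₂ ot) = let s′ , t′ , eq = even-s (s + t) (- t) (odd+odd os ot) in s′ , t′ , trans (sym (lem₂ s t)) eq
      cases (inj₂ (f , refl)) (inj₁ (g , refl)) = ⊥-elim (¬even∧odd e (+ 2 * (f * f) + + 2 * f + (f + f + 1ℤ) * g + + 2 * ((g + g) * g) , lem₃ f g))

    Sum7 : ℤ → Set
    Sum7 m = ∃[ s ] ∃[ t ] ∃[ s′ ] ∃[ t′ ] (n₇ s t + n₇ s′ t′ ≡ m)

    -- Two even summands are halved separately. Two odd ones have s, s′ odd and t, t′ even, so half
    -- the sum and half the difference of the two pairs are integral, and the parallelogram law
    -- halves the total.
    halve : ∀ s t s′ t′ m → n₇ s t + n₇ s′ t′ ≡ m + m → Sum7 m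
    halve s t s′ t′ m eq = cases (even⊎odd (n₇ s t)) (even⊎odd (n₇ s′ t′))
      where
      mixed : ∀ {x y} → Even x → Odd y → x + y ≢ m + m
      mixed (f , refl) (g , refl) e = even≢odd m (f + g) (trans (sym e) (lem f g))
        where
        lem : ∀ f g → (f + f) + (g + g + 1ℤ) ≡ (f + g) + (f + g) + 1ℤ
        lem = solve-∀
      regroup : ∀ x y → (x + y) + (x + y) ≡ (x + x) + (y + y)
      regroup = solve-∀
      swap : ∀ x y → y + x ≡ x + y
      swap = solve-∀
      lem : ∀ f g h i →
        ((f + h + 1ℤ) * (f + h + 1ℤ) + (f + h + 1ℤ) * (g + i) + + 2 * ((g + i) * (g + i)) + ((f - h) * (f - h) + (f - h) * (g - i) + + 2 * ((g - i) * (g - i))))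
        + ((f + h + 1ℤ) * (f + h + 1ℤ) + (f + h + 1ℤ) * (g + i) + + 2 * ((g + i) * (g + i)) + ((f - h) * (f - h) + (f - h) * (g - i) + + 2 * ((g - i) * (g - i))))
        ≡ ((f + f + 1ℤ) * (f + f + 1ℤ) + (f + f + 1ℤ) * (g + g) + + 2 * ((g + g) * (g + g))) + ((h + h + 1ℤ) * (h + h + 1ℤ) + (h + h + 1ℤ) * (i + i) + + 2 * ((i + i) * (i + i)))
      lem = solve-∀
      both-odd : ∀ s t s′ t′ → n₇ s t + n₇ s′ t′ ≡ m + m → Odd s × Even t → Odd s′ × Even t′ → Sum7 m
      both-odd _ _ _ _ eq ((f , refl) , (g , refl)) ((h , refl) , (i , refl)) =
        f + h + 1ℤ , g + i , f - h , g - i , double-injective (trans (lem f g h i) eq)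
      cases : Even (n₇ s t) ⊎ Odd (n₇ s t) → Even (n₇ s′ t′) ⊎ Odd (n₇ s′ t′) → Sum7 m
      cases (inj₁ e) (inj₁ e′) =
        let a , b , ab = halve-n₇ s t e
            c , d , cd = halve-n₇ s′ t′ e′
        in a , b , c , d , double-injective (trans (regroup (n₇ a b) (n₇ c d)) (trans (sym (cong₂ _+_ ab cd)) eq))
      cases (inj₂ o) (inj₂ o′) = both-odd s t s′ t′ eq (n₇-odd s t o) (n₇-odd s′ t′ o′)
      cases (inj₁ e) (inj₂ o) = ⊥-elim (mixed e o eq)
      cases (inj₂ o) (inj₁ e) = ⊥-elim (mixed e o (trans (swap (n₇ s t) (n₇ s′ t′)) eq))

    halve-represented : ∀ j p → Represented ((j ℕ.+ j) ℕ.* p) → Represented (j ℕ.* p)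
    halve-represented j p (⟨ a , b , c , d ⟩ , eq) =
      let x , y , z , w , e = halve a b c d (+ (j ℕ.* p)) (trans (sym (norm-≡ a b c d)) (trans eq (cong +_ (ℕₚ.*-distribʳ-+ p j j))))
      in ⟨ x , y , z , w ⟩ , trans (norm-≡ x y z w) e

    -- The values used are `n₇ x 0` = x² and `n₇ y 1` = y² + y + 2. The second is injective modulo p
    -- because its differences are d (d + 2i + 1) with d + 2i + 1 ≤ 2h.
    start : ∀ h → Prime (suc (h ℕ.+ h)) → ∃[ k ] (0 ℕ.< k × k ℕ.< suc (h ℕ.+ h) × Represented (k ℕ.* suc (h ℕ.+ h)))
    start zero pr = ⊥-elim (¬prime[1] pr)
    start h@(suc h′) pr with Pigeonhole.meet h (λ x → + x * + x) (λ y → - (+ y * + y + + y + + 2)) (squares-injective h pr) injective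
      where
      lem : ∀ d i → d * (d + (i + i) + 1ℤ) ≡ - (- ((d + i) * (d + i) + (d + i) + + 2) - - (i * i + i + + 2))
      lem = solve-∀
      injective : Pigeonhole.Injective h (λ y → - (+ y * + y + + y + + 2))
      injective i d 0<d d+i≤h q eq = prime∤product pr d (d ℕ.+ (i ℕ.+ i) ℕ.+ 1) 0<d
        (s≤s (ℕₚ.≤-trans (ℕₚ.m≤m+n d i) (ℕₚ.≤-trans d+i≤h (ℕₚ.m≤m+n h h)))) (ℕₚ.m≤n+m 1 _) (s≤s small) (- q)
        (trans (ℤₚ.pos-* d _) (trans (lem (+ d) (+ i)) (trans (cong -_ eq) (ℤₚ.neg-distribˡ-* q _))))
        where
        small : d ℕ.+ (i ℕ.+ i) ℕ.+ 1 ℕ.≤ h ℕ.+ h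
        small = ℕₚ.≤-trans (ℕₚ.≤-reflexive (lem′ d i)) (ℕₚ.+-mono-≤ d+i≤h (ℕₚ.≤-trans (ℕₚ.+-monoˡ-≤ i 0<d) d+i≤h))
          where
          lem′ : ∀ d i → d ℕ.+ (i ℕ.+ i) ℕ.+ 1 ≡ (d ℕ.+ i) ℕ.+ (1 ℕ.+ i)
          lem′ = ℕ-Solver.solve-∀
    ... | x , y , q , x≤h , y≤h , eq with small-multiple (x ℕ.* x ℕ.+ (y ℕ.* y ℕ.+ y ℕ.+ 2)) (suc (h ℕ.+ h)) q (ℕₚ.≤-trans (s≤s z≤n) (ℕₚ.≤-trans (ℕₚ.m≤n+m 2 (y ℕ.* y ℕ.+ y)) (ℕₚ.m≤n+m _ (x ℕ.* x)))) bound value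
      where
      value : + (x ℕ.* x ℕ.+ (y ℕ.* y ℕ.+ y ℕ.+ 2)) ≡ q * + suc (h ℕ.+ h)
      value = trans (cong₂ (λ s t → s + (t + + y + + 2)) (ℤₚ.pos-* x x) (ℤₚ.pos-* y y)) (trans (lem (+ x * + x) (+ y * + y) (+ y)) eq)
        where
        lem : ∀ s t y → s + (t + y + + 2) ≡ s - - (t + y + + 2)
        lem = solve-∀
      bound : x ℕ.* x ℕ.+ (y ℕ.* y ℕ.+ y ℕ.+ 2) ℕ.< suc (h ℕ.+ h) ℕ.* suc (h ℕ.+ h)
      bound = ℕₚ.≤-trans (s≤s (ℕₚ.+-mono-≤ (half-bounds x≤h) (ℕₚ.+-monoˡ-≤ 2 (ℕₚ.+-mono-≤ (half-bounds y≤h) y≤h))))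
                (ℕₚ.≤-trans (ℕₚ.m≤m+n _ (h′ ℕ.* h′ ℕ.* 2 ℕ.+ h′ ℕ.* 7 ℕ.+ 3)) (ℕₚ.≤-reflexive (lem h′)))
        where
        lem : ∀ h′ → suc (suc h′ ℕ.* suc h′ ℕ.+ (suc h′ ℕ.* suc h′ ℕ.+ suc h′ ℕ.+ 2)) ℕ.+ (h′ ℕ.* h′ ℕ.* 2 ℕ.+ h′ ℕ.* 7 ℕ.+ 3) ≡ suc (suc h′ ℕ.+ suc h′) ℕ.* suc (suc h′ ℕ.+ suc h′)
        lem = ℕ-Solver.solve-∀
    ... | k , 0<k , k<p , V≡ = k , 0<k , k<p , ⟨ + x , 0ℤ , + y , 1ℤ ⟩ ,
      trans (norm-≡ (+ x) 0ℤ (+ y) 1ℤ) (trans (lem (+ x) (+ y)) (trans (sym (cong₂ (λ s t → s + (t + + y + + 2)) (ℤₚ.pos-* x x) (ℤₚ.pos-* y y))) (cong +_ V≡)))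
      where
      lem : ∀ x y → x * x + x * 0ℤ + + 2 * (0ℤ * 0ℤ) + (y * y + y * 1ℤ + + 2 * (1ℤ * 1ℤ)) ≡ x * x + (y * y + y + + 2)
      lem = solve-∀

    -- With u = 2s + t one has 4 n₇ = u² + 7t², hence 64 n₇ = 16 u² + 7 (4t)². The two weights 16
    -- and 7 produce all the constants below.
    bound64 : ∀ (a b K s t : ℤ) → (+ 2 * s + t) * (+ 2 * s + t) ℤ.≤ a * K → + 16 * (t * t) ℤ.≤ b * K →
              + 64 * n₇ s t ℤ.≤ (+ 16 * a + + 7 * b) * K
    bound64 a b K s t p q = subst₂ ℤ._≤_ (lem₁ s t) (lem₂ a b K)
      (ℤₚ.+-mono-≤ (ℤₚ.*-monoˡ-≤-nonNeg (+ 16) p) (ℤₚ.*-monoˡ-≤-nonNeg (+ 7) q))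
      where
      lem₁ : ∀ s t → + 16 * ((+ 2 * s + t) * (+ 2 * s + t)) + + 7 * (+ 16 * (t * t)) ≡ + 64 * (s * s + s * t + + 2 * (t * t))
      lem₁ = solve-∀
      lem₂ : ∀ a b K → + 16 * (a * K) + + 7 * (b * K) ≡ (+ 16 * a + + 7 * b) * K
      lem₂ = solve-∀

    -- Plain rounding bounds 64 n₇ by 44 K for each of the two pairs, 88 K in total, which misses
    -- the 64 K needed for a descent. The aim is therefore a remainder of even norm below 2 K: its
    -- quotient by the odd number k is even and can be halved.
    module Rounding (k j : ℕ) .{{_ : ℕ.NonZero k}} (k≡ : k ≡ suc (j ℕ.+ j)) where
      κ J K : ℤ
      κ = + k
      J = + j
      K = κ * κ

      κ≡ : κ ≡ J + J + 1ℤ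
      κ≡ = trans (cong +_ k≡) (ℤₚ.+-comm 1ℤ (J + J))

      κ-odd : Odd κ
      κ-odd = J , κ≡

      0≤κ : 0ℤ ℤ.≤ κ
      0≤κ = ℤ.+≤+ z≤n

      0≤J : 0ℤ ℤ.≤ J
      0≤J = ℤ.+≤+ z≤n

      0≤K : 0ℤ ℤ.≤ K
      0≤K = square-nonneg κ

      relax : ∀ {x} a d → 0ℤ ℤ.≤ d → x ℤ.≤ a * K → x ℤ.≤ (a + d) * K
      relax a d 0≤d le = ℤₚ.≤-trans le (≤-by (d * K) (*-nonneg 0≤d 0≤K) (ℤₚ.*-distribʳ-+ K a d))

      round-s : ∀ s t → ∃[ q ] (0ℤ ℤ.≤ κ + (+ 2 * (s - κ * q) + t) × 0ℤ ℤ.≤ κ - (+ 2 * (s - κ * q) + t))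
      round-s s t =
        let q , lo , hi = centred (+ 2 * s + t) k (k ℕ.+ k) {{ℕ.>-nonZero (ℕₚ.≤-trans (ℕ.>-nonZero⁻¹ k) (ℕₚ.m≤m+n k k))}} (ℕₚ.n≤1+n (k ℕ.+ k))
        in q , subst (λ e → 0ℤ ℤ.≤ κ + e) (lem s t κ q) lo , subst (λ e → 0ℤ ℤ.≤ κ - e) (lem s t κ q) hi
        where
        lem : ∀ s t κ q → (+ 2 * s + t) - (κ + κ) * q ≡ + 2 * (s - κ * q) + t
        lem = solve-∀

      u-bound : ∀ u → 0ℤ ℤ.≤ κ + u → 0ℤ ℤ.≤ κ - u → u * u ℤ.≤ 1ℤ * K
      u-bound u lo hi = subst (u * u ℤ.≤_) (sym (ℤₚ.*-identityˡ K)) (square-≤ κ u lo hi)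

      record Rounded (s t : ℤ) : Set where
        constructor rounded
        field
          qs qt : ℤ
          t-lo : 0ℤ ℤ.≤ J + (t - κ * qt)
          t-hi : 0ℤ ℤ.≤ J - (t - κ * qt)
          u-lo : 0ℤ ℤ.≤ κ + (+ 2 * (s - κ * qs) + (t - κ * qt))
          u-hi : 0ℤ ℤ.≤ κ - (+ 2 * (s - κ * qs) + (t - κ * qt))

      round : ∀ s t → Rounded s t
      round s t =
        let qt , lo , hi = centred t j k (ℕₚ.≤-reflexive k≡)
            qs , lo′ , hi′ = round-s s (t - κ * qt)
        in rounded qs qt lo hi lo′ hi′

      -- The constant is 16 · 1 + 7 · 4, from |u| ≤ κ and 2|t| ≤ κ.
      rounded-bound : ∀ {s t} (r : Rounded s t) → let open Rounded r in + 64 * n₇ (s - κ * qs) (t - κ * qt) ℤ.≤ + 44 * K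
      rounded-bound {s} {t} (rounded qs qt lo hi ulo uhi) =
        bound64 1ℤ (+ 4) K (s - κ * qs) t′ (u-bound (+ 2 * (s - κ * qs) + t′) ulo uhi)
          (ℤₚ.≤-trans (ℤₚ.*-monoˡ-≤-nonNeg (+ 16) (square-≤ J t′ lo hi))
            (≤-by (+ 16 * J + + 4) (+-nonneg (*-nonneg {+ 16} {J} (ℤ.+≤+ z≤n) 0≤J) (ℤ.+≤+ z≤n)) (trans (cong (λ κ → + 4 * (κ * κ)) κ≡) (lem J))))
        where
        t′ = t - κ * qt
        lem : ∀ J → + 4 * ((J + J + 1ℤ) * (J + J + 1ℤ)) ≡ + 16 * (J * J) + (+ 16 * J + + 4)
        lem = solve-∀

      EvenRep : ℤ → ℤ → Set
      EvenRep s t = ∃[ qs ] ∃[ qt ] (Even (n₇ (s - κ * qs) (t - κ * qt)) × + 64 * n₇ (s - κ * qs) (t - κ * qt) ℤ.≤ + 79 * K)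

      -- Shifting s or t by κ (which is odd) changes the parity; 4 |t| against κ decides which shift is short enough.
      flip-parity : ∀ {s t} (r : Rounded s t) → let open Rounded r in Odd (n₇ (s - κ * qs) (t - κ * qt)) → EvenRep s t
      flip-parity {s} {t} (rounded qs qt lo hi ulo uhi) odd = cases (ℤₚ.≤-total (+ 4 * t₀) κ) (ℤₚ.≤-total (- κ) (+ 4 * t₀)) (ℤₚ.≤-total 0ℤ u₀)
        where
        s₀ = s - κ * qs
        t₀ = t - κ * qt
        u₀ = + 2 * s₀ + t₀
        parities = n₇-odd s₀ t₀ odd
        up : ∀ s κ q → s - κ * (q + 1ℤ) ≡ (s - κ * q) - κ
        up = solve-∀
        down : ∀ s κ q → s - κ * (q - 1ℤ) ≡ (s - κ * q) + κ
        down = solve-∀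
        even-sub : ∀ {x} → Odd x → Even (x - κ)
        even-sub (f , refl) = f - J , trans (cong (λ κ → f + f + 1ℤ - κ) κ≡) (lem f J)
          where
          lem : ∀ f J → f + f + 1ℤ - (J + J + 1ℤ) ≡ (f - J) + (f - J)
          lem = solve-∀
        odd-sub : ∀ {x} → Even x → Odd (x - κ)
        odd-sub (f , refl) = f - J - 1ℤ , trans (cong (λ κ → f + f - κ) κ≡) (lem f J)
          where
          lem : ∀ f J → f + f - (J + J + 1ℤ) ≡ (f - J - 1ℤ) + (f - J - 1ℤ) + 1ℤ
          lem = solve-∀
        odd-add : ∀ {x} → Even x → Odd (x + κ)
        odd-add (f , refl) = f + J , trans (cong (λ κ → f + f + κ) κ≡) (lem f J)
          where
          lem : ∀ f J → f + f + (J + J + 1ℤ) ≡ (f + J) + (f + J) + 1ℤ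
          lem = solve-∀

        -- A small t leaves room for s to move by κ: |u| ≤ 2κ and 4|t| ≤ κ give 16 · 4 + 7 · 1 = 71,
        -- relaxed to the 79 of the other shift.
        shift-s : 0ℤ ℤ.≤ κ - + 4 * t₀ → 0ℤ ℤ.≤ κ + + 4 * t₀ → ∀ q s₁ → s - κ * q ≡ s₁ → Even s₁ →
                  (+ 2 * s₁ + t₀) * (+ 2 * s₁ + t₀) ℤ.≤ + 4 * K → EvenRep s t
        shift-s p₁ p₂ q s₁ refl even ub = q , qt , even-s⇒even s₁ t₀ even ,
          relax (+ 71) (+ 8) (ℤ.+≤+ z≤n) (bound64 (+ 4) 1ℤ K s₁ t₀ ub (≤-by ((κ - + 4 * t₀) * (κ + + 4 * t₀)) (*-nonneg p₁ p₂) (lem κ t₀)))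
          where
          lem : ∀ κ t → 1ℤ * (κ * κ) ≡ + 16 * (t * t) + (κ - + 4 * t) * (κ + + 4 * t)
          lem = solve-∀

        -- If 4|t| ≥ κ, moving t by κ to the other side of 0 leaves 4|t₁| ≤ 3κ. Then s is rounded
        -- afresh for the new t, and the constant is 16 · 1 + 7 · 9 = 79.
        shift-t : ∀ q t₁ → t - κ * q ≡ t₁ → Odd t₁ → + 16 * (t₁ * t₁) ℤ.≤ + 9 * K → EvenRep s t
        shift-t q t₁ refl odd-t tb = let qs′ , lo′ , hi′ = round-s s t₁ in
          qs′ , q , odd-t⇒even (s - κ * qs′) t₁ odd-t , bound64 1ℤ (+ 9) K (s - κ * qs′) t₁ (u-bound (+ 2 * (s - κ * qs′) + t₁) lo′ hi′) tb

        cases : + 4 * t₀ ℤ.≤ κ ⊎ κ ℤ.≤ + 4 * t₀ → - κ ℤ.≤ + 4 * t₀ ⊎ + 4 * t₀ ℤ.≤ - κ → 0ℤ ℤ.≤ u₀ ⊎ u₀ ℤ.≤ 0ℤ → EvenRep s t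
        cases (inj₂ le) _ _ = shift-t (qt + 1ℤ) (t₀ - κ) (up t κ qt) (odd-sub (proj₂ parities))
          (≤-by ((+ 4 * t₀ - κ) * (+ 3 * κ + + 4 * ((J - t₀) + (J + 1ℤ))))
            (*-nonneg (ℤₚ.i≤j⇒0≤j-i le) (+-nonneg (*-nonneg {+ 3} (ℤ.+≤+ z≤n) 0≤κ) (*-nonneg {+ 4} (ℤ.+≤+ z≤n) (+-nonneg hi (ℤ.+≤+ z≤n)))))
            (trans (lem κ t₀) (trans (cong (λ e → + 16 * ((t₀ - κ) * (t₀ - κ)) + (+ 4 * t₀ - κ) * (+ 3 * κ + + 4 * (e - t₀))) κ≡) (cong (λ e → + 16 * ((t₀ - κ) * (t₀ - κ)) + (+ 4 * t₀ - κ) * (+ 3 * κ + + 4 * e)) (lem′ J t₀)))))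
          where
          lem : ∀ κ t → + 9 * (κ * κ) ≡ + 16 * ((t - κ) * (t - κ)) + (+ 4 * t - κ) * (+ 3 * κ + + 4 * (κ - t))
          lem = solve-∀
          lem′ : ∀ J t → (J + J + 1ℤ) - t ≡ (J - t) + (J + 1ℤ)
          lem′ = solve-∀
        cases (inj₁ _) (inj₂ le) _ = shift-t (qt - 1ℤ) (t₀ + κ) (down t κ qt) (odd-add (proj₂ parities))
          (≤-by ((- κ - + 4 * t₀) * (+ 3 * κ + + 4 * ((J + t₀) + (J + 1ℤ))))
            (*-nonneg (ℤₚ.i≤j⇒0≤j-i le) (+-nonneg (*-nonneg {+ 3} (ℤ.+≤+ z≤n) 0≤κ) (*-nonneg {+ 4} (ℤ.+≤+ z≤n) (+-nonneg lo (ℤ.+≤+ z≤n)))))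
            (trans (lem κ t₀) (trans (cong (λ e → + 16 * ((t₀ + κ) * (t₀ + κ)) + (- κ - + 4 * t₀) * (+ 3 * κ + + 4 * (e + t₀))) κ≡) (cong (λ e → + 16 * ((t₀ + κ) * (t₀ + κ)) + (- κ - + 4 * t₀) * (+ 3 * κ + + 4 * e)) (lem′ J t₀)))))
          where
          lem : ∀ κ t → + 9 * (κ * κ) ≡ + 16 * ((t + κ) * (t + κ)) + (- κ - + 4 * t) * (+ 3 * κ + + 4 * (κ + t))
          lem = solve-∀
          lem′ : ∀ J t → (J + J + 1ℤ) + t ≡ (J + t) + (J + 1ℤ)
          lem′ = solve-∀
        cases (inj₁ le₁) (inj₁ le₂) (inj₁ 0≤u) = shift-s (ℤₚ.i≤j⇒0≤j-i le₁) (subst (0ℤ ℤ.≤_) (lem₀ κ t₀) (ℤₚ.i≤j⇒0≤j-i le₂)) (qs + 1ℤ) (s₀ - κ) (up s κ qs) (even-sub (proj₁ parities))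
          (≤-by (u₀ * (+ 3 * κ + (κ - u₀))) (*-nonneg 0≤u (+-nonneg (*-nonneg {+ 3} (ℤ.+≤+ z≤n) 0≤κ) uhi)) (lem κ s₀ t₀))
          where
          lem₀ : ∀ κ t → + 4 * t - - κ ≡ κ + + 4 * t
          lem₀ = solve-∀
          lem : ∀ κ s t → + 4 * (κ * κ) ≡ (+ 2 * (s - κ) + t) * (+ 2 * (s - κ) + t) + (+ 2 * s + t) * (+ 3 * κ + (κ - (+ 2 * s + t)))
          lem = solve-∀
        cases (inj₁ le₁) (inj₁ le₂) (inj₂ u≤0) = shift-s (ℤₚ.i≤j⇒0≤j-i le₁) (subst (0ℤ ℤ.≤_) (lem₀ κ t₀) (ℤₚ.i≤j⇒0≤j-i le₂)) (qs - 1ℤ) (s₀ + κ) (down s κ qs) (odd+odd (proj₁ parities) κ-odd)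
          (≤-by ((0ℤ - u₀) * (+ 3 * κ + (κ + u₀))) (*-nonneg (ℤₚ.i≤j⇒0≤j-i u≤0) (+-nonneg (*-nonneg {+ 3} (ℤ.+≤+ z≤n) 0≤κ) ulo)) (lem κ s₀ t₀))
          where
          lem₀ : ∀ κ t → + 4 * t - - κ ≡ κ + + 4 * t
          lem₀ = solve-∀
          lem : ∀ κ s t → + 4 * (κ * κ) ≡ (+ 2 * (s + κ) + t) * (+ 2 * (s + κ) + t) + (0ℤ - (+ 2 * s + t)) * (+ 3 * κ + (κ + (+ 2 * s + t)))
          lem = solve-∀

      EvenPair : ℤ → ℤ → ℤ → ℤ → Set
      EvenPair s t s′ t′ = ∃[ q₁ ] ∃[ q₂ ] ∃[ q₃ ] ∃[ q₄ ]
        let N = n₇ (s - κ * q₁) (t - κ * q₂) + n₇ (s′ - κ * q₃) (t′ - κ * q₄) in Even N × + 64 * N ℤ.≤ + 123 * K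

      -- Only one of the two pairs ever has to change parity, so the worst case is 44 + 79 = 123,
      -- still below 128.
      even-pair : ∀ s t s′ t′ → EvenPair s t s′ t′
      even-pair s t s′ t′ = cases (even⊎odd x) (even⊎odd y)
        where
        r = round s t
        r′ = round s′ t′
        open Rounded r
        open Rounded r′ using () renaming (qs to qs′; qt to qt′)
        x = n₇ (s - κ * qs) (t - κ * qt)
        y = n₇ (s′ - κ * qs′) (t′ - κ * qt′)
        add : ∀ {x y} a b → + 64 * x ℤ.≤ a * K → + 64 * y ℤ.≤ b * K → + 64 * (x + y) ℤ.≤ (a + b) * K
        add {x} {y} a b p q = subst₂ ℤ._≤_ (sym (ℤₚ.*-distribˡ-+ (+ 64) x y)) (sym (ℤₚ.*-distribʳ-+ K a b)) (ℤₚ.+-mono-≤ p q)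
        basic : Even (x + y) → EvenPair s t s′ t′
        basic e = qs , qt , qs′ , qt′ , e , relax (+ 88) (+ 35) (ℤ.+≤+ z≤n) (add (+ 44) (+ 44) (rounded-bound r) (rounded-bound r′))
        cases : Even x ⊎ Odd x → Even y ⊎ Odd y → EvenPair s t s′ t′
        cases (inj₁ ex) (inj₁ ey) = basic (even+even ex ey)
        cases (inj₂ ox) (inj₂ oy) = basic (odd+odd ox oy)
        cases (inj₂ ox) (inj₁ ey) = let q₁ , q₂ , e , b = flip-parity r ox in
          q₁ , q₂ , qs′ , qt′ , even+even e ey , add (+ 79) (+ 44) b (rounded-bound r′)
        cases (inj₁ ex) (inj₂ oy) = let q₁ , q₂ , e , b = flip-parity r′ oy in
          qs , qt , q₁ , q₂ , even+even ex e , add (+ 44) (+ 79) (rounded-bound r) b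

    descend : ∀ p k → Prime p → 1 ℕ.< k → k ℕ.< p → Represented (k ℕ.* p) →
              ∃[ k′ ] (0 ℕ.< k′ × k′ ℕ.< k × Represented (k′ ℕ.* p))
    descend p k pr 1<k k<p rep = split (parity k)
      where
      Goal : Set
      Goal = ∃[ k′ ] (0 ℕ.< k′ × k′ ℕ.< k × Represented (k′ ℕ.* p))

      even-case : ∀ j → k ≡ j ℕ.+ j → Goal
      even-case zero eq = ⊥-elim (ℕₚ.n≮0 (subst (1 ℕ.<_) eq 1<k))
      even-case j@(suc j′) eq = j , s≤s z≤n , subst (j ℕ.<_) (sym eq) (s≤s (ℕₚ.m≤n+m j j′)) ,
        halve-represented j p (subst (λ k → Represented (k ℕ.* p)) eq rep)

      module _ (j : ℕ) (k≡ : k ≡ suc (j ℕ.+ j)) where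
        instance
          k≢0 : ℕ.NonZero k
          k≢0 = ℕ.>-nonZero (ℕₚ.<-trans (s≤s z≤n) 1<k)
        open Rounding k j k≡

        -- As κ is odd and N = κ k′ is even, k′ = 2h. Then 128 κ h = 64 N ≤ 123 κ² gives h < k, and
        -- halving the representation of k′ p gives one of h p.
        finish : ∀ k′ N → N ≡ κ * + k′ → Even N → + 64 * N ℤ.≤ + 123 * K → 0 ℕ.< k′ → Represented (k′ ℕ.* p) → Goal
        finish k′ N N≡ eN bN 0<k′ rep′ = conclude (parity k′)
          where
          even-k′ : Even (+ k′)
          even-k′ = odd-*-even κ-odd (subst Even N≡ eN)
          conclude : ∃[ h ] (k′ ≡ h ℕ.+ h ⊎ k′ ≡ suc (h ℕ.+ h)) → Goal
          conclude (h , inj₂ eq) = ⊥-elim (¬even∧odd even-k′ (+ h , trans (cong +_ eq) (ℤₚ.+-comm 1ℤ (+ h + + h))))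
          conclude (zero , inj₁ eq) = ⊥-elim (ℕₚ.n≮0 (subst (0 ℕ.<_) eq 0<k′))
          conclude (h@(suc _) , inj₁ eq) = h , s≤s z≤n , quotient-< k h (κ * + h) refl small , halve-represented h p (subst (λ k → Represented (k ℕ.* p)) eq rep′)
            where
            N≡′ : + 64 * N ≡ + 128 * (κ * + h)
            N≡′ = trans (cong (+ 64 *_) (trans N≡ (cong (λ t → κ * + t) eq))) (lem κ (+ h))
              where
              lem : ∀ κ h → + 64 * (κ * (h + h)) ≡ + 128 * (κ * h)
              lem = solve-∀
            K>0 : 1ℤ ℤ.≤ K
            K>0 = subst (1ℤ ℤ.≤_) (ℤₚ.pos-* k k) (ℤ.+≤+ (ℕₚ.*-mono-≤ (ℕₚ.<⇒≤ 1<k) (ℕₚ.<⇒≤ 1<k)))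
            small : κ * + h ℤ.< K
            small = ℤₚ.*-cancelˡ-<-nonNeg (+ 128) (ℤₚ.≤-<-trans (subst (ℤ._≤ + 123 * K) N≡′ bN)
              (<-by (+ 4 * K + (K - 1ℤ)) (+-nonneg (*-nonneg {+ 4} (ℤ.+≤+ z≤n) 0≤K) (ℤₚ.i≤j⇒0≤j-i K>0)) (lem K)))
              where
              lem : ∀ K → + 128 * K ≡ (1ℤ + + 123 * K) + (+ 4 * K + (K - 1ℤ))
              lem = solve-∀

        odd-case : Represented (k ℕ.* p) → Goal
        odd-case (v@(⟨ s , t , s′ , t′ ⟩) , normv) =
          let q₁ , q₂ , q₃ , q₄ , e , b = even-pair s t s′ t′
              k′ , 0<k′ , normr , rep′ = reduce p k v ⟨ q₁ , q₂ , q₃ , q₄ ⟩ pr 1<k k<p normv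
          in finish k′ (n₇ (s - κ * q₁) (t - κ * q₂) + n₇ (s′ - κ * q₃) (t′ - κ * q₄))
               (trans (sym (norm-≡ (s - κ * q₁) (t - κ * q₂) (s′ - κ * q₃) (t′ - κ * q₄))) normr) e b 0<k′ rep′

      split : ∃[ h ] (k ≡ h ℕ.+ h ⊎ k ≡ suc (h ℕ.+ h)) → Goal
      split (j , inj₁ eq) = even-case j eq
      split (j , inj₂ eq) = odd-case j eq rep

    sum7 : ∀ m → 1 ℕ.≤ m → Sum7 (+ m)
    sum7 m 1≤m = unpack (universal m 1≤m)
      where
      open Universality Represented (⟨ 1ℤ , 0ℤ , 0ℤ , 0ℤ ⟩ , refl) (⟨ 1ℤ , 0ℤ , 1ℤ , 0ℤ ⟩ , refl) (λ {a} {b} → represented-* {a} {b}) start descend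
      unpack : Represented m → Sum7 (+ m)
      unpack (⟨ x , y , z , w ⟩ , eq) = x , y , z , w , trans (sym (norm-≡ x y z w)) eq

    Form : ℤ → Set
    Form m = ∃[ x ] ∃[ y ] ∃[ z ] ∃[ w ] (x * x + + 2 * (y * y + y * z + + 2 * (z * z)) + + 7 * (w * w) ≡ m)

    -- The form is (x² + 7w²) + 2 n₇(y, z). Doubling exchanges the two parts, since x² + 7w² = n₇(x
    -- - w, 2w) and 4 n₇(y, z) = (2y + z)² + 7z².
    double : ∀ {m} → Form m → Form (m + m)
    double (x , y , z , w , refl) = + 2 * y + z , x - w , + 2 * w , z , lem x y z w
      where
      lem : ∀ x y z w → (+ 2 * y + z) * (+ 2 * y + z) + + 2 * ((x - w) * (x - w) + (x - w) * (+ 2 * w) + + 2 * ((+ 2 * w) * (+ 2 * w))) + + 7 * (z * z)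
            ≡ (x * x + + 2 * (y * y + y * z + + 2 * (z * z)) + + 7 * (w * w)) + (x * x + + 2 * (y * y + y * z + + 2 * (z * z)) + + 7 * (w * w))
      lem = solve-∀

    -- Exactly one of the two summands is odd. Its second argument is 2f, so it equals (s + f)² +
    -- 7f²; the even summand is twice a value of n₇.
    odd⇒form : ∀ m → Odd m → Sum7 m → Form m
    odd⇒form m om (s , t , s′ , t′ , eq) = cases (even⊎odd (n₇ s t)) (even⊎odd (n₇ s′ t′))
      where
      lem : ∀ s f x y → (s + f) * (s + f) + + 2 * (x * x + x * y + + 2 * (y * y)) + + 7 * (f * f)
            ≡ (s * s + s * (f + f) + + 2 * ((f + f) * (f + f))) + ((x * x + x * y + + 2 * (y * y)) + (x * x + x * y + + 2 * (y * y)))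
      lem = solve-∀
      one-odd : ∀ s t s′ t′ → n₇ s t + n₇ s′ t′ ≡ m → Odd s × Even t → Even (n₇ s′ t′) → Form m
      one-odd s t s′ t′ eq (_ , f , refl) e = let x , y , xy = halve-n₇ s′ t′ e in
        s + f , x , y , f , trans (lem s f x y) (trans (cong (λ e → n₇ s (f + f) + e) (sym xy)) eq)
      cases : Even (n₇ s t) ⊎ Odd (n₇ s t) → Even (n₇ s′ t′) ⊎ Odd (n₇ s′ t′) → Form m
      cases (inj₁ e) (inj₁ e′) = ⊥-elim (¬even∧odd (subst Even eq (even+even e e′)) om)
      cases (inj₂ o) (inj₂ o′) = ⊥-elim (¬even∧odd (subst Even eq (odd+odd o o′)) om)
      cases (inj₂ o) (inj₁ e) = one-odd s t s′ t′ eq (n₇-odd s t o) e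
      cases (inj₁ e) (inj₂ o) = one-odd s′ t′ s t (trans (ℤₚ.+-comm (n₇ s′ t′) (n₇ s t)) eq) (n₇-odd s′ t′ o) e

    universal : ∀ m → 1 ℕ.≤ m → Form (+ m)
    universal = <-rec _ go
      where
      go : ∀ m → (∀ {j} → j ℕ.< m → 1 ℕ.≤ j → Form (+ j)) → 1 ℕ.≤ m → Form (+ m)
      go m rec 1≤m = cases (parity m)
        where
        cases : ∃[ h ] (m ≡ h ℕ.+ h ⊎ m ≡ suc (h ℕ.+ h)) → Form (+ m)
        cases (zero , inj₁ refl) = ⊥-elim (ℕₚ.n≮0 1≤m)
        cases (h@(suc h′) , inj₁ refl) = double (rec {h} (s≤s (ℕₚ.m≤n+m h h′)) (s≤s z≤n))
        cases (h , inj₂ eq) = odd⇒form (+ m) (+ h , trans (cong +_ eq) (ℤₚ.+-comm 1ℤ (+ h + + h))) (sum7 m 1≤m)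

-- The order of discriminant 5 is norm-Euclidean, hence its norm form is universal.

module DiscriminantFive where
  open Quaternions
  open LagrangeMethod
  open FourSquareForms
  open import Data.Nat as ℕ using (ℕ; zero; suc; s≤s; z≤n)
  import Data.Nat.Properties as ℕₚ
  open import Data.Nat.Primality using (Prime; ¬prime[1])
  import Data.Nat.Tactic.RingSolver as ℕ-Solver
  open import Data.Integer as ℤ using (ℤ; +_; _+_; _*_; _-_; -_; 0ℤ; 1ℤ; _%ℕ_; _/ℕ_)
  import Data.Integer.Properties as ℤₚ
  open import Data.Integer.DivMod using (n%ℕd<d; a≡a%ℕn+[a/ℕn]*n)
  open import Data.Product using (_×_; _,_; ∃-syntax; proj₁; proj₂)
  open import Data.Sum using (_⊎_; inj₁; inj₂)
  open import Data.Empty using (⊥-elim)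
  open import Relation.Binary.PropositionalEquality using (_≡_; refl; sym; trans; cong; cong₂; subst; subst₂)
  open import Data.Integer.Tactic.RingSolver using (ring; solve-∀)
  open import Tactic.RingSolver.NonReflective ring using (solve; _⊜_; Κ; _⊕_; _⊗_; ⊝_)
  open Ops ℤOps using (_•_; _⊟v_; module Quaternion)

  n₃ : ℤ → ℤ → ℤ
  n₃ a b = a * a + a * b + b * b

  4n₃ : ∀ a b → + 4 * n₃ a b ≡ (+ 2 * a + b) * (+ 2 * a + b) + + 3 * (b * b)
  4n₃ = lem
    where
    lem : ∀ a b → + 4 * (a * a + a * b + b * b) ≡ (+ 2 * a + b) * (+ 2 * a + b) + + 3 * (b * b)
    lem = solve-∀

  n₃≥0 : ∀ a b → 0ℤ ℤ.≤ n₃ a b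
  n₃≥0 a b = ℤₚ.*-cancelˡ-≤-pos 0ℤ (n₃ a b) (+ 4) (subst (0ℤ ℤ.≤_) (sym (4n₃ a b))
    (+-nonneg (square-nonneg (+ 2 * a + b)) (*-nonneg {+ 3} (ℤ.+≤+ z≤n) (square-nonneg b))))

  n₃≡0 : ∀ a b → n₃ a b ≡ 0ℤ → a ≡ 0ℤ × b ≡ 0ℤ
  n₃≡0 a b eq = a≡0 , b≡0
    where
    split = nonneg-+≡0 (square-nonneg (+ 2 * a + b)) (*-nonneg {+ 3} (ℤ.+≤+ z≤n) (square-nonneg b)) (trans (sym (4n₃ a b)) (cong (+ 4 *_) eq))
    b≡0 : b ≡ 0ℤ
    b≡0 = square≡0 b (ℤₚ.*-cancelˡ-≡ (+ 3) (b * b) 0ℤ (proj₂ split))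
    a≡0 : a ≡ 0ℤ
    a≡0 = ℤₚ.*-cancelˡ-≡ (+ 2) a 0ℤ (trans (sym (ℤₚ.+-identityʳ (+ 2 * a))) (trans (cong (λ t → + 2 * a + t) (sym b≡0)) (square≡0 (+ 2 * a + b) (proj₁ split))))

  -- Covering radius of the hexagonal lattice, in terms of barycentric coordinates in a triangle of side k.
  barycentric : ∀ a b c → 0ℤ ℤ.≤ a → 0ℤ ℤ.≤ b → 0ℤ ℤ.≤ c → a ℤ.≤ c → b ℤ.≤ c → + 3 * n₃ a b ℤ.≤ (a + b + c) * (a + b + c)
  barycentric a b c 0≤a 0≤b 0≤c a≤c b≤c = ≤-by ((c - a) * (c + a + a) + (c - b) * (a + b + b))
    (+-nonneg (*-nonneg (ℤₚ.i≤j⇒0≤j-i a≤c) (+-nonneg (+-nonneg 0≤c 0≤a) 0≤a)) (*-nonneg (ℤₚ.i≤j⇒0≤j-i b≤c) (+-nonneg (+-nonneg 0≤a 0≤b) 0≤b)))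
    (lem a b c)
    where
    lem : ∀ a b c → (a + b + c) * (a + b + c) ≡ + 3 * (a * a + a * b + b * b) + ((c - a) * (c + a + a) + (c - b) * (a + b + b))
    lem = solve-∀

  -- The numbers s, t and k - s - t are barycentric coordinates in an equilateral triangle of
  -- lattice points; the vertex with the largest coordinate is close enough.
  hexagon-triangle : ∀ k s t → 0ℤ ℤ.≤ s → 0ℤ ℤ.≤ t → 0ℤ ℤ.≤ k - s - t →
    ∃[ i ] ∃[ j ] (+ 3 * n₃ (s - k * i) (t - k * j) ℤ.≤ k * k)
  hexagon-triangle k s t 0≤s 0≤t 0≤c = cases (ℤₚ.≤-total s c) (ℤₚ.≤-total t c) (ℤₚ.≤-total s t)
    where
    c = k - s - t
    goal : ∀ {x y} → x ≡ y → ∀ {z w} → z ≡ w → x ℤ.≤ z → y ℤ.≤ w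
    goal refl refl le = le
    at-0 : s ℤ.≤ c → t ℤ.≤ c → ∃[ i ] ∃[ j ] (+ 3 * n₃ (s - k * i) (t - k * j) ℤ.≤ k * k)
    at-0 p q = 0ℤ , 0ℤ , goal (l₁ k s t) (l₂ k s t) (barycentric s t c 0≤s 0≤t 0≤c p q)
      where
      l₁ : ∀ k s t → + 3 * (s * s + s * t + t * t) ≡ + 3 * ((s - k * 0ℤ) * (s - k * 0ℤ) + (s - k * 0ℤ) * (t - k * 0ℤ) + (t - k * 0ℤ) * (t - k * 0ℤ))
      l₁ = solve-∀
      l₂ : ∀ k s t → (s + t + (k - s - t)) * (s + t + (k - s - t)) ≡ k * k
      l₂ = solve-∀
    at-s : c ℤ.≤ s → t ℤ.≤ s → ∃[ i ] ∃[ j ] (+ 3 * n₃ (s - k * i) (t - k * j) ℤ.≤ k * k)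
    at-s p q = 1ℤ , 0ℤ , goal (l₁ k s t) (l₂ k s t) (barycentric c t s 0≤c 0≤t 0≤s p q)
      where
      l₁ : ∀ k s t → + 3 * ((k - s - t) * (k - s - t) + (k - s - t) * t + t * t) ≡ + 3 * ((s - k * 1ℤ) * (s - k * 1ℤ) + (s - k * 1ℤ) * (t - k * 0ℤ) + (t - k * 0ℤ) * (t - k * 0ℤ))
      l₁ = solve-∀
      l₂ : ∀ k s t → (k - s - t + t + s) * (k - s - t + t + s) ≡ k * k
      l₂ = solve-∀
    at-t : s ℤ.≤ t → c ℤ.≤ t → ∃[ i ] ∃[ j ] (+ 3 * n₃ (s - k * i) (t - k * j) ℤ.≤ k * k)
    at-t p q = 0ℤ , 1ℤ , goal (l₁ k s t) (l₂ k s t) (barycentric s c t 0≤s 0≤c 0≤t p q)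
      where
      l₁ : ∀ k s t → + 3 * (s * s + s * (k - s - t) + (k - s - t) * (k - s - t)) ≡ + 3 * ((s - k * 0ℤ) * (s - k * 0ℤ) + (s - k * 0ℤ) * (t - k * 1ℤ) + (t - k * 1ℤ) * (t - k * 1ℤ))
      l₁ = solve-∀
      l₂ : ∀ k s t → (s + (k - s - t) + t) * (s + (k - s - t) + t) ≡ k * k
      l₂ = solve-∀
    cases : s ℤ.≤ c ⊎ c ℤ.≤ s → t ℤ.≤ c ⊎ c ℤ.≤ t → s ℤ.≤ t ⊎ t ℤ.≤ s → ∃[ i ] ∃[ j ] (+ 3 * n₃ (s - k * i) (t - k * j) ℤ.≤ k * k)
    cases (inj₁ p) (inj₁ q) _ = at-0 p q
    cases (inj₁ p) (inj₂ q) _ = at-t (ℤₚ.≤-trans p q) q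
    cases (inj₂ p) (inj₁ q) _ = at-s p (ℤₚ.≤-trans q p)
    cases (inj₂ p) (inj₂ q) (inj₁ r) = at-t r q
    cases (inj₂ p) (inj₂ q) (inj₂ r) = at-s p r

  -- The remainders lie in a rhombus of side k made of two triangles; the point reflection (s, t) ↦
  -- (k - s, k - t) carries the second onto the first.
  hexagon : ∀ (k : ℕ) .{{_ : ℕ.NonZero k}} a b → ∃[ i ] ∃[ j ] (+ 3 * n₃ (a - + k * i) (b - + k * j) ℤ.≤ + k * + k)
  hexagon k a b = cases (ℤₚ.≤-total (s + t) κ)
    where
    κ s t : ℤ
    κ = + k
    s = + (a %ℕ k)
    t = + (b %ℕ k)
    p = a /ℕ k
    q = b /ℕ k
    Goal = ∃[ i ] ∃[ j ] (+ 3 * n₃ (a - κ * i) (b - κ * j) ℤ.≤ κ * κ)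
    s<k : s ℤ.≤ κ
    s<k = ℤ.+≤+ (ℕₚ.<⇒≤ (n%ℕd<d a k))
    t<k : t ℤ.≤ κ
    t<k = ℤ.+≤+ (ℕₚ.<⇒≤ (n%ℕd<d b k))
    lem : ∀ r p κ i → r - κ * i ≡ (r + p * κ) - κ * (p + i)
    lem = solve-∀
    lem⁻ : ∀ r p κ i → - ((κ - r) - κ * i) ≡ (r + p * κ) - κ * (p + 1ℤ - i)
    lem⁻ = solve-∀
    a≡ = a≡a%ℕn+[a/ℕn]*n a k
    b≡ = a≡a%ℕn+[a/ℕn]*n b k
    neg : ∀ x y → + 3 * (- x * - x + - x * - y + - y * - y) ≡ + 3 * (x * x + x * y + y * y)
    neg = solve-∀
    swap₁ : ∀ κ s t → κ - (s + t) ≡ κ - s - t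
    swap₁ = solve-∀
    swap₂ : ∀ κ s t → s + t - κ ≡ κ - (κ - s) - (κ - t)
    swap₂ = solve-∀
    cases : s + t ℤ.≤ κ ⊎ κ ℤ.≤ s + t → Goal
    cases (inj₁ le) =
      let i , j , le′ = hexagon-triangle κ s t (ℤ.+≤+ z≤n) (ℤ.+≤+ z≤n) (subst (0ℤ ℤ.≤_) (swap₁ κ s t) (ℤₚ.i≤j⇒0≤j-i le))
      in p + i , q + j , subst₂ (λ x y → + 3 * n₃ x y ℤ.≤ κ * κ)
           (trans (lem s p κ i) (cong (_- κ * (p + i)) (sym a≡))) (trans (lem t q κ j) (cong (_- κ * (q + j)) (sym b≡))) le′
    cases (inj₂ le) =
      let i , j , le′ = hexagon-triangle κ (κ - s) (κ - t) (ℤₚ.i≤j⇒0≤j-i s<k) (ℤₚ.i≤j⇒0≤j-i t<k) (subst (0ℤ ℤ.≤_) (swap₂ κ s t) (ℤₚ.i≤j⇒0≤j-i le))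
      in p + 1ℤ - i , q + 1ℤ - j , subst₂ (λ x y → + 3 * n₃ x y ℤ.≤ κ * κ)
           (trans (lem⁻ s p κ i) (cong (_- κ * (p + 1ℤ - i)) (sym a≡))) (trans (lem⁻ t q κ j) (cong (_- κ * (q + 1ℤ - j)) (sym b≡)))
           (subst (ℤ._≤ κ * κ) (sym (neg ((κ - s) - κ * i) ((κ - t) - κ * j))) le′)

  module Order5 where
    open Descent 1ℤ 1ℤ (+ 2) 1ℤ public

    -- Completing the square over ℤ[ω]: the first summand comes from the orthogonal projection to
    -- the plane of ℤ[ω], which has denominator 3, and the rest is (5/3) n₃(z, w).
    9norm : ∀ x y z w → + 9 * norm ⟨ x , y , z , w ⟩ ≡ n₃ (+ 3 * x + z + + 2 * w) (+ 3 * y - + 2 * z - w) + + 15 * n₃ z w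
    9norm = solve 4 (λ x y z w → let n = λ a b → a ⊗ a ⊕ a ⊗ b ⊕ b ⊗ b in
      (Κ (+ 9) ⊗ Ops.Quaternion.norm (exprOps 4) (Κ 1ℤ) (Κ 1ℤ) (Κ (+ 2)) (Κ 1ℤ) ⟨ x , y , z , w ⟩)
        ⊜ (n (Κ (+ 3) ⊗ x ⊕ z ⊕ Κ (+ 2) ⊗ w) (Κ (+ 3) ⊗ y ⊕ ⊝ (Κ (+ 2) ⊗ z) ⊕ ⊝ w) ⊕ Κ (+ 15) ⊗ n z w)) refl

    norm≥0 : ∀ v → 0ℤ ℤ.≤ norm v
    norm≥0 v@(⟨ x , y , z , w ⟩) = ℤₚ.*-cancelˡ-≤-pos 0ℤ (norm v) (+ 9) (subst (0ℤ ℤ.≤_) (sym (9norm x y z w))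
      (+-nonneg (n₃≥0 (+ 3 * x + z + + 2 * w) (+ 3 * y - + 2 * z - w)) (*-nonneg {+ 15} (ℤ.+≤+ z≤n) (n₃≥0 z w))))

    norm≡0 : ∀ v → norm v ≡ 0ℤ → v ≡ ⟨ 0ℤ , 0ℤ , 0ℤ , 0ℤ ⟩
    norm≡0 ⟨ x , y , z , w ⟩ eq = vec-≡ (cancel3 x (trans (lem₁ x z w) (cong₂ (λ e t → e - t) (proj₁ e≡0) (cong₂ (λ z w → z + + 2 * w) z≡0 w≡0))))
                                       (cancel3 y (trans (lem₂ y z w) (cong₂ (λ e t → e + t) (proj₂ e≡0) (cong₂ (λ z w → + 2 * z + w) z≡0 w≡0)))) z≡0 w≡0
      where
      parts = nonneg-+≡0 (n₃≥0 (+ 3 * x + z + + 2 * w) (+ 3 * y - + 2 * z - w)) (*-nonneg {+ 15} (ℤ.+≤+ z≤n) (n₃≥0 z w))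
                (trans (sym (9norm x y z w)) (cong (+ 9 *_) eq))
      zw≡0 = n₃≡0 z w (ℤₚ.*-cancelˡ-≡ (+ 15) (n₃ z w) 0ℤ (proj₂ parts))
      z≡0 = proj₁ zw≡0
      w≡0 = proj₂ zw≡0
      e≡0 = n₃≡0 (+ 3 * x + z + + 2 * w) (+ 3 * y - + 2 * z - w) (proj₁ parts)
      cancel3 : ∀ x → + 3 * x ≡ 0ℤ → x ≡ 0ℤ
      cancel3 x = ℤₚ.*-cancelˡ-≡ (+ 3) x 0ℤ
      lem₁ : ∀ x z w → + 3 * x ≡ (+ 3 * x + z + + 2 * w) - (z + + 2 * w)
      lem₁ = solve-∀
      lem₂ : ∀ y z w → + 3 * y ≡ (+ 3 * y - + 2 * z - w) + (+ 2 * z + w)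
      lem₂ = solve-∀

    open Reduction norm≥0 norm≡0

    -- This is x + y g + z J + w gJ, where g² = -2, J² = -5 and g, J anticommute; these four
    -- elements are orthogonal of norms 1, 2, 5, 10.
    embed : ℤ → ℤ → ℤ → ℤ → Vℤ
    embed x y z w = ⟨ x - z - + 2 * w , + 4 * w , y + w - z , + 2 * z ⟩

    norm-embed : ∀ x y z w → norm (embed x y z w) ≡ x * x + + 2 * (y * y) + + 5 * (z * z) + + 10 * (w * w)
    norm-embed = solve 4 (λ x y z w →
      Ops.Quaternion.norm (exprOps 4) (Κ 1ℤ) (Κ 1ℤ) (Κ (+ 2)) (Κ 1ℤ) ⟨ x ⊕ ⊝ z ⊕ ⊝ (Κ (+ 2) ⊗ w) , Κ (+ 4) ⊗ w , y ⊕ w ⊕ ⊝ z , Κ (+ 2) ⊗ z ⟩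
        ⊜ (x ⊗ x ⊕ Κ (+ 2) ⊗ (y ⊗ y) ⊕ Κ (+ 5) ⊗ (z ⊗ z) ⊕ Κ (+ 10) ⊗ (w ⊗ w))) refl

    -- The norm of x + y g + J is x² + 2y² + 5. The differences of 2y² are 2d (d + 2i), again with
    -- both factors below p. The size bound is sharp for p = 3, where 1 + 2 + 5 = 8 < 9.
    start : ∀ h → Prime (suc (h ℕ.+ h)) → ∃[ k ] (0 ℕ.< k × k ℕ.< suc (h ℕ.+ h) × Represented (k ℕ.* suc (h ℕ.+ h)))
    start zero pr = ⊥-elim (¬prime[1] pr)
    start h@(suc h′) pr with Pigeonhole.meet h (λ x → + x * + x) (λ y → - (+ 2 * (+ y * + y) + + 5)) (squares-injective h pr) injective
      where
      lem : ∀ d i → (d + d) * (d + (i + i)) ≡ - (- (+ 2 * ((d + i) * (d + i)) + + 5) - - (+ 2 * (i * i) + + 5))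
      lem = solve-∀
      injective : Pigeonhole.Injective h (λ y → - (+ 2 * (+ y * + y) + + 5))
      injective i d 0<d d+i≤h q eq = prime∤product pr (d ℕ.+ d) (d ℕ.+ (i ℕ.+ i)) (ℕₚ.≤-trans 0<d (ℕₚ.m≤m+n d d))
        (s≤s (ℕₚ.+-mono-≤ d≤h d≤h)) (ℕₚ.≤-trans 0<d (ℕₚ.m≤m+n d _)) (s≤s small) (- q)
        (trans (ℤₚ.pos-* (d ℕ.+ d) _) (trans (lem (+ d) (+ i)) (trans (cong -_ eq) (ℤₚ.neg-distribˡ-* q _))))
        where
        d≤h = ℕₚ.≤-trans (ℕₚ.m≤m+n d i) d+i≤h
        small : d ℕ.+ (i ℕ.+ i) ℕ.≤ h ℕ.+ h
        small = ℕₚ.≤-trans (ℕₚ.≤-reflexive (sym (ℕₚ.+-assoc d i i))) (ℕₚ.+-mono-≤ d+i≤h (ℕₚ.≤-trans (ℕₚ.m≤n+m i d) d+i≤h))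
    ... | x , y , q , x≤h , y≤h , eq with small-multiple (x ℕ.* x ℕ.+ (2 ℕ.* (y ℕ.* y) ℕ.+ 5)) (suc (h ℕ.+ h)) q
      (ℕₚ.≤-trans (s≤s z≤n) (ℕₚ.≤-trans (ℕₚ.m≤n+m 5 (2 ℕ.* (y ℕ.* y))) (ℕₚ.m≤n+m _ (x ℕ.* x)))) bound value
      where
      value : + (x ℕ.* x ℕ.+ (2 ℕ.* (y ℕ.* y) ℕ.+ 5)) ≡ q * + suc (h ℕ.+ h)
      value = trans (cong₂ (λ s t → s + (t + + 5)) (ℤₚ.pos-* x x) (trans (ℤₚ.pos-* 2 (y ℕ.* y)) (cong (+ 2 *_) (ℤₚ.pos-* y y)))) (trans (lem (+ x * + x) (+ y * + y)) eq)
        where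
        lem : ∀ s t → s + (+ 2 * t + + 5) ≡ s - - (+ 2 * t + + 5)
        lem = solve-∀
      bound : x ℕ.* x ℕ.+ (2 ℕ.* (y ℕ.* y) ℕ.+ 5) ℕ.< suc (h ℕ.+ h) ℕ.* suc (h ℕ.+ h)
      bound = ℕₚ.≤-trans (s≤s (ℕₚ.+-mono-≤ (half-bounds x≤h) (ℕₚ.+-monoˡ-≤ 5 (ℕₚ.*-monoʳ-≤ 2 (half-bounds y≤h)))))
                (ℕₚ.≤-trans (ℕₚ.m≤m+n _ (h′ ℕ.* h′ ℕ.+ h′ ℕ.* 6)) (ℕₚ.≤-reflexive (lem h′)))
        where
        lem : ∀ h′ → suc (suc h′ ℕ.* suc h′ ℕ.+ (2 ℕ.* (suc h′ ℕ.* suc h′) ℕ.+ 5)) ℕ.+ (h′ ℕ.* h′ ℕ.+ h′ ℕ.* 6) ≡ suc (suc h′ ℕ.+ suc h′) ℕ.* suc (suc h′ ℕ.+ suc h′)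
        lem = ℕ-Solver.solve-∀
    ... | k , 0<k , k<p , V≡ = k , 0<k , k<p , embed (+ x) (+ y) 1ℤ 0ℤ ,
      trans (norm-embed (+ x) (+ y) 1ℤ 0ℤ) (trans (lem (+ x) (+ y))
        (trans (sym (cong₂ (λ s t → s + (t + + 5)) (ℤₚ.pos-* x x) (trans (ℤₚ.pos-* 2 (y ℕ.* y)) (cong (+ 2 *_) (ℤₚ.pos-* y y))))) (cong +_ V≡)))
      where
      lem : ∀ x y → x * x + + 2 * (y * y) + + 5 * (1ℤ * 1ℤ) + + 10 * (0ℤ * 0ℤ) ≡ x * x + (+ 2 * (y * y) + + 5)
      lem = solve-∀

    -- 27 norm r ≤ (9 + 15) k² once both hexagonal coordinates of r are reduced.
    euclidean : ∀ (k : ℕ) → 0 ℕ.< k → ∀ v → ∃[ q ] (norm (v ⊟v (+ k • q)) ℤ.< + k * + k)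
    euclidean k 0<k ⟨ x , y , z , w ⟩ = ⟨ q₁ , q₂ , q₃ , q₄ ⟩ ,
      ℤₚ.*-cancelˡ-<-nonNeg (+ 27) (ℤₚ.≤-<-trans total strict)
      where
      instance
        k≢0 : ℕ.NonZero k
        k≢0 = ℕ.>-nonZero 0<k
        3k≢0 : ℕ.NonZero (3 ℕ.* k)
        3k≢0 = ℕ.>-nonZero (ℕₚ.≤-trans 0<k (ℕₚ.m≤m+n k _))
      κ = + k
      hex₁ = hexagon k z w
      q₃ = proj₁ hex₁
      q₄ = proj₁ (proj₂ hex₁)
      z′ = z - κ * q₃
      w′ = w - κ * q₄
      -- With z and w already fixed, changing x and y by multiples of k moves the projected
      -- coordinates by multiples of 3k, so the second rounding has modulus 3k.
      hex₂ = hexagon (3 ℕ.* k) (+ 3 * x + z′ + + 2 * w′) (+ 3 * y - + 2 * z′ - w′)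
      q₁ = proj₁ hex₂
      q₂ = proj₁ (proj₂ hex₂)
      x′ = x - κ * q₁
      y′ = y - κ * q₂
      N = norm ⟨ x′ , y′ , z′ , w′ ⟩
      e₁ = + 3 * x′ + z′ + + 2 * w′
      e₂ = + 3 * y′ - + 2 * z′ - w′
      b₁ : + 3 * n₃ z′ w′ ℤ.≤ κ * κ
      b₁ = proj₂ (proj₂ hex₁)
      b₂ : + 3 * n₃ e₁ e₂ ℤ.≤ (+ 3 * κ) * (+ 3 * κ)
      b₂ = subst₂ (λ a b → + 3 * n₃ a b ℤ.≤ (+ 3 * κ) * (+ 3 * κ)) (l₁ x z′ w′ κ q₁) (l₂ y z′ w′ κ q₂)
        (subst (λ K → + 3 * n₃ (+ 3 * x + z′ + + 2 * w′ - K * q₁) (+ 3 * y - + 2 * z′ - w′ - K * q₂) ℤ.≤ K * K) (ℤₚ.pos-* 3 k) (proj₂ (proj₂ hex₂)))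
        where
        l₁ : ∀ x z w κ q → + 3 * x + z + + 2 * w - (+ 3 * κ) * q ≡ + 3 * (x - κ * q) + z + + 2 * w
        l₁ = solve-∀
        l₂ : ∀ y z w κ q → + 3 * y - + 2 * z - w - (+ 3 * κ) * q ≡ + 3 * (y - κ * q) - + 2 * z - w
        l₂ = solve-∀
      total : + 27 * N ℤ.≤ (+ 3 * κ) * (+ 3 * κ) + + 15 * (κ * κ)
      total = subst (ℤ._≤ (+ 3 * κ) * (+ 3 * κ) + + 15 * (κ * κ)) (sym 27N) (ℤₚ.+-mono-≤ b₂ (ℤₚ.*-monoˡ-≤-nonNeg (+ 15) b₁))
        where
        l₁ : ∀ N → + 27 * N ≡ + 3 * (+ 9 * N)
        l₁ = solve-∀
        l₂ : ∀ a b → + 3 * (a + + 15 * b) ≡ + 3 * a + + 15 * (+ 3 * b)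
        l₂ = solve-∀
        27N : + 27 * N ≡ + 3 * n₃ e₁ e₂ + + 15 * (+ 3 * n₃ z′ w′)
        27N = trans (l₁ N) (trans (cong (+ 3 *_) (9norm x′ y′ z′ w′)) (l₂ (n₃ e₁ e₂) (n₃ z′ w′)))
      K>0 : 1ℤ ℤ.≤ κ * κ
      K>0 = subst (1ℤ ℤ.≤_) (ℤₚ.pos-* k k) (ℤ.+≤+ (ℕₚ.*-mono-≤ 0<k 0<k))
      strict : (+ 3 * κ) * (+ 3 * κ) + + 15 * (κ * κ) ℤ.< + 27 * (κ * κ)
      strict = <-by (+ 2 * (κ * κ) + (κ * κ - 1ℤ)) (+-nonneg (*-nonneg {+ 2} (ℤ.+≤+ z≤n) (square-nonneg κ)) (ℤₚ.i≤j⇒0≤j-i K>0)) (lem κ)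
        where
        lem : ∀ κ → + 27 * (κ * κ) ≡ (1ℤ + ((+ 3 * κ) * (+ 3 * κ) + + 15 * (κ * κ))) + (+ 2 * (κ * κ) + (κ * κ - 1ℤ))
        lem = solve-∀

    descend : ∀ p k → Prime p → 1 ℕ.< k → k ℕ.< p → Represented (k ℕ.* p) →
              ∃[ k′ ] (0 ℕ.< k′ × k′ ℕ.< k × Represented (k′ ℕ.* p))
    descend p k pr 1<k k<p (v , normv) =
      let q , small = euclidean k (ℕₚ.<⇒≤ 1<k) v
          k′ , 0<k′ , normr , rep′ = reduce p k v q pr 1<k k<p normv
      in k′ , 0<k′ , quotient-< k k′ (norm (v ⊟v (+ k • q))) normr small , rep′

    represents : ∀ m → 1 ℕ.≤ m → Represented m
    represents = Universality.universal Represented (⟨ 1ℤ , 0ℤ , 0ℤ , 0ℤ ⟩ , refl) (⟨ 0ℤ , 0ℤ , 1ℤ , 0ℤ ⟩ , refl)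
      (λ {a} {b} → represented-* {a} {b}) start descend

-- Finite checks modulo 3, 4 and 5 in the order of discriminant 5.

module Residues where
  open Quaternions
  open LagrangeMethod
  open DiscriminantFive
  open import Data.Nat as ℕ using (ℕ; zero; suc; s≤s; z≤n)
  open import Data.Integer using (ℤ; +_; _+_; _*_; _-_; -_; 0ℤ; 1ℤ; _%ℕ_; _/ℕ_)
  import Data.Integer.Properties as ℤₚ
  open import Data.Fin using (Fin; zero; suc; toℕ; fromℕ<)
  import Data.Fin.Properties as Finₚ
  open import Data.Unit using (tt)
  open import Relation.Nullary.Decidable using (Dec; toWitness; _×-dec_; _⊎-dec_; _→-dec_; ¬?)
  open import Data.Integer.DivMod using (n%ℕd<d; a≡a%ℕn+[a/ℕn]*n)
  open import Data.Product using (_×_; _,_; ∃-syntax; proj₁; proj₂)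
  open import Data.Sum using (_⊎_)
  open import Data.Empty using (⊥-elim)
  open import Relation.Binary.PropositionalEquality using (_≡_; _≢_; refl; sym; trans; cong; cong₂; subst)
  open import Data.Integer.Tactic.RingSolver using (ring; solve-∀)
  open import Tactic.RingSolver.NonReflective ring using (solve; _⊜_; Expr; Κ)
  open Ops ℤOps using (_•_; _⊟v_; module Quaternion)

  module Form12510 where
    open Order5 using (norm; mul; conj; embed; norm-embed; Represented; represents)

    Form : ℤ → Set
    Form m = ∃[ x ] ∃[ y ] ∃[ z ] ∃[ w ] (x * x + + 2 * (y * y) + + 5 * (z * z) + + 10 * (w * w) ≡ m)

    -- The image of embed, which is the order generated by g and J, has index 8.
    InL : Vℤ → Set
    InL v = (∃[ e ] (V4.c₂ v ≡ + 4 * e)) × (∃[ f ] (V4.c₄ v ≡ + 2 * f))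

    inL⇒form : ∀ v → InL v → Form (norm v)
    inL⇒form ⟨ a , _ , c , _ ⟩ ((w , refl) , (z , refl)) = a + z + + 2 * w , c - w + z , z , w ,
      trans (sym (norm-embed (a + z + + 2 * w) (c - w + z) z w))
        (cong₂ (λ a c → norm ⟨ a , + 4 * w , c , + 2 * z ⟩) (lem₁ a z w) (lem₂ c z w))
      where
      lem₁ : ∀ a z w → a + z + + 2 * w - z - + 2 * w ≡ a
      lem₁ = solve-∀
      lem₂ : ∀ c z w → c - w + z + w - z ≡ c
      lem₂ = solve-∀

    double : ∀ {m} → Form m → Form (m + m)
    double (x , y , z , w , refl) = + 2 * y , x , + 2 * w , z , lem x y z w
      where
      lem : ∀ x y z w → (+ 2 * y) * (+ 2 * y) + + 2 * (x * x) + + 5 * ((+ 2 * w) * (+ 2 * w)) + + 10 * (z * z)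
        ≡ (x * x + + 2 * (y * y) + + 5 * (z * z) + + 10 * (w * w)) + (x * x + + 2 * (y * y) + + 5 * (z * z) + + 10 * (w * w))
      lem = solve-∀

    rem : ℤ → (d : ℕ) .{{_ : ℕ.NonZero d}} → Fin d
    rem a d = fromℕ< (n%ℕd<d a d)

    divide : ∀ a d .{{_ : ℕ.NonZero d}} → a - + d * (a /ℕ d) ≡ + toℕ (rem a d)
    divide a d = trans (cong (_- + d * (a /ℕ d)) (a≡a%ℕn+[a/ℕn]*n a d))
      (trans (lem (+ (a %ℕ d)) (a /ℕ d) (+ d)) (cong +_ (sym (Finₚ.toℕ-fromℕ< (n%ℕd<d a d)))))
      where
      lem : ∀ r q d → (r + q * d) - d * q ≡ r
      lem = solve-∀

    exact : ∀ a d .{{_ : ℕ.NonZero d}} {r} → a %ℕ d ≡ r → a ≡ + r + (a /ℕ d) * + d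
    exact a d refl = a≡a%ℕn+[a/ℕn]*n a d

    -- As -2 is not a square modulo 5, x² + 2y² ≡ 0 forces x = 5p and y = 5q. Dividing by 5 leaves
    -- z² + 2w² + 5p² + 10q², the same form with the two halves exchanged.
    five : ∀ {m} → Form (+ 5 * m) → Form m
    five {m} (x , y , z , w , eq) = z , w , x /ℕ 5 , y /ℕ 5 , ℤₚ.*-cancelˡ-≡ (+ 5) _ m (trans (lem (x /ℕ 5) (y /ℕ 5) z w)
        (trans (cong₂ (λ x y → x * x + + 2 * (y * y) + + 5 * (z * z) + + 10 * (w * w)) (sym x≡) (sym y≡)) eq))
      where
      table : ∀ (a b : Fin 5) → (+ toℕ a * + toℕ a + + 2 * (+ toℕ b * + toℕ b)) %ℕ 5 ≡ 0 → toℕ a ≡ 0 × toℕ b ≡ 0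
      table = toWitness {a? = Finₚ.all? λ a → Finₚ.all? λ b → (_ ℕ.≟ 0) →-dec ((toℕ a ℕ.≟ 0) ×-dec (toℕ b ℕ.≟ 0))} tt
      a b : ℤ
      a = + toℕ (rem x 5)
      b = + toℕ (rem y 5)
      p q : ℤ
      p = x /ℕ 5
      q = y /ℕ 5
      back : ∀ x → x ≡ + 5 * (x /ℕ 5) + + toℕ (rem x 5)
      back x = trans (lem′ x (+ 5 * (x /ℕ 5))) (cong (λ t → + 5 * (x /ℕ 5) + t) (divide x 5))
        where
        lem′ : ∀ x t → x ≡ t + (x - t)
        lem′ = solve-∀
      multiple : ∀ s → (s * + 5) %ℕ 5 ≡ 0
      multiple s with (s * + 5) %ℕ 5 in eq | n%ℕd<d (s * + 5) 5
      ... | zero | _ = refl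
      ... | suc r | r<5 = ⊥-elim (∣-bounded 5 (suc r) (s - (s * + 5) /ℕ 5) (s≤s z≤n) r<5
              (trans (lem′ (+ suc r) ((s * + 5) /ℕ 5)) (trans (cong (λ t → t - ((s * + 5) /ℕ 5) * + 5) (sym (exact (s * + 5) 5 eq))) (lem″ s ((s * + 5) /ℕ 5)))))
        where
        lem′ : ∀ r q → r ≡ (r + q * + 5) - q * + 5
        lem′ = solve-∀
        lem″ : ∀ s q → s * + 5 - q * + 5 ≡ (s - q) * + 5
        lem″ = solve-∀
      S : ℤ
      S = m - z * z - + 2 * (w * w) - + 5 * (p * p) - + 2 * (p * a) - + 10 * (q * q) - + 4 * (q * b)
      small : a * a + + 2 * (b * b) ≡ S * + 5
      small = trans (l₁ a b p q z w) (trans (cong (λ V → V - rest) (trans (cong₂ (λ x y → x * x + + 2 * (y * y) + + 5 * (z * z) + + 10 * (w * w)) (sym (back x)) (sym (back y))) eq)) (l₂ a b p q z w m))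
        where
        rest = + 5 * (z * z) + + 10 * (w * w) + + 25 * (p * p) + + 10 * (p * a) + + 50 * (q * q) + + 20 * (q * b)
        l₁ : ∀ a b p q z w → a * a + + 2 * (b * b) ≡ ((+ 5 * p + a) * (+ 5 * p + a) + + 2 * ((+ 5 * q + b) * (+ 5 * q + b)) + + 5 * (z * z) + + 10 * (w * w))
          - (+ 5 * (z * z) + + 10 * (w * w) + + 25 * (p * p) + + 10 * (p * a) + + 50 * (q * q) + + 20 * (q * b))
        l₁ = solve-∀
        l₂ : ∀ a b p q z w m → + 5 * m - (+ 5 * (z * z) + + 10 * (w * w) + + 25 * (p * p) + + 10 * (p * a) + + 50 * (q * q) + + 20 * (q * b))
          ≡ (m - z * z - + 2 * (w * w) - + 5 * (p * p) - + 2 * (p * a) - + 10 * (q * q) - + 4 * (q * b)) * + 5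
        l₂ = solve-∀
      zeros = table (rem x 5) (rem y 5) (trans (cong (_%ℕ 5) small) (multiple S))
      x≡ : x ≡ + 5 * p
      x≡ = trans (back x) (trans (cong (λ t → + 5 * p + + t) (proj₁ zeros)) (ℤₚ.+-identityʳ (+ 5 * p)))
      y≡ : y ≡ + 5 * q
      y≡ = trans (back y) (trans (cong (λ t → + 5 * q + + t) (proj₂ zeros)) (ℤₚ.+-identityʳ (+ 5 * q)))
      lem : ∀ p q z w → + 5 * (z * z + + 2 * (w * w) + + 5 * (p * p) + + 10 * (q * q)) ≡ (+ 5 * p) * (+ 5 * p) + + 2 * ((+ 5 * q) * (+ 5 * q)) + + 5 * (z * z) + + 10 * (w * w)
      lem = solve-∀

    mul-subˡ : ∀ k u v q → mul u (v ⊟v (k • q)) ≡ mul u v ⊟v (k • mul u q)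
    mul-subˡ k ⟨ a , b , c , d ⟩ ⟨ x , y , z , w ⟩ ⟨ x′ , y′ , z′ , w′ ⟩ = vec-≡
      (solve 13 (λ a b c d x y z w x′ y′ z′ w′ k → E.side V4.c₁ a b c d x y z w x′ y′ z′ w′ k) refl a b c d x y z w x′ y′ z′ w′ k)
      (solve 13 (λ a b c d x y z w x′ y′ z′ w′ k → E.side V4.c₂ a b c d x y z w x′ y′ z′ w′ k) refl a b c d x y z w x′ y′ z′ w′ k)
      (solve 13 (λ a b c d x y z w x′ y′ z′ w′ k → E.side V4.c₃ a b c d x y z w x′ y′ z′ w′ k) refl a b c d x y z w x′ y′ z′ w′ k)
      (solve 13 (λ a b c d x y z w x′ y′ z′ w′ k → E.side V4.c₄ a b c d x y z w x′ y′ z′ w′ k) refl a b c d x y z w x′ y′ z′ w′ k)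
      where
      module E where
        open Ops (exprOps 13) using () renaming (_•_ to _•ₑ_; _⊟v_ to _⊟ₑ_)
        open Ops.Quaternion (exprOps 13) (Κ 1ℤ) (Κ 1ℤ) (Κ (+ 2)) (Κ 1ℤ) using () renaming (mul to mulₑ)
        side : (V4 (Expr ℤ 13) → Expr ℤ 13) → (a b c d x y z w x′ y′ z′ w′ k : Expr ℤ 13) → Expr ℤ 13 × Expr ℤ 13
        side π a b c d x y z w x′ y′ z′ w′ k =
          π (mulₑ ⟨ a , b , c , d ⟩ (⟨ x , y , z , w ⟩ ⊟ₑ (k •ₑ ⟨ x′ , y′ , z′ , w′ ⟩)))
            ⊜ π (mulₑ ⟨ a , b , c , d ⟩ ⟨ x , y , z , w ⟩ ⊟ₑ (k •ₑ mulₑ ⟨ a , b , c , d ⟩ ⟨ x′ , y′ , z′ , w′ ⟩))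

    mul-subʳ : ∀ k u v q → mul (v ⊟v (k • q)) u ≡ mul v u ⊟v (k • mul q u)
    mul-subʳ k ⟨ a , b , c , d ⟩ ⟨ x , y , z , w ⟩ ⟨ x′ , y′ , z′ , w′ ⟩ = vec-≡
      (solve 13 (λ a b c d x y z w x′ y′ z′ w′ k → E.side V4.c₁ a b c d x y z w x′ y′ z′ w′ k) refl a b c d x y z w x′ y′ z′ w′ k)
      (solve 13 (λ a b c d x y z w x′ y′ z′ w′ k → E.side V4.c₂ a b c d x y z w x′ y′ z′ w′ k) refl a b c d x y z w x′ y′ z′ w′ k)
      (solve 13 (λ a b c d x y z w x′ y′ z′ w′ k → E.side V4.c₃ a b c d x y z w x′ y′ z′ w′ k) refl a b c d x y z w x′ y′ z′ w′ k)
      (solve 13 (λ a b c d x y z w x′ y′ z′ w′ k → E.side V4.c₄ a b c d x y z w x′ y′ z′ w′ k) refl a b c d x y z w x′ y′ z′ w′ k)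
      where
      module E where
        open Ops (exprOps 13) using () renaming (_•_ to _•ₑ_; _⊟v_ to _⊟ₑ_)
        open Ops.Quaternion (exprOps 13) (Κ 1ℤ) (Κ 1ℤ) (Κ (+ 2)) (Κ 1ℤ) using () renaming (mul to mulₑ)
        side : (V4 (Expr ℤ 13) → Expr ℤ 13) → (a b c d x y z w x′ y′ z′ w′ k : Expr ℤ 13) → Expr ℤ 13 × Expr ℤ 13
        side π a b c d x y z w x′ y′ z′ w′ k =
          π (mulₑ (⟨ x , y , z , w ⟩ ⊟ₑ (k •ₑ ⟨ x′ , y′ , z′ , w′ ⟩)) ⟨ a , b , c , d ⟩)
            ⊜ π (mulₑ ⟨ x , y , z , w ⟩ ⟨ a , b , c , d ⟩ ⊟ₑ (k •ₑ mulₑ ⟨ x′ , y′ , z′ , w′ ⟩ ⟨ a , b , c , d ⟩))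

    sandwich : Vℤ → Vℤ → Vℤ → Vℤ
    sandwich a b v = mul (mul a v) b

    sandwich-sub : ∀ k a b v q → sandwich a b (v ⊟v (k • q)) ≡ sandwich a b v ⊟v (k • sandwich a b q)
    sandwich-sub k a b v q = trans (cong (λ u → mul u b) (mul-subˡ k a v q)) (mul-subʳ k b (mul a v) (mul a q))

    norm-sandwich : ∀ a b v → norm (sandwich a b v) ≡ norm a * norm v * norm b
    norm-sandwich a b v = trans (norm-mul 1ℤ 1ℤ (+ 2) 1ℤ (mul a v) b) (cong (_* norm b) (norm-mul 1ℤ 1ℤ (+ 2) 1ℤ a v))

    -- The units, up to sign: powers of a sixth root of unity ω.
    U : Fin 3 → Vℤ
    U zero = ⟨ 1ℤ , 0ℤ , 0ℤ , 0ℤ ⟩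
    U (suc zero) = ⟨ 0ℤ , 1ℤ , 0ℤ , 0ℤ ⟩
    U (suc (suc zero)) = ⟨ - 1ℤ , 1ℤ , 0ℤ , 0ℤ ⟩

    norm-U : ∀ i → norm (U i) ≡ 1ℤ
    norm-U zero = refl
    norm-U (suc zero) = refl
    norm-U (suc (suc zero)) = refl

    -- J² = −5, and J anticommutes with g = ⟨ 0 , 0 , 1 , 0 ⟩, where g² = −2.
    J : Vℤ
    J = ⟨ - 1ℤ , 0ℤ , - 1ℤ , + 2 ⟩

    fromFin : ∀ {d} (a b c e : Fin d) → Vℤ
    fromFin a b c e = ⟨ + toℕ a , + toℕ b , + toℕ c , + toℕ e ⟩

    -- Decidable versions by remainders. The bad elements are those congruent to ±√-3 modulo 4,
    -- where √-3 = 2ω - 1. Multiplied by units from both sides they stay ±√-3 times a power of ω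
    -- modulo 4, whose second coordinate is never divisible by 4.
    InLᵣ Badᵣ : Vℤ → Set
    InLᵣ v = V4.c₂ v %ℕ 4 ≡ 0 × V4.c₄ v %ℕ 2 ≡ 0
    Badᵣ v = V4.c₁ v %ℕ 2 ≡ 1 × V4.c₂ v %ℕ 4 ≡ 2 × V4.c₃ v %ℕ 4 ≡ 0 × V4.c₄ v %ℕ 4 ≡ 0

    Outcome : Vℤ → Set
    Outcome v = (∃[ i ] ∃[ k ] InLᵣ (sandwich (U i) (U k) v)) ⊎ (∃[ i ] Badᵣ (mul (U i) v)) ⊎ (∃[ i ] Badᵣ (mul (mul (U i) J) v))

    inLᵣ? : ∀ v → Dec (InLᵣ v)
    inLᵣ? v = (V4.c₂ v %ℕ 4 ℕ.≟ 0) ×-dec (V4.c₄ v %ℕ 2 ℕ.≟ 0)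

    badᵣ? : ∀ v → Dec (Badᵣ v)
    badᵣ? v = (V4.c₁ v %ℕ 2 ℕ.≟ 1) ×-dec (V4.c₂ v %ℕ 4 ℕ.≟ 2) ×-dec (V4.c₃ v %ℕ 4 ℕ.≟ 0) ×-dec (V4.c₄ v %ℕ 4 ℕ.≟ 0)

    outcome? : ∀ v → Dec (Outcome v)
    outcome? v = Finₚ.any? (λ i → Finₚ.any? λ k → inLᵣ? (sandwich (U i) (U k) v))
      ⊎-dec (Finₚ.any? (λ i → badᵣ? (mul (U i) v)) ⊎-dec Finₚ.any? (λ i → badᵣ? (mul (mul (U i) J) v)))

    -- Membership in the sublattice depends only on residues modulo 4, so 256 cases suffice. Odd
    -- norms are enough because the target form can be doubled.
    odd-outcome : ∀ (a b c e : Fin 4) → norm (fromFin a b c e) %ℕ 2 ≡ 1 → Outcome (fromFin a b c e)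
    odd-outcome = toWitness {a? = Finₚ.all? λ a → Finₚ.all? λ b → Finₚ.all? λ c → Finₚ.all? λ e →
      (norm (fromFin a b c e) %ℕ 2 ℕ.≟ 1) →-dec outcome? (fromFin a b c e)} tt

    -- Generators of the four ideals of norm 3.
    T : Fin 4 → Vℤ
    T zero = ⟨ - 1ℤ , + 2 , 0ℤ , 0ℤ ⟩
    T (suc zero) = ⟨ - 1ℤ , + 2 , 1ℤ , 0ℤ ⟩
    T (suc (suc zero)) = ⟨ - 1ℤ , 1ℤ , - 1ℤ , 1ℤ ⟩
    T (suc (suc (suc zero))) = ⟨ 0ℤ , 1ℤ , 0ℤ , - 1ℤ ⟩

    Null : Vℤ → Set
    Null v = V4.c₁ v %ℕ 3 ≡ 0 × V4.c₂ v %ℕ 3 ≡ 0 × V4.c₃ v %ℕ 3 ≡ 0 × V4.c₄ v %ℕ 3 ≡ 0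

    -- tᵢ v t̄ₖ / 3 is integral when v matches, modulo 3, the kernels of tᵢ and tₖ among the four lines of 𝔽₃².
    Matched Scalar : Vℤ → Set
    Matched v = ∃[ i ] ∃[ k ] (i ≢ k × Null (sandwich (T i) (conj (T k)) v))
    Scalar v = V4.c₂ v ≡ 0ℤ × V4.c₃ v ≡ 0ℤ × V4.c₄ v ≡ 0ℤ

    -- Modulo 3 the order is a 2 × 2 matrix algebra, where t̄ₖ has image the kernel of tₖ. A matrix
    -- preserving all four lines is scalar; any other sends the kernel of some tₖ into the kernel of
    -- some tᵢ with i ≠ k, and then tᵢ v t̄ₖ vanishes.
    matched⊎scalar : ∀ (a b c e : Fin 3) → Matched (fromFin a b c e) ⊎ Scalar (fromFin a b c e)
    matched⊎scalar = toWitness {a? = Finₚ.all? λ a → Finₚ.all? λ b → Finₚ.all? λ c → Finₚ.all? λ e →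
      let v = fromFin a b c e in
      Finₚ.any? (λ i → Finₚ.any? λ k → let u = sandwich (T i) (conj (T k)) v in
        ¬? (i Finₚ.≟ k) ×-dec ((V4.c₁ u %ℕ 3 ℕ.≟ 0) ×-dec (V4.c₂ u %ℕ 3 ℕ.≟ 0) ×-dec (V4.c₃ u %ℕ 3 ℕ.≟ 0) ×-dec (V4.c₄ u %ℕ 3 ℕ.≟ 0)))
      ⊎-dec ((V4.c₂ v ℤₚ.≟ 0ℤ) ×-dec (V4.c₃ v ℤₚ.≟ 0ℤ) ×-dec (V4.c₄ v ℤₚ.≟ 0ℤ))} tt

    bad-residue : Fin 2 → Vℤ
    bad-residue e = ⟨ + 2 * + toℕ e + 1ℤ , + 2 , 0ℤ , 0ℤ ⟩

    -- The case i = k is excluded because conjugation by an element of norm 3 preserves the bad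
    -- class; different elements on the two sides leave it, up to units.
    switched : ∀ (i k : Fin 4) → i ≢ k → ∀ e → ∃[ a ] ∃[ b ] InLᵣ (sandwich (U a) (U b) (sandwich (T i) (conj (T k)) (bad-residue e)))
    switched = toWitness {a? = Finₚ.all? λ i → Finₚ.all? λ k → ¬? (i Finₚ.≟ k) →-dec (Finₚ.all? λ e →
      Finₚ.any? λ a → Finₚ.any? λ b → inLᵣ? (sandwich (U a) (U b) (sandwich (T i) (conj (T k)) (bad-residue e))))} tt

    quotients : (d : ℕ) .{{_ : ℕ.NonZero d}} → Vℤ → Vℤ
    quotients d ⟨ x , y , z , w ⟩ = ⟨ x /ℕ d , y /ℕ d , z /ℕ d , w /ℕ d ⟩

    reduced : (d : ℕ) .{{_ : ℕ.NonZero d}} → Vℤ → Vℤ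
    reduced d ⟨ x , y , z , w ⟩ = fromFin (rem x d) (rem y d) (rem z d) (rem w d)

    reduced-≡ : ∀ d .{{_ : ℕ.NonZero d}} v → reduced d v ≡ v ⊟v (+ d • quotients d v)
    reduced-≡ d ⟨ x , y , z , w ⟩ = sym (vec-≡ (divide x d) (divide y d) (divide z d) (divide w d))

    sandwich-reduced : ∀ d .{{_ : ℕ.NonZero d}} a b v →
      sandwich a b (reduced d v) ≡ sandwich a b v ⊟v (+ d • sandwich a b (quotients d v))
    sandwich-reduced d a b v = trans (cong (sandwich a b) (reduced-≡ d v)) (sandwich-sub (+ d) a b v (quotients d v))

    mul-reduced : ∀ d .{{_ : ℕ.NonZero d}} a v → mul a (reduced d v) ≡ mul a v ⊟v (+ d • mul a (quotients d v))
    mul-reduced d a v = trans (cong (mul a) (reduced-≡ d v)) (mul-subˡ (+ d) a v (quotients d v))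

    lift : ∀ x q d .{{_ : ℕ.NonZero d}} r → (x - q) %ℕ d ≡ r → x ≡ + r + ((x - q) /ℕ d) * + d + q
    lift x q d r eq = trans (lem x q) (cong (_+ q) (exact (x - q) d eq))
      where
      lem : ∀ x q → x ≡ (x - q) + q
      lem = solve-∀

    inL-lift : ∀ u q → InLᵣ (u ⊟v (+ 4 • q)) → InL u
    inL-lift ⟨ _ , y , _ , w ⟩ ⟨ _ , y′ , _ , w′ ⟩ (ey , ew) =
      ((y - + 4 * y′) /ℕ 4 + y′ , trans (lift y (+ 4 * y′) 4 0 ey) (lem₁ ((y - + 4 * y′) /ℕ 4) y′)) ,
      ((w - + 4 * w′) /ℕ 2 + + 2 * w′ , trans (lift w (+ 4 * w′) 2 0 ew) (lem₂ ((w - + 4 * w′) /ℕ 2) w′))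
      where
      lem₁ : ∀ e q → 0ℤ + e * + 4 + + 4 * q ≡ + 4 * (e + q)
      lem₁ = solve-∀
      lem₂ : ∀ e q → 0ℤ + e * + 2 + + 4 * q ≡ + 2 * (e + + 2 * q)
      lem₂ = solve-∀

    Bad : Vℤ → Set
    Bad v = ∃[ a ] ∃[ b ] ∃[ c ] ∃[ e ] (v ≡ ⟨ + 2 * a + 1ℤ , + 4 * b + + 2 , + 4 * c , + 4 * e ⟩)

    bad-lift : ∀ u q → Badᵣ (u ⊟v (+ 4 • q)) → Bad u
    bad-lift ⟨ x , y , z , w ⟩ ⟨ x′ , y′ , z′ , w′ ⟩ (ex , ey , ez , ew) =
      (x - + 4 * x′) /ℕ 2 + + 2 * x′ , (y - + 4 * y′) /ℕ 4 + y′ , (z - + 4 * z′) /ℕ 4 + z′ , (w - + 4 * w′) /ℕ 4 + w′ , vec-≡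
      (trans (lift x (+ 4 * x′) 2 1 ex) (lem₁ ((x - + 4 * x′) /ℕ 2) x′))
      (trans (lift y (+ 4 * y′) 4 2 ey) (lem₂ ((y - + 4 * y′) /ℕ 4) y′))
      (trans (lift z (+ 4 * z′) 4 0 ez) (lem₃ ((z - + 4 * z′) /ℕ 4) z′))
      (trans (lift w (+ 4 * w′) 4 0 ew) (lem₃ ((w - + 4 * w′) /ℕ 4) w′))
      where
      lem₁ : ∀ e q → 1ℤ + e * + 2 + + 4 * q ≡ + 2 * (e + + 2 * q) + 1ℤ
      lem₁ = solve-∀
      lem₂ : ∀ e q → + 2 + e * + 4 + + 4 * q ≡ + 4 * (e + q) + + 2
      lem₂ = solve-∀
      lem₃ : ∀ e q → 0ℤ + e * + 4 + + 4 * q ≡ + 4 * (e + q)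
      lem₃ = solve-∀

    rotated⇒form : ∀ i k v → InL (sandwich (U i) (U k) v) → Form (norm v)
    rotated⇒form i k v inL = subst Form eq (inL⇒form (sandwich (U i) (U k) v) inL)
      where
      lem : ∀ N → 1ℤ * N * 1ℤ ≡ N
      lem = solve-∀
      eq : norm (sandwich (U i) (U k) v) ≡ norm v
      eq = trans (norm-sandwich (U i) (U k) v) (trans (cong₂ (λ a b → a * norm v * b) (norm-U i) (norm-U k)) (lem (norm v)))

-- Leaving the bad class by elements of norm 3; universality of ⟨1,2,5,10⟩.

module NormThree where
  open Quaternions
  open LagrangeMethod
  open FourSquareForms
  open SqrtMinusSeven
  open DiscriminantFive
  open Residues
  open import Data.Nat as ℕ using (ℕ; zero; suc; s≤s; z≤n)
  import Data.Nat.Properties as ℕₚ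
  import Data.Nat.Divisibility as ℕ∣
  open import Data.Nat using (_^_)
  open import Data.Nat.Induction using (<-rec)
  open import Data.Integer as ℤ using (ℤ; +_; _+_; _*_; _-_; -_; 0ℤ; 1ℤ; _%ℕ_; _/ℕ_)
  import Data.Integer.Properties as ℤₚ
  open import Data.Integer.Divisibility.Signed as ℤ∣ using (_∣_; divides)
  open import Data.Fin using (Fin; zero; suc; toℕ)
  import Data.Fin.Properties as Finₚ
  open import Relation.Nullary.Decidable using (Dec; _×-dec_)
  open import Data.Integer.DivMod using (n%ℕd<d)
  open import Data.Product using (_×_; _,_; ∃-syntax; proj₁; proj₂)
  open import Data.Sum using (_⊎_; inj₁; inj₂)
  open import Data.Empty using (⊥-elim)
  open import Relation.Nullary using (¬_)
  open import Relation.Binary.PropositionalEquality using (_≡_; _≢_; refl; sym; trans; cong; cong₂; subst; module ≡-Reasoning)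
  open import Data.Integer.Tactic.RingSolver using (ring; solve-∀)
  open import Tactic.RingSolver.NonReflective ring using (solve; _⊜_; Expr; Κ; _⊕_; _⊗_; ⊝_)
  open Ops ℤOps using (_•_; _⊟v_; module Quaternion)

  module Switching where
    open Order5 using (norm; mul; conj; Represented; represents)
    open Form12510

    mul-•ˡ : ∀ k u v → mul u (k • v) ≡ k • mul u v
    mul-•ˡ k ⟨ a , b , c , d ⟩ ⟨ x , y , z , w ⟩ = vec-≡
      (solve 9 (λ a b c d x y z w k → E.side V4.c₁ a b c d x y z w k) refl a b c d x y z w k)
      (solve 9 (λ a b c d x y z w k → E.side V4.c₂ a b c d x y z w k) refl a b c d x y z w k)
      (solve 9 (λ a b c d x y z w k → E.side V4.c₃ a b c d x y z w k) refl a b c d x y z w k)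
      (solve 9 (λ a b c d x y z w k → E.side V4.c₄ a b c d x y z w k) refl a b c d x y z w k)
      where
      module E where
        open Ops (exprOps 9) using () renaming (_•_ to _•ₑ_)
        open Ops.Quaternion (exprOps 9) (Κ 1ℤ) (Κ 1ℤ) (Κ (+ 2)) (Κ 1ℤ) using () renaming (mul to mulₑ)
        side : (V4 (Expr ℤ 9) → Expr ℤ 9) → (a b c d x y z w k : Expr ℤ 9) → Expr ℤ 9 × Expr ℤ 9
        side π a b c d x y z w k = π (mulₑ ⟨ a , b , c , d ⟩ (k •ₑ ⟨ x , y , z , w ⟩)) ⊜ π (k •ₑ mulₑ ⟨ a , b , c , d ⟩ ⟨ x , y , z , w ⟩)

    mul-•ʳ : ∀ k u v → mul (k • v) u ≡ k • mul v u
    mul-•ʳ k ⟨ a , b , c , d ⟩ ⟨ x , y , z , w ⟩ = vec-≡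
      (solve 9 (λ a b c d x y z w k → E.side V4.c₁ a b c d x y z w k) refl a b c d x y z w k)
      (solve 9 (λ a b c d x y z w k → E.side V4.c₂ a b c d x y z w k) refl a b c d x y z w k)
      (solve 9 (λ a b c d x y z w k → E.side V4.c₃ a b c d x y z w k) refl a b c d x y z w k)
      (solve 9 (λ a b c d x y z w k → E.side V4.c₄ a b c d x y z w k) refl a b c d x y z w k)
      where
      module E where
        open Ops (exprOps 9) using () renaming (_•_ to _•ₑ_)
        open Ops.Quaternion (exprOps 9) (Κ 1ℤ) (Κ 1ℤ) (Κ (+ 2)) (Κ 1ℤ) using () renaming (mul to mulₑ)
        side : (V4 (Expr ℤ 9) → Expr ℤ 9) → (a b c d x y z w k : Expr ℤ 9) → Expr ℤ 9 × Expr ℤ 9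
        side π a b c d x y z w k = π (mulₑ (k •ₑ ⟨ x , y , z , w ⟩) ⟨ a , b , c , d ⟩) ⊜ π (k •ₑ mulₑ ⟨ x , y , z , w ⟩ ⟨ a , b , c , d ⟩)

    sandwich-• : ∀ k a b v → sandwich a b (k • v) ≡ k • sandwich a b v
    sandwich-• k a b v = trans (cong (λ u → mul u b) (mul-•ˡ k a v)) (mul-•ʳ k b (mul a v))

    norm-T : ∀ i → norm (T i) ≡ + 3
    norm-T zero = refl
    norm-T (suc zero) = refl
    norm-T (suc (suc zero)) = refl
    norm-T (suc (suc (suc zero))) = refl

    null-lift : ∀ u q → Null (u ⊟v (+ 3 • q)) → ∃[ v ] (u ≡ + 3 • v)
    null-lift ⟨ x , y , z , w ⟩ ⟨ x′ , y′ , z′ , w′ ⟩ (ex , ey , ez , ew) =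
      ⟨ (x - + 3 * x′) /ℕ 3 + x′ , (y - + 3 * y′) /ℕ 3 + y′ , (z - + 3 * z′) /ℕ 3 + z′ , (w - + 3 * w′) /ℕ 3 + w′ ⟩ ,
      vec-≡ (third x x′ ex) (third y y′ ey) (third z z′ ez) (third w w′ ew)
      where
      lem : ∀ e q → 0ℤ + e * + 3 + + 3 * q ≡ + 3 * (e + q)
      lem = solve-∀
      third : ∀ x q → (x - + 3 * q) %ℕ 3 ≡ 0 → x ≡ + 3 * ((x - + 3 * q) /ℕ 3 + q)
      third x q e = trans (lift x (+ 3 * q) 3 0 e) (lem ((x - + 3 * q) /ℕ 3) q)

    -- The index of the sublattice is a power of 2 and 3 is odd; explicitly y = 4y - 3y and w = 3w -
    -- 2w.
    inL-third : ∀ v → InL (+ 3 • v) → InL v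
    inL-third ⟨ _ , y , _ , w ⟩ ((e , ey) , (f , ew)) =
      (y - e , trans (l₁ y) (trans (cong (λ t → + 4 * y - t) ey) (l₂ y e))) ,
      (f - w , trans (l₃ w) (trans (cong (λ t → t - + 2 * w) ew) (l₄ w f)))
      where
      l₁ : ∀ y → y ≡ + 4 * y - + 3 * y
      l₁ = solve-∀
      l₂ : ∀ y e → + 4 * y - + 4 * e ≡ + 4 * (y - e)
      l₂ = solve-∀
      l₃ : ∀ w → w ≡ + 3 * w - + 2 * w
      l₃ = solve-∀
      l₄ : ∀ w f → + 2 * f - + 2 * w ≡ + 2 * (f - w)
      l₄ = solve-∀

    bad-reduced : ∀ a b c e → bad-residue (rem a 2) ≡ ⟨ + 2 * a + 1ℤ , + 4 * b + + 2 , + 4 * c , + 4 * e ⟩ ⊟v (+ 4 • ⟨ a /ℕ 2 , b , c , e ⟩)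
    bad-reduced a b c e = sym (vec-≡ (trans (l₁ a (a /ℕ 2)) (cong (λ t → + 2 * t + 1ℤ) (divide a 2))) (l₂ b) (l₃ c) (l₃ e))
      where
      l₁ : ∀ a q → + 2 * a + 1ℤ - + 4 * q ≡ + 2 * (a - + 2 * q) + 1ℤ
      l₁ = solve-∀
      l₂ : ∀ b → + 4 * b + + 2 - + 4 * b ≡ + 2
      l₂ = solve-∀
      l₃ : ∀ c → + 4 * c - + 4 * c ≡ 0ℤ
      l₃ = solve-∀

    module _ (A B v : Vℤ) (norm-A : norm A ≡ + 3) (norm-B : norm B ≡ + 3) where
      private
        S = sandwich A B v

      norm-third : ∀ v′ → S ≡ + 3 • v′ → norm v′ ≡ norm v
      norm-third v′ S≡ = ℤₚ.*-cancelˡ-≡ (+ 9) (norm v′) (norm v) (begin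
        + 9 * norm v′ ≡⟨ norm-• 1ℤ 1ℤ (+ 2) 1ℤ (+ 3) v′ ⟨
        norm (+ 3 • v′) ≡⟨ cong norm S≡ ⟨
        norm S ≡⟨ norm-sandwich A B v ⟩
        norm A * norm v * norm B ≡⟨ cong₂ (λ s t → s * norm v * t) norm-A norm-B ⟩
        + 3 * norm v * + 3 ≡⟨ lem (norm v) ⟩
        + 9 * norm v ∎)
        where
        open ≡-Reasoning
        lem : ∀ N → + 3 * N * + 3 ≡ + 9 * N
        lem = solve-∀

      third-inL : ∀ C D v′ r Q → S ≡ + 3 • v′ → r ≡ v ⊟v (+ 4 • Q) → InLᵣ (sandwich C D (sandwich A B r)) → InL (sandwich C D v′)
      third-inL C D v′ r Q S≡ r≡ inL = inL-third (sandwich C D v′) (subst InL (trans (cong (sandwich C D) S≡) (sandwich-• (+ 3) C D v′))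
        (inL-lift (sandwich C D S) (sandwich C D (sandwich A B Q)) (subst InLᵣ moved inL)))
        where
        moved : sandwich C D (sandwich A B r) ≡ sandwich C D S ⊟v (+ 4 • sandwich C D (sandwich A B Q))
        moved = trans (cong (λ r → sandwich C D (sandwich A B r)) r≡)
          (trans (cong (sandwich C D) (sandwich-sub (+ 4) A B v Q)) (sandwich-sub (+ 4) C D S (sandwich A B Q)))

      -- Here A v B = 3 v′ with `norm v′` equal to `norm v`. Modulo 4 the product A v B is
      -- determined by the bad residue of v, so after a rotation by units it lies in the sublattice,
      -- and the factor 3 can be cancelled.
      switch⇒form : Bad v → Null (sandwich A B (reduced 3 v)) →
        (∀ e → ∃[ x ] ∃[ y ] InLᵣ (sandwich (U x) (U y) (sandwich A B (bad-residue e)))) → Form (norm v)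
      switch⇒form (a , b , c , e , v≡) null switched =
        conclude (null-lift S (sandwich A B (quotients 3 v)) (subst Null (sandwich-reduced 3 A B v) null)) (switched (rem a 2))
        where
        Q = ⟨ a /ℕ 2 , b , c , e ⟩
        residue≡ : bad-residue (rem a 2) ≡ v ⊟v (+ 4 • Q)
        residue≡ = trans (bad-reduced a b c e) (cong (_⊟v (+ 4 • Q)) (sym v≡))
        conclude : ∃[ v′ ] (S ≡ + 3 • v′) → ∃[ x ] ∃[ y ] InLᵣ (sandwich (U x) (U y) (sandwich A B (bad-residue (rem a 2)))) → Form (norm v)
        conclude (v′ , S≡) (x , y , inL) = subst Form (norm-third v′ S≡)
          (rotated⇒form x y v′ (third-inL (U x) (U y) v′ (bad-residue (rem a 2)) Q S≡ residue≡ inL))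

    matched⇒form : ∀ v → Bad v → Matched (reduced 3 v) → Form (norm v)
    matched⇒form v bad (i , k , i≢k , null) = switch⇒form (T i) (conj (T k)) v (norm-T i)
      (trans (norm-conj 1ℤ 1ℤ (+ 2) 1ℤ (T k)) (norm-T k)) bad null (switched i k i≢k)

    -- The conjugate t v t⁻¹ of v = c + 3 (yζ + zg + wζg), for the i-th element t of norm 3.
    conjugate : Fin 4 → ℤ → ℤ → ℤ → ℤ → Vℤ
    conjugate zero c y z w = ⟨ c + + 2 * z + + 4 * w , + 3 * y - + 4 * z - + 2 * w , - (+ 3 * z) , - (+ 3 * w) ⟩
    conjugate (suc zero) c y z w = ⟨ c + y - + 2 * z + + 2 * w , y + + 4 * z + + 2 * w , + 2 * y - z + w , - (+ 3 * w) ⟩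
    conjugate (suc (suc zero)) c y z w = ⟨ c + y + + 3 * z + + 2 * w , - y - + 3 * z + w , - (+ 2 * y) - w , + 2 * y - + 3 * z - + 2 * w ⟩
    conjugate (suc (suc (suc zero))) c y z w = ⟨ c + + 3 * y + + 3 * w , - y - + 3 * z - + 4 * w , - (+ 3 * z) , - (+ 2 * y) + + 3 * z + w ⟩

    norm-conjugate : ∀ i c y z w → norm (conjugate i c y z w) ≡ norm ⟨ c , + 3 * y , + 3 * z , + 3 * w ⟩
    norm-conjugate zero = solve 4 (λ c y z w → let N = Ops.Quaternion.norm (exprOps 4) (Κ 1ℤ) (Κ 1ℤ) (Κ (+ 2)) (Κ 1ℤ) in
      N ⟨ c ⊕ Κ (+ 2) ⊗ z ⊕ Κ (+ 4) ⊗ w , Κ (+ 3) ⊗ y ⊕ ⊝ (Κ (+ 4) ⊗ z) ⊕ ⊝ (Κ (+ 2) ⊗ w) , ⊝ (Κ (+ 3) ⊗ z) , ⊝ (Κ (+ 3) ⊗ w) ⟩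
        ⊜ N ⟨ c , Κ (+ 3) ⊗ y , Κ (+ 3) ⊗ z , Κ (+ 3) ⊗ w ⟩) refl
    norm-conjugate (suc zero) = solve 4 (λ c y z w → let N = Ops.Quaternion.norm (exprOps 4) (Κ 1ℤ) (Κ 1ℤ) (Κ (+ 2)) (Κ 1ℤ) in
      N ⟨ c ⊕ y ⊕ ⊝ (Κ (+ 2) ⊗ z) ⊕ Κ (+ 2) ⊗ w , y ⊕ Κ (+ 4) ⊗ z ⊕ Κ (+ 2) ⊗ w , Κ (+ 2) ⊗ y ⊕ ⊝ z ⊕ w , ⊝ (Κ (+ 3) ⊗ w) ⟩
        ⊜ N ⟨ c , Κ (+ 3) ⊗ y , Κ (+ 3) ⊗ z , Κ (+ 3) ⊗ w ⟩) refl
    norm-conjugate (suc (suc zero)) = solve 4 (λ c y z w → let N = Ops.Quaternion.norm (exprOps 4) (Κ 1ℤ) (Κ 1ℤ) (Κ (+ 2)) (Κ 1ℤ) in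
      N ⟨ c ⊕ y ⊕ Κ (+ 3) ⊗ z ⊕ Κ (+ 2) ⊗ w , ⊝ y ⊕ ⊝ (Κ (+ 3) ⊗ z) ⊕ w , ⊝ (Κ (+ 2) ⊗ y) ⊕ ⊝ w , Κ (+ 2) ⊗ y ⊕ ⊝ (Κ (+ 3) ⊗ z) ⊕ ⊝ (Κ (+ 2) ⊗ w) ⟩
        ⊜ N ⟨ c , Κ (+ 3) ⊗ y , Κ (+ 3) ⊗ z , Κ (+ 3) ⊗ w ⟩) refl
    norm-conjugate (suc (suc (suc zero))) = solve 4 (λ c y z w → let N = Ops.Quaternion.norm (exprOps 4) (Κ 1ℤ) (Κ 1ℤ) (Κ (+ 2)) (Κ 1ℤ) in
      N ⟨ c ⊕ Κ (+ 3) ⊗ y ⊕ Κ (+ 3) ⊗ w , ⊝ y ⊕ ⊝ (Κ (+ 3) ⊗ z) ⊕ ⊝ (Κ (+ 4) ⊗ w) , ⊝ (Κ (+ 3) ⊗ z) , ⊝ (Κ (+ 2) ⊗ y) ⊕ Κ (+ 3) ⊗ z ⊕ w ⟩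
        ⊜ N ⟨ c , Κ (+ 3) ⊗ y , Κ (+ 3) ⊗ z , Κ (+ 3) ⊗ w ⟩) refl

    -- This keeps the 3-adic descent inside the bad class: the element that replaces v has the same
    -- norm and the same obstruction.
    bad-conjugate : ∀ i a b c e → Bad (conjugate i (+ 2 * a + 1ℤ) (+ 4 * b + + 2) (+ 4 * c) (+ 4 * e))
    bad-conjugate zero a b c e = a + + 4 * c + + 8 * e , + 3 * b + 1ℤ - + 4 * c - + 2 * e , - (+ 3 * c) , - (+ 3 * e) ,
      vec-≡ (l₁ a c e) (l₂ b c e) (l₃ c) (l₃ e)
      where
      l₁ : ∀ a c e → + 2 * a + 1ℤ + + 2 * (+ 4 * c) + + 4 * (+ 4 * e) ≡ + 2 * (a + + 4 * c + + 8 * e) + 1ℤ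
      l₁ = solve-∀
      l₂ : ∀ b c e → + 3 * (+ 4 * b + + 2) - + 4 * (+ 4 * c) - + 2 * (+ 4 * e) ≡ + 4 * (+ 3 * b + 1ℤ - + 4 * c - + 2 * e) + + 2
      l₂ = solve-∀
      l₃ : ∀ c → - (+ 3 * (+ 4 * c)) ≡ + 4 * - (+ 3 * c)
      l₃ = solve-∀
    bad-conjugate (suc zero) a b c e = a + + 2 * b + 1ℤ - + 4 * c + + 4 * e , b + + 4 * c + + 2 * e , + 2 * b + 1ℤ - c + e , - (+ 3 * e) ,
      vec-≡ (l₁ a b c e) (l₂ b c e) (l₃ b c e) (l₄ e)
      where
      l₁ : ∀ a b c e → + 2 * a + 1ℤ + (+ 4 * b + + 2) - + 2 * (+ 4 * c) + + 2 * (+ 4 * e) ≡ + 2 * (a + + 2 * b + 1ℤ - + 4 * c + + 4 * e) + 1ℤ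
      l₁ = solve-∀
      l₂ : ∀ b c e → + 4 * b + + 2 + + 4 * (+ 4 * c) + + 2 * (+ 4 * e) ≡ + 4 * (b + + 4 * c + + 2 * e) + + 2
      l₂ = solve-∀
      l₃ : ∀ b c e → + 2 * (+ 4 * b + + 2) - + 4 * c + + 4 * e ≡ + 4 * (+ 2 * b + 1ℤ - c + e)
      l₃ = solve-∀
      l₄ : ∀ e → - (+ 3 * (+ 4 * e)) ≡ + 4 * - (+ 3 * e)
      l₄ = solve-∀
    bad-conjugate (suc (suc zero)) a b c e = a + + 2 * b + 1ℤ + + 6 * c + + 4 * e , - b - 1ℤ - + 3 * c + e , - (+ 2 * b) - 1ℤ - e , + 2 * b + 1ℤ - + 3 * c - + 2 * e ,
      vec-≡ (l₁ a b c e) (l₂ b c e) (l₃ b e) (l₄ b c e)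
      where
      l₁ : ∀ a b c e → + 2 * a + 1ℤ + (+ 4 * b + + 2) + + 3 * (+ 4 * c) + + 2 * (+ 4 * e) ≡ + 2 * (a + + 2 * b + 1ℤ + + 6 * c + + 4 * e) + 1ℤ
      l₁ = solve-∀
      l₂ : ∀ b c e → - (+ 4 * b + + 2) - + 3 * (+ 4 * c) + + 4 * e ≡ + 4 * (- b - 1ℤ - + 3 * c + e) + + 2
      l₂ = solve-∀
      l₃ : ∀ b e → - (+ 2 * (+ 4 * b + + 2)) - + 4 * e ≡ + 4 * (- (+ 2 * b) - 1ℤ - e)
      l₃ = solve-∀
      l₄ : ∀ b c e → + 2 * (+ 4 * b + + 2) - + 3 * (+ 4 * c) - + 2 * (+ 4 * e) ≡ + 4 * (+ 2 * b + 1ℤ - + 3 * c - + 2 * e)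
      l₄ = solve-∀
    bad-conjugate (suc (suc (suc zero))) a b c e = a + + 6 * b + + 3 + + 6 * e , - b - 1ℤ - + 3 * c - + 4 * e , - (+ 3 * c) , - (+ 2 * b) - 1ℤ + + 3 * c + e ,
      vec-≡ (l₁ a b e) (l₂ b c e) (l₃ c) (l₄ b c e)
      where
      l₁ : ∀ a b e → + 2 * a + 1ℤ + + 3 * (+ 4 * b + + 2) + + 3 * (+ 4 * e) ≡ + 2 * (a + + 6 * b + + 3 + + 6 * e) + 1ℤ
      l₁ = solve-∀
      l₂ : ∀ b c e → - (+ 4 * b + + 2) - + 3 * (+ 4 * c) - + 4 * (+ 4 * e) ≡ + 4 * (- b - 1ℤ - + 3 * c - + 4 * e) + + 2
      l₂ = solve-∀
      l₃ : ∀ c → - (+ 3 * (+ 4 * c)) ≡ + 4 * - (+ 3 * c)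
      l₃ = solve-∀
      l₄ : ∀ b c e → - (+ 2 * (+ 4 * b + + 2)) + + 3 * (+ 4 * c) + + 4 * e ≡ + 4 * (- (+ 2 * b) - 1ℤ + + 3 * c + e)
      l₄ = solve-∀

    ScalarMod : ℕ → Vℤ → Set
    ScalarMod d v = + d ∣ V4.c₂ v × + d ∣ V4.c₃ v × + d ∣ V4.c₄ v

    scalarMod? : ∀ d v → Dec (ScalarMod d v)
    scalarMod? d v = (+ d ℤ∣.∣? V4.c₂ v) ×-dec (+ d ℤ∣.∣? V4.c₃ v) ×-dec (+ d ℤ∣.∣? V4.c₄ v)

    -- One non-scalar coordinate from each of the four conjugates suffices: integral combinations of
    -- them recover y, z and w. Hence, if v is not scalar modulo 3d, some conjugate is not scalar
    -- modulo d.
    conjugates-scalar : ∀ d c y z w → (∀ i → ScalarMod d (conjugate i c y z w)) → + d ∣ y × + d ∣ z × + d ∣ w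
    conjugates-scalar d c y z w all = d∣y , d∣z , d∣w
      where
      P = proj₁ (proj₂ (all (suc zero)))
      B = proj₁ (proj₂ (all (suc (suc zero))))
      E = proj₂ (proj₂ (all (suc (suc (suc zero)))))
      H = proj₁ (all zero)
      l₁ : ∀ y z w → - ((+ 2 * y - z + w) + (- (+ 2 * y) - w)) ≡ z
      l₁ = solve-∀
      l₂ : ∀ y z w → + 2 * z - + 2 * (- (+ 2 * y) + + 3 * z + w) - (+ 3 * y - + 4 * z - + 2 * w) ≡ y
      l₂ = solve-∀
      l₃ : ∀ y w → - (- (+ 2 * y) - w) - + 2 * y ≡ w
      l₃ = solve-∀
      d∣z : + d ∣ z
      d∣z = subst (+ d ∣_) (l₁ y z w) (ℤ∣.∣m⇒∣-m (ℤ∣.∣m∣n⇒∣m+n P B))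
      d∣y : + d ∣ y
      d∣y = subst (+ d ∣_) (l₂ y z w) (ℤ∣.∣m∣n⇒∣m-n (ℤ∣.∣m∣n⇒∣m-n (ℤ∣.∣n⇒∣m*n (+ 2) d∣z) (ℤ∣.∣n⇒∣m*n (+ 2) E)) H)
      d∣w : + d ∣ w
      d∣w = subst (+ d ∣_) (l₃ y w) (ℤ∣.∣m∣n⇒∣m-n (ℤ∣.∣m⇒∣-m B) (ℤ∣.∣n⇒∣m*n (+ 2) d∣y))

    triple-∣ : ∀ n x → + (3 ^ n) ∣ x → + (3 ^ suc n) ∣ + 3 * x
    triple-∣ n x (divides q eq) = divides q (trans (cong (+ 3 *_) eq) (trans (lem q (+ (3 ^ n))) (cong (q *_) (sym (ℤₚ.pos-* 3 (3 ^ n))))))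
      where
      lem : ∀ q M → + 3 * (q * M) ≡ q * (+ 3 * M)
      lem = solve-∀

    -- Induction on n. An element that is not scalar modulo 3 is matched and can be switched at
    -- once. Otherwise some conjugate fails to be scalar already modulo the next lower power of 3,
    -- and conjugation changes neither norm nor badness.
    bad⇒form : ∀ n v → Bad v → ¬ ScalarMod (3 ^ n) v → Form (norm v)
    bad⇒form zero v _ ¬s = ⊥-elim (¬s (one∣ _ , one∣ _ , one∣ _))
      where
      one∣ : ∀ x → 1ℤ ∣ x
      one∣ x = divides x (sym (ℤₚ.*-identityʳ x))
    bad⇒form (suc n) v@(⟨ c , y , z , w ⟩) bad@(a , b , c′ , e , v≡) ¬s = cases (matched⊎scalar (rem c 3) (rem y 3) (rem z 3) (rem w 3))
      where
      third : ∀ y → + toℕ (rem y 3) ≡ 0ℤ → y ≡ + 3 * (y /ℕ 3)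
      third y eq = ℤₚ.i-j≡0⇒i≡j y (+ 3 * (y /ℕ 3)) (trans (divide y 3) eq)
      l₁ : ∀ y b → + 4 * y - + 3 * y ≡ y
      l₁ = solve-∀
      y₂ : ∀ y b → + 3 * y ≡ + 4 * b + + 2 → y ≡ + 4 * (y - b - 1ℤ) + + 2
      y₂ y b eq = trans (sym (l₁ y b)) (trans (cong (λ t → + 4 * y - t) eq) (l y b))
        where
        l : ∀ y b → + 4 * y - (+ 4 * b + + 2) ≡ + 4 * (y - b - 1ℤ) + + 2
        l = solve-∀
      z₂ : ∀ z c → + 3 * z ≡ + 4 * c → z ≡ + 4 * (z - c)
      z₂ z c eq = trans (sym (l₁ z c)) (trans (cong (λ t → + 4 * z - t) eq) (l z c))
        where
        l : ∀ z c → + 4 * z - + 4 * c ≡ + 4 * (z - c)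
        l = solve-∀
      scalar-case : ∀ y′ z′ w′ → y ≡ + 3 * y′ → z ≡ + 3 * z′ → w ≡ + 3 * w′ → Form (norm v)
      scalar-case y′ z′ w′ ey ez ew = subst Form (trans (norm-conjugate i c y′ z′ w′) (sym (cong norm v≡′)))
          (bad⇒form n (conjugate i c y′ z′ w′) bad′ (proj₂ pick))
        where
        v≡′ : v ≡ ⟨ c , + 3 * y′ , + 3 * z′ , + 3 * w′ ⟩
        v≡′ = vec-≡ refl ey ez ew
        not-all : ¬ (∀ i → ScalarMod (3 ^ n) (conjugate i c y′ z′ w′))
        not-all all = let dy , dz , dw = conjugates-scalar (3 ^ n) c y′ z′ w′ all in
          ¬s (subst (+ (3 ^ suc n) ∣_) (sym ey) (triple-∣ n y′ dy) , subst (+ (3 ^ suc n) ∣_) (sym ez) (triple-∣ n z′ dz) , subst (+ (3 ^ suc n) ∣_) (sym ew) (triple-∣ n w′ dw))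
        pick = Finₚ.¬∀⟶∃¬ 4 (λ i → ScalarMod (3 ^ n) (conjugate i c y′ z′ w′)) (λ i → scalarMod? (3 ^ n) (conjugate i c y′ z′ w′)) not-all
        i = proj₁ pick
        c≡ = cong V4.c₁ v≡
        y≡ = y₂ y′ b (trans (sym ey) (cong V4.c₂ v≡))
        z≡ = z₂ z′ c′ (trans (sym ez) (cong V4.c₃ v≡))
        w≡ = z₂ w′ e (trans (sym ew) (cong V4.c₄ v≡))
        bad′ : Bad (conjugate i c y′ z′ w′)
        bad′ = subst Bad (sym (trans (cong₂ (λ c y → conjugate i c y z′ w′) c≡ y≡) (cong₂ (λ z w → conjugate i (+ 2 * a + 1ℤ) (+ 4 * (y′ - b - 1ℤ) + + 2) z w) z≡ w≡)))
          (bad-conjugate i a (y′ - b - 1ℤ) (z′ - c′) (w′ - e))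
      cases : Matched (reduced 3 v) ⊎ Scalar (reduced 3 v) → Form (norm v)
      cases (inj₁ m) = matched⇒form v bad m
      cases (inj₂ (sy , sz , sw)) = scalar-case (y /ℕ 3) (z /ℕ 3) (w /ℕ 3) (third y sy) (third z sz) (third w sw)

    n<3^n : ∀ n → n ℕ.< 3 ^ n
    n<3^n zero = s≤s z≤n
    n<3^n (suc n) = ℕₚ.≤-trans (s≤s (n<3^n n)) (ℕₚ.≤-trans (ℕₚ.+-monoˡ-≤ (3 ^ n) (ℕₚ.≤-trans (s≤s z≤n) (n<3^n n))) (ℕₚ.+-monoʳ-≤ (3 ^ n) (ℕₚ.m≤m+n (3 ^ n) _)))

    -- The second coordinate y is 2 modulo 4, hence nonzero, and 3 to the power |y| exceeds |y|; so
    -- |y| is an admissible depth for the descent.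
    bad-universal : ∀ v → Bad v → Form (norm v)
    bad-universal v bad@(a , b , c , e , v≡) = bad⇒form N v bad not-scalar
      where
      y = V4.c₂ v
      N = ℤ.∣ y ∣
      y≢0 : y ≢ 0ℤ
      y≢0 y≡0 = even≢odd 0ℤ b (sym (double-injective {b + b + 1ℤ} {0ℤ} (trans (l b) (trans (sym (cong V4.c₂ v≡)) y≡0))))
        where
        l : ∀ b → (b + b + 1ℤ) + (b + b + 1ℤ) ≡ + 4 * b + + 2
        l = solve-∀
      not-scalar : ¬ ScalarMod (3 ^ N) v
      not-scalar (d , _) = ℕ∣.>⇒∤ {{ℕ.≢-nonZero (λ eq → y≢0 (ℤₚ.∣i∣≡0⇒i≡0 eq))}} (n<3^n N) (ℤ∣.∣⇒∣ᵤ d)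

    odd⇒% : ∀ x → Odd x → x %ℕ 2 ≡ 1
    odd⇒% x o = go (x %ℕ 2) refl (n%ℕd<d x 2)
      where
      lem : ∀ t → 0ℤ + t * + 2 ≡ t + t
      lem = solve-∀
      go : ∀ r → x %ℕ 2 ≡ r → r ℕ.< 2 → r ≡ 1
      go 0 eq _ = ⊥-elim (¬even∧odd (x /ℕ 2 , trans (exact x 2 eq) (lem (x /ℕ 2))) o)
      go 1 _ _ = refl
      go (suc (suc _)) _ (s≤s (s≤s ()))

    norm-reduced-odd : ∀ v → Odd (norm v) → Odd (norm (reduced 4 v))
    norm-reduced-odd v odd = subst Odd (sym (trans (cong norm (reduced-≡ 4 v)) (norm-sub 1ℤ 1ℤ (+ 2) 1ℤ (+ 4) v q))) (shift (norm v) odd)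
      where
      q = quotients 4 v
      X = + 4 * norm q - Order5.polar v q
      shift : ∀ N → Odd N → Odd (N + + 4 * X)
      shift _ (f , refl) = f + + 2 * X , l f X
        where
        l : ∀ f X → f + f + 1ℤ + + 4 * X ≡ (f + + 2 * X) + (f + + 2 * X) + 1ℤ
        l = solve-∀

    bad-multiple⇒form : ∀ a v → Badᵣ (mul a (reduced 4 v)) → Form (norm a * norm v)
    bad-multiple⇒form a v bad = subst Form (norm-mul 1ℤ 1ℤ (+ 2) 1ℤ a v)
      (bad-universal (mul a v) (bad-lift (mul a v) (mul a (quotients 4 v)) (subst Badᵣ (mul-reduced 4 a v) bad)))

    outcome⇒form : ∀ v → Outcome (reduced 4 v) → Form (norm v)
    outcome⇒form v (inj₁ (i , k , inL)) = rotated⇒form i k v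
      (inL-lift (sandwich (U i) (U k) v) (sandwich (U i) (U k) (quotients 4 v)) (subst InLᵣ (sandwich-reduced 4 (U i) (U k) v) inL))
    outcome⇒form v (inj₂ (inj₁ (i , bad))) = subst Form (trans (cong (_* norm v) (norm-U i)) (ℤₚ.*-identityˡ (norm v)))
      (bad-multiple⇒form (U i) v bad)
    -- Here only a multiple of v by an element of norm 5 is bad; its norm is represented, and `five`
    -- removes the extra factor.
    outcome⇒form v (inj₂ (inj₂ (i , bad))) = five (subst Form (cong (_* norm v) (norm-UJ i)) (bad-multiple⇒form (mul (U i) J) v bad))
      where
      norm-UJ : ∀ i → norm (mul (U i) J) ≡ + 5
      norm-UJ zero = refl
      norm-UJ (suc zero) = refl
      norm-UJ (suc (suc zero)) = refl

    odd⇒form : ∀ v → Odd (norm v) → Form (norm v)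
    odd⇒form v@(⟨ x , y , z , w ⟩) odd = outcome⇒form v
      (odd-outcome (rem x 4) (rem y 4) (rem z 4) (rem w 4) (odd⇒% (norm (reduced 4 v)) (norm-reduced-odd v odd)))

    universal : ∀ m → 1 ℕ.≤ m → Form (+ m)
    universal = <-rec _ go
      where
      go : ∀ m → (∀ {j} → j ℕ.< m → 1 ℕ.≤ j → Form (+ j)) → 1 ℕ.≤ m → Form (+ m)
      go m rec 1≤m = cases (parity m)
        where
        from : Odd (+ m) → Represented m → Form (+ m)
        from odd (v , eq) = subst Form eq (odd⇒form v (subst Odd (sym eq) odd))
        cases : ∃[ h ] (m ≡ h ℕ.+ h ⊎ m ≡ suc (h ℕ.+ h)) → Form (+ m)
        cases (zero , inj₁ refl) = ⊥-elim (ℕₚ.n≮0 1≤m)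
        cases (h@(suc h′) , inj₁ refl) = double (rec {h} (s≤s (ℕₚ.m≤n+m h h′)) (s≤s z≤n))
        cases (h , inj₂ eq) = from (+ h , trans (cong +_ eq) (ℤₚ.+-comm 1ℤ (+ h + + h))) (represents m 1≤m)

-- Escalation by vectors of small norm and their Gram determinant.

module GramDeterminants where
  open Quaternions
  open LagrangeMethod
  open import Data.Nat as ℕ using (ℕ; zero; suc; s≤s; z≤n)
  import Data.Nat.Properties as ℕₚ
  import Data.Nat.Divisibility as ℕ∣
  open import Data.Integer as ℤ using (ℤ; +_; -[1+_]; _+_; _*_; _-_; -_; 0ℤ; 1ℤ)
  import Data.Integer.Properties as ℤₚ
  open import Data.Integer.Divisibility.Signed as ℤ∣ using (_∣_; divides)
  open import Data.Product using (_,_; ∃-syntax)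
  open import Data.Sum using (_⊎_; inj₁; inj₂)
  open import Data.Empty using (⊥; ⊥-elim)
  open import Relation.Binary.PropositionalEquality using (_≡_; _≢_; refl; sym; trans; cong; cong₂; subst)
  open import Data.Integer.Tactic.RingSolver using (ring; solve-∀)
  open import Tactic.RingSolver.NonReflective ring using (solve; _⊜_; Κ; _⊕_; _⊗_; ⊝_)
  open Ops ℤOps using (_•_; _⊟v_; module Quaternion)

  det₃ : (a b c p q r : ℤ) → ℤ
  det₃ a b c p q r = a * b * c + + 2 * (p * q * r) - a * (r * r) - b * (q * q) - c * (p * p)

  -- Off-diagonal entries: ⟨u,v⟩ = p, ⟨u,w⟩ = q, ⟨v,w⟩ = r.
  gram : (a b c p q r x y z : ℤ) → ℤ
  gram a b c p q r x y z = a * (x * x) + b * (y * y) + c * (z * z) + + 2 * (p * (x * y) + q * (x * z) + r * (y * z))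

  square-abs : ∀ x → x * x ≡ + (ℤ.∣ x ∣ ℕ.* ℤ.∣ x ∣)
  square-abs (+ n) = sym (ℤₚ.pos-* n n)
  square-abs -[1+ n ] = refl

  -- This and the next lemma keep the determinants 3 - q² - s² and 10 - 2q² - r² of the escalation
  -- from vanishing, so that their divisibility by D bounds D.
  x²+y²≢3 : ∀ x y → x * x + y * y ≢ + 3
  x²+y²≢3 x y eq = natural ℤ.∣ x ∣ ℤ.∣ y ∣ (ℤₚ.+-injective (trans (sym (cong₂ _+_ (square-abs x) (square-abs y))) eq))
    where
    natural : ∀ a b → a ℕ.* a ℕ.+ b ℕ.* b ≢ 3
    natural 0 0 ()
    natural 0 1 ()
    natural 1 0 ()
    natural 1 1 ()
    natural (suc (suc a)) b eq = ℕₚ.<⇒≱ (ℕₚ.*-mono-≤ {2} {suc (suc a)} {2} {suc (suc a)} (s≤s (s≤s z≤n)) (s≤s (s≤s z≤n))) (ℕₚ.m+n≤o⇒m≤o (suc (suc a) ℕ.* suc (suc a)) (ℕₚ.≤-reflexive eq))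
    natural a (suc (suc b)) eq = ℕₚ.<⇒≱ (ℕₚ.*-mono-≤ {2} {suc (suc b)} {2} {suc (suc b)} (s≤s (s≤s z≤n)) (s≤s (s≤s z≤n))) (ℕₚ.m+n≤o⇒n≤o (a ℕ.* a) (ℕₚ.≤-reflexive eq))

  2x²+y²≢10 : ∀ x y → + 2 * (x * x) + y * y ≢ + 10
  2x²+y²≢10 x y eq = natural ℤ.∣ x ∣ ℤ.∣ y ∣ (ℤₚ.+-injective (trans (sym (cong₂ _+_ (trans (cong (+ 2 *_) (square-abs x)) (sym (ℤₚ.pos-* 2 (ℤ.∣ x ∣ ℕ.* ℤ.∣ x ∣)))) (square-abs y))) eq))
    where
    natural : ∀ a b → 2 ℕ.* (a ℕ.* a) ℕ.+ b ℕ.* b ≢ 10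
    natural 0 0 ()
    natural 0 1 ()
    natural 0 2 ()
    natural 0 3 ()
    natural 1 0 ()
    natural 1 1 ()
    natural 1 2 ()
    natural 1 3 ()
    natural 2 0 ()
    natural 2 1 ()
    natural 2 2 ()
    natural 2 3 ()
    natural a@(suc (suc (suc a′))) b eq = ℕₚ.<⇒≱ (ℕₚ.≤-trans (ℕₚ.m≤m+n 11 7) (ℕₚ.*-monoʳ-≤ 2 (ℕₚ.*-mono-≤ {3} {a} {3} {a} 3≤a 3≤a))) (ℕₚ.m+n≤o⇒m≤o (2 ℕ.* (a ℕ.* a)) (ℕₚ.≤-reflexive eq))
      where
      3≤a : 3 ℕ.≤ a
      3≤a = s≤s (s≤s (s≤s z≤n))
    natural a b@(suc (suc (suc (suc b′)))) eq = ℕₚ.<⇒≱ (ℕₚ.≤-trans (ℕₚ.m≤m+n 11 5) (ℕₚ.*-mono-≤ {4} {b} {4} {b} 4≤b 4≤b)) (ℕₚ.m+n≤o⇒n≤o (2 ℕ.* (a ℕ.* a)) (ℕₚ.≤-reflexive eq))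
      where
      4≤b : 4 ℕ.≤ b
      4≤b = s≤s (s≤s (s≤s (s≤s z≤n)))

  divisor-≤ : ∀ D x n → + D ∣ x → 0ℤ ℤ.≤ x → x ≢ 0ℤ → x ℤ.≤ + n → D ℕ.≤ n
  divisor-≤ D (+ zero) n _ _ x≢0 _ = ⊥-elim (x≢0 refl)
  divisor-≤ D (+ suc m) n d _ _ le = ℕₚ.≤-trans (ℕ∣.∣⇒≤ (ℤ∣.∣⇒∣ᵤ d)) (ℤₚ.drop‿+≤+ le)

  -- Semidefiniteness makes each Gram determinant nonnegative, and arithmetic excludes zero;
  -- together these replace a proof of linear independence.
  module Escalation (D : ℕ) (V : Set) (B : V → V → ℤ)
    (psd : ∀ u v w x y z → 0ℤ ℤ.≤ gram (B u u) (B v v) (B w w) (B u v) (B u w) (B v w) x y z)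
    (degenerate : ∀ u v w → + D ∣ det₃ (B u u) (B v v) (B w w) (B u v) (B u w) (B v w))
    (represents : ∀ m → 1 ℕ.≤ m → ∃[ v ] (B v v ≡ + m))
    where

    module _ (u v w : V) (c : ℕ) (uu : B u u ≡ 1ℤ) (vv : B v v ≡ + 2) (ww : B w w ≡ + c) where
      psd′ : ∀ x y z → 0ℤ ℤ.≤ gram 1ℤ (+ 2) (+ c) (B u v) (B u w) (B v w) x y z
      psd′ x y z = subst (0ℤ ℤ.≤_) (trans (cong (λ t → gram t (B v v) (B w w) (B u v) (B u w) (B v w) x y z) uu)
        (cong₂ (λ s t → gram 1ℤ s t (B u v) (B u w) (B v w) x y z) vv ww)) (psd u v w x y z)

      degenerate′ : + D ∣ det₃ 1ℤ (+ 2) (+ c) (B u v) (B u w) (B v w)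
      degenerate′ = subst (+ D ∣_) (trans (cong (λ t → det₃ t (B v v) (B w w) (B u v) (B u w) (B v w)) uu)
        (cong₂ (λ s t → det₃ 1ℤ s t (B u v) (B u w) (B v w)) vv ww)) (degenerate u v w)

    -- The determinant is 10 - 2q² - r². Twice it is the norm of 2w - 2q u - r v, which is twice the
    -- component of w orthogonal to u and v.
    orthogonal-case : ∀ q r → (∀ x y z → 0ℤ ℤ.≤ gram 1ℤ (+ 2) (+ 5) 0ℤ q r x y z) → + D ∣ det₃ 1ℤ (+ 2) (+ 5) 0ℤ q r → D ℕ.≤ 10
    orthogonal-case q r psd₀ d = divisor-≤ D (det₃ 1ℤ (+ 2) (+ 5) 0ℤ q r) 10 d
      (ℤₚ.*-cancelˡ-≤-pos 0ℤ _ (+ 2) (subst (0ℤ ℤ.≤_) (l₁ q r) (psd₀ (- (+ 2 * q)) (- r) (+ 2))))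
      (λ eq → 2x²+y²≢10 q r (trans (l₃ q r) (cong (λ t → + 10 - t) eq)))
      (≤-by (+ 2 * (q * q) + r * r) (+-nonneg (*-nonneg {+ 2} (ℤ.+≤+ z≤n) (square-nonneg q)) (square-nonneg r)) (l₂ q r))
      where
      l₁ : ∀ q r → 1ℤ * (- (+ 2 * q) * - (+ 2 * q)) + + 2 * (- r * - r) + + 5 * (+ 2 * + 2) + + 2 * (0ℤ * (- (+ 2 * q) * - r) + q * (- (+ 2 * q) * + 2) + r * (- r * + 2))
           ≡ + 2 * (1ℤ * + 2 * + 5 + + 2 * (0ℤ * q * r) - 1ℤ * (r * r) - + 2 * (q * q) - + 5 * (0ℤ * 0ℤ))
      l₁ = solve-∀
      l₂ : ∀ q r → + 10 ≡ (1ℤ * + 2 * + 5 + + 2 * (0ℤ * q * r) - 1ℤ * (r * r) - + 2 * (q * q) - + 5 * (0ℤ * 0ℤ)) + (+ 2 * (q * q) + r * r)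
      l₂ = solve-∀
      l₃ : ∀ q r → + 2 * (q * q) + r * r ≡ + 10 - (1ℤ * + 2 * + 5 + + 2 * (0ℤ * q * r) - 1ℤ * (r * r) - + 2 * (q * q) - + 5 * (0ℤ * 0ℤ))
      l₃ = solve-∀

    -- The vector v - e u is orthogonal to u and has norm 1, and s is its product with w. In the new
    -- basis the determinant is 3 - q² - s², the norm of w - q u - s (v - e u).
    unit-case : ∀ e q r → e * e ≡ 1ℤ → (∀ x y z → 0ℤ ℤ.≤ gram 1ℤ (+ 2) (+ 3) e q r x y z) → + D ∣ det₃ 1ℤ (+ 2) (+ 3) e q r → D ℕ.≤ 10
    unit-case e q r ee psd₀ d = ℕₚ.≤-trans (divisor-≤ D N 3 (subst (+ D ∣_) det≡ d)
        (subst (0ℤ ℤ.≤_) psd≡ (psd₀ (e * s - q) (- s) 1ℤ))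
        (λ eq → x²+y²≢3 q s (trans (l₂ q s) (cong (λ t → + 3 - t) eq)))
        (≤-by (q * q + s * s) (+-nonneg (square-nonneg q) (square-nonneg s)) (l₃ q s))) (ℕₚ.m≤m+n 3 7)
      where
      s N : ℤ
      s = r - e * q
      N = + 3 - q * q - s * s
      l₁ : ∀ e q r → 1ℤ * + 2 * + 3 + + 2 * (e * q * r) - 1ℤ * (r * r) - + 2 * (q * q) - + 3 * (e * e)
        ≡ + 3 - q * q - (r - e * q) * (r - e * q) + (1ℤ - e * e) * (+ 3 - q * q)
      l₁ = solve-∀
      l₂ : ∀ q s → q * q + s * s ≡ + 3 - (+ 3 - q * q - s * s)
      l₂ = solve-∀
      l₃ : ∀ q s → + 3 ≡ (+ 3 - q * q - s * s) + (q * q + s * s)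
      l₃ = solve-∀
      l₄ : ∀ e q r → 1ℤ * ((e * (r - e * q) - q) * (e * (r - e * q) - q)) + + 2 * (- (r - e * q) * - (r - e * q)) + + 3 * (1ℤ * 1ℤ)
          + + 2 * (e * ((e * (r - e * q) - q) * - (r - e * q)) + q * ((e * (r - e * q) - q) * 1ℤ) + r * (- (r - e * q) * 1ℤ))
        ≡ + 3 - q * q - (r - e * q) * (r - e * q) + (1ℤ - e * e) * ((r - e * q) * (r - e * q))
      l₄ = solve-∀
      drop : ∀ t → N + (1ℤ - e * e) * t ≡ N
      drop t = trans (cong (λ u → N + (1ℤ - u) * t) ee) (lem N t)
        where
        lem : ∀ N t → N + (1ℤ - 1ℤ) * t ≡ N
        lem = solve-∀
      det≡ : det₃ 1ℤ (+ 2) (+ 3) e q r ≡ N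
      det≡ = trans (l₁ e q r) (drop (+ 3 - q * q))
      psd≡ : gram 1ℤ (+ 2) (+ 3) e q r (e * s - q) (- s) 1ℤ ≡ N
      psd≡ = trans (l₄ e q r) (drop (s * s))

    small-entry : ∀ e → e * e ℤ.≤ + 2 → e ≡ 0ℤ ⊎ e * e ≡ 1ℤ
    small-entry (+ 0) _ = inj₁ refl
    small-entry (+ 1) _ = inj₂ refl
    small-entry (+ suc (suc n)) le = ⊥-elim (too-big (ℤₚ.drop‿+≤+ (subst (ℤ._≤ + 2) (sym (ℤₚ.pos-* (suc (suc n)) (suc (suc n)))) le)))
      where
      too-big : suc (suc n) ℕ.* suc (suc n) ℕ.≤ 2 → ⊥
      too-big le = ℕₚ.<⇒≱ (ℕₚ.≤-trans (ℕₚ.m≤m+n 3 1) (ℕₚ.*-mono-≤ {2} {suc (suc n)} {2} {suc (suc n)} (s≤s (s≤s z≤n)) (s≤s (s≤s z≤n)))) le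
    small-entry -[1+ 0 ] _ = inj₂ refl
    small-entry -[1+ suc n ] le = ⊥-elim (ℕₚ.<⇒≱ (ℕₚ.≤-trans (ℕₚ.m≤m+n 3 1) (ℕₚ.*-mono-≤ {2} {suc (suc n)} {2} {suc (suc n)} (s≤s (s≤s z≤n)) (s≤s (s≤s z≤n)))) (ℤₚ.drop‿+≤+ le))

    D≤10 : D ℕ.≤ 10
    D≤10 = from₂ (represents 1 (s≤s z≤n)) (represents 2 (s≤s z≤n)) (represents 3 (s≤s z≤n)) (represents 5 (s≤s z≤n))
      where
      from₂ : ∃[ u ] (B u u ≡ + 1) → ∃[ v ] (B v v ≡ + 2) → ∃[ w ] (B w w ≡ + 3) → ∃[ w ] (B w w ≡ + 5) → D ℕ.≤ 10
      from₂ (u , uu) (v , vv) (w₃ , ww₃) (w₅ , ww₅) = cases (small-entry (B u v) bound)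
        where
        lem : ∀ e q r → 1ℤ * (- e * - e) + + 2 * (1ℤ * 1ℤ) + + 3 * (0ℤ * 0ℤ) + + 2 * (e * (- e * 1ℤ) + q * (- e * 0ℤ) + r * (1ℤ * 0ℤ)) ≡ + 2 - e * e
        lem = solve-∀
        -- Cauchy-Schwarz, read off from the norm 2 - e² of v - e u with e = B u v; the third vector
        -- enters with coefficient 0.
        bound : B u v * B u v ℤ.≤ + 2
        bound = ℤₚ.0≤i-j⇒j≤i (subst (0ℤ ℤ.≤_) (lem (B u v) (B u w₃) (B v w₃)) (psd′ u v w₃ 3 uu vv ww₃ (- B u v) 1ℤ 0ℤ))
        cases : B u v ≡ 0ℤ ⊎ B u v * B u v ≡ 1ℤ → D ℕ.≤ 10
        cases (inj₁ e≡0) = orthogonal-case (B u w₅) (B v w₅)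
          (λ x y z → subst (λ e → 0ℤ ℤ.≤ gram 1ℤ (+ 2) (+ 5) e (B u w₅) (B v w₅) x y z) e≡0 (psd′ u v w₅ 5 uu vv ww₅ x y z))
          (subst (λ e → + D ∣ det₃ 1ℤ (+ 2) (+ 5) e (B u w₅) (B v w₅)) e≡0 (degenerate′ u v w₅ 5 uu vv ww₅))
        cases (inj₂ ee) = unit-case (B u v) (B u w₃) (B v w₃) ee (psd′ u v w₃ 3 uu vv ww₃) (degenerate′ u v w₃ 3 uu vv ww₃)

  -- Modulo D the vectors lie in a plane.
  det-mod : ∀ D s t r x z x′ z′ x″ z″ c₁ c₂ c₃ c₁₂ c₁₃ c₂₃ →
    let A = λ (x z x′ z′ : ℤ) → s * (x * x′) + t * (x * z′ + x′ * z) + r * (z * z′) in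
    D ∣ det₃ (A x z x z + D * c₁) (A x′ z′ x′ z′ + D * c₂) (A x″ z″ x″ z″ + D * c₃) (A x z x′ z′ + D * c₁₂) (A x z x″ z″ + D * c₁₃) (A x′ z′ x″ z″ + D * c₂₃)
  det-mod D s t r x z x′ z′ x″ z″ c₁ c₂ c₃ c₁₂ c₁₃ c₂₃ = divides quotient
    (trans (expand D a₁ a₂ a₃ a₁₂ a₁₃ a₂₃ c₁ c₂ c₃ c₁₂ c₁₃ c₂₃) (trans (cong (_+ quotient * D) (vanish s t r x z x′ z′ x″ z″)) (ℤₚ.+-identityˡ _)))
    where
    A : ℤ → ℤ → ℤ → ℤ → ℤ
    A x z x′ z′ = s * (x * x′) + t * (x * z′ + x′ * z) + r * (z * z′)
    a₁ = A x z x z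
    a₂ = A x′ z′ x′ z′
    a₃ = A x″ z″ x″ z″
    a₁₂ = A x z x′ z′
    a₁₃ = A x z x″ z″
    a₂₃ = A x′ z′ x″ z″
    -- The quotient by D of (a + D a′)(b + D b′)(c + D c′) - a b c, obtained by changing one factor
    -- at a time.
    telescope : (D a b c a′ b′ c′ : ℤ) → ℤ
    telescope D a b c a′ b′ c′ = a′ * (b + D * b′) * (c + D * c′) + a * b′ * (c + D * c′) + a * b * c′
    quotient = telescope D a₁ a₂ a₃ c₁ c₂ c₃ + + 2 * telescope D a₁₂ a₁₃ a₂₃ c₁₂ c₁₃ c₂₃
      - telescope D a₁ a₂₃ a₂₃ c₁ c₂₃ c₂₃ - telescope D a₂ a₁₃ a₁₃ c₂ c₁₃ c₁₃ - telescope D a₃ a₁₂ a₁₂ c₃ c₁₂ c₁₂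
    expand : ∀ D a₁ a₂ a₃ a₁₂ a₁₃ a₂₃ c₁ c₂ c₃ c₁₂ c₁₃ c₂₃ →
      det₃ (a₁ + D * c₁) (a₂ + D * c₂) (a₃ + D * c₃) (a₁₂ + D * c₁₂) (a₁₃ + D * c₁₃) (a₂₃ + D * c₂₃)
      ≡ det₃ a₁ a₂ a₃ a₁₂ a₁₃ a₂₃ + (telescope D a₁ a₂ a₃ c₁ c₂ c₃ + + 2 * telescope D a₁₂ a₁₃ a₂₃ c₁₂ c₁₃ c₂₃
        - telescope D a₁ a₂₃ a₂₃ c₁ c₂₃ c₂₃ - telescope D a₂ a₁₃ a₁₃ c₂ c₁₃ c₁₃ - telescope D a₃ a₁₂ a₁₂ c₃ c₁₂ c₁₂) * D
    expand = solve 13 (λ D a₁ a₂ a₃ a₁₂ a₁₃ a₂₃ c₁ c₂ c₃ c₁₂ c₁₃ c₂₃ →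
      let T = λ a b c a′ b′ c′ → a′ ⊗ (b ⊕ D ⊗ b′) ⊗ (c ⊕ D ⊗ c′) ⊕ a ⊗ b′ ⊗ (c ⊕ D ⊗ c′) ⊕ a ⊗ b ⊗ c′
          det = λ a b c p q r → a ⊗ b ⊗ c ⊕ Κ (+ 2) ⊗ (p ⊗ q ⊗ r) ⊕ ⊝ (a ⊗ (r ⊗ r)) ⊕ ⊝ (b ⊗ (q ⊗ q)) ⊕ ⊝ (c ⊗ (p ⊗ p)) in
      det (a₁ ⊕ D ⊗ c₁) (a₂ ⊕ D ⊗ c₂) (a₃ ⊕ D ⊗ c₃) (a₁₂ ⊕ D ⊗ c₁₂) (a₁₃ ⊕ D ⊗ c₁₃) (a₂₃ ⊕ D ⊗ c₂₃)
      ⊜ (det a₁ a₂ a₃ a₁₂ a₁₃ a₂₃ ⊕ (T a₁ a₂ a₃ c₁ c₂ c₃ ⊕ Κ (+ 2) ⊗ T a₁₂ a₁₃ a₂₃ c₁₂ c₁₃ c₂₃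
        ⊕ ⊝ T a₁ a₂₃ a₂₃ c₁ c₂₃ c₂₃ ⊕ ⊝ T a₂ a₁₃ a₁₃ c₂ c₁₃ c₁₃ ⊕ ⊝ T a₃ a₁₂ a₁₂ c₃ c₁₂ c₁₂) ⊗ D)) refl
    vanish : ∀ s t r x z x′ z′ x″ z″ → let A = λ (x z x′ z′ : ℤ) → s * (x * x′) + t * (x * z′ + x′ * z) + r * (z * z′) in
      det₃ (A x z x z) (A x′ z′ x′ z′) (A x″ z″ x″ z″) (A x z x′ z′) (A x z x″ z″) (A x′ z′ x″ z″) ≡ 0ℤ
    vanish = solve 9 (λ s t r x z x′ z′ x″ z″ →
      let A = λ x z x′ z′ → s ⊗ (x ⊗ x′) ⊕ t ⊗ (x ⊗ z′ ⊕ x′ ⊗ z) ⊕ r ⊗ (z ⊗ z′)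
          det = λ a b c p q r → a ⊗ b ⊗ c ⊕ Κ (+ 2) ⊗ (p ⊗ q ⊗ r) ⊕ ⊝ (a ⊗ (r ⊗ r)) ⊕ ⊝ (b ⊗ (q ⊗ q)) ⊕ ⊝ (c ⊗ (p ⊗ p)) in
      det (A x z x z) (A x′ z′ x′ z′) (A x″ z″ x″ z″) (A x z x′ z′) (A x z x″ z″) (A x′ z′ x″ z″) ⊜ Κ 0ℤ) refl

-- Rational linear algebra, integrality, and a criterion for universality.

module RationalForms where
  open import Defs
  open Quaternions using (V4; ⟨_,_,_,_⟩; Ops)
  open import Data.Nat as ℕ using (ℕ)
  open import Data.Integer as ℤ using (ℤ) renaming (+_ to pos)
  import Data.Integer.Properties as ℤₚ
  open import Data.Rational as ℚ using (ℚ; 0ℚ; 1ℚ; ½; _+_; _*_; _-_; -_; _<_; _≤_)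
  import Data.Rational.Properties as ℚₚ
  open import Data.Rational.Unnormalised as ℚᵘ using (mkℚᵘ; *≡*)
  import Data.Rational.Unnormalised.Properties as ℚᵘₚ
  open import Data.Maybe using (Maybe; just; nothing)
  open import Data.Product using (_×_; _,_; ∃-syntax)
  open import Data.Sum using (_⊎_; inj₁; inj₂)
  open import Data.Empty using (⊥-elim)
  open import Relation.Nullary using (yes; no)
  open import Relation.Binary.PropositionalEquality using (_≡_; _≢_; refl; sym; trans; cong; cong₂; subst; subst₂; module ≡-Reasoning)
  open import Relation.Binary.Definitions using (tri<; tri≈; tri>)
  import Tactic.RingSolver.Core.AlmostCommutativeRing as ACR

  is-zero? : ∀ x → Maybe (0ℚ ≡ x)
  is-zero? x with 0ℚ ℚₚ.≟ x
  ... | yes p = just p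
  ... | no _ = nothing

  ℚ-ring : ACR.AlmostCommutativeRing _ _
  ℚ-ring = ACR.fromCommutativeRing ℚₚ.+-*-commutativeRing is-zero?

  open import Tactic.RingSolver.NonReflective ℚ-ring using (solve; _⊜_; Expr; Κ; _⊕_; _⊗_; ⊝_)

  -- Fractions in ℚ are normalised by a gcd, which does not compute for a variable numerator; the
  -- homomorphism laws are therefore proved with unnormalised fractions of denominator 1.
  toℚᵘ-ℤtoℚ : ∀ a → ℚ.toℚᵘ (ℤtoℚ a) ℚᵘ.≃ mkℚᵘ a 0
  toℚᵘ-ℤtoℚ a = ℚₚ.toℚᵘ-fromℚᵘ (mkℚᵘ a 0)

  ℤtoℚ-+ : ∀ a b → ℤtoℚ a + ℤtoℚ b ≡ ℤtoℚ (a ℤ.+ b)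
  ℤtoℚ-+ a b = ℚₚ.toℚᵘ-injective (ℚᵘₚ.≃-trans (ℚₚ.toℚᵘ-homo-+ (ℤtoℚ a) (ℤtoℚ b))
    (ℚᵘₚ.≃-trans (ℚᵘₚ.+-cong (toℚᵘ-ℤtoℚ a) (toℚᵘ-ℤtoℚ b))
      (ℚᵘₚ.≃-trans (*≡* (cong (ℤ._* pos 1) (cong₂ ℤ._+_ (ℤₚ.*-identityʳ a) (ℤₚ.*-identityʳ b)))) (ℚᵘₚ.≃-sym (toℚᵘ-ℤtoℚ (a ℤ.+ b))))))

  ℤtoℚ-* : ∀ a b → ℤtoℚ a * ℤtoℚ b ≡ ℤtoℚ (a ℤ.* b)
  ℤtoℚ-* a b = ℚₚ.toℚᵘ-injective (ℚᵘₚ.≃-trans (ℚₚ.toℚᵘ-homo-* (ℤtoℚ a) (ℤtoℚ b))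
    (ℚᵘₚ.≃-trans (ℚᵘₚ.*-cong (toℚᵘ-ℤtoℚ a) (toℚᵘ-ℤtoℚ b)) (ℚᵘₚ.≃-sym (toℚᵘ-ℤtoℚ (a ℤ.* b)))))

  ℤtoℚ-neg : ∀ a → - ℤtoℚ a ≡ ℤtoℚ (ℤ.- a)
  ℤtoℚ-neg a = ℚₚ.toℚᵘ-injective (ℚᵘₚ.≃-trans (ℚₚ.toℚᵘ-homo‿- (ℤtoℚ a))
    (ℚᵘₚ.≃-trans (ℚᵘₚ.-‿cong (toℚᵘ-ℤtoℚ a)) (ℚᵘₚ.≃-sym (toℚᵘ-ℤtoℚ (ℤ.- a)))))

  ℤtoℚ-injective : ∀ {a b} → ℤtoℚ a ≡ ℤtoℚ b → a ≡ b
  ℤtoℚ-injective {a} {b} eq with ℚᵘₚ.≃-trans (ℚᵘₚ.≃-sym (toℚᵘ-ℤtoℚ a)) (ℚᵘₚ.≃-trans (ℚᵘₚ.≃-reflexive (cong ℚ.toℚᵘ eq)) (toℚᵘ-ℤtoℚ b))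
  ... | *≡* e = trans (sym (ℤₚ.*-identityʳ a)) (trans e (ℤₚ.*-identityʳ b))

  0≤square : ∀ x → 0ℚ ≤ x * x
  0≤square x with ℚₚ.≤-total 0ℚ x
  ... | inj₁ 0≤x = subst (_≤ x * x) (ℚₚ.*-zeroˡ x) (ℚₚ.*-monoʳ-≤-nonNeg x {{ℚ.nonNegative 0≤x}} 0≤x)
  ... | inj₂ x≤0 = subst (_≤ x * x) (ℚₚ.*-zeroˡ x) (ℚₚ.*-monoʳ-≤-nonPos x {{ℚ.nonPositive x≤0}} x≤0)

  0≤* : ∀ {x y} → 0ℚ ≤ x → 0ℚ ≤ y → 0ℚ ≤ x * y
  0≤* {x} {y} 0≤x 0≤y = subst (_≤ x * y) (ℚₚ.*-zeroˡ y) (ℚₚ.*-monoʳ-≤-nonNeg y {{ℚ.nonNegative 0≤y}} 0≤x)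

  0≤+ : ∀ {x y} → 0ℚ ≤ x → 0ℚ ≤ y → 0ℚ ≤ x + y
  0≤+ = ℚₚ.+-mono-≤

  *≡0 : ∀ x y → x * y ≡ 0ℚ → x ≡ 0ℚ ⊎ y ≡ 0ℚ
  *≡0 x y eq with x ℚₚ.≟ 0ℚ
  ... | yes p = inj₁ p
  ... | no x≢0 = inj₂ (begin
    y ≡⟨ ℚₚ.*-identityˡ y ⟨
    1ℚ * y ≡⟨ cong (_* y) (ℚₚ.*-inverseˡ x) ⟨
    (ℚ.1/ x * x) * y ≡⟨ ℚₚ.*-assoc (ℚ.1/ x) x y ⟩
    ℚ.1/ x * (x * y) ≡⟨ cong (ℚ.1/ x *_) eq ⟩
    ℚ.1/ x * 0ℚ ≡⟨ ℚₚ.*-zeroʳ (ℚ.1/ x) ⟩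
    0ℚ ∎)
    where
    open ≡-Reasoning
    instance
      nz : ℚ.NonZero x
      nz = ℚ.≢-nonZero x≢0

  square≡0 : ∀ x → x * x ≡ 0ℚ → x ≡ 0ℚ
  square≡0 x eq with *≡0 x x eq
  ... | inj₁ p = p
  ... | inj₂ p = p

  +≡0 : ∀ {x y} → 0ℚ ≤ x → 0ℚ ≤ y → x + y ≡ 0ℚ → x ≡ 0ℚ × y ≡ 0ℚ
  +≡0 {x} {y} 0≤x 0≤y eq = x≡0 , trans (sym (ℚₚ.+-identityˡ y)) (trans (cong (_+ y) (sym x≡0)) eq)
    where
    x≡0 : x ≡ 0ℚ
    x≡0 = ℚₚ.≤-antisym (subst₂ _≤_ (ℚₚ.+-identityʳ x) eq (ℚₚ.+-monoʳ-≤ x 0≤y)) 0≤x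

  0<-from : ∀ {x} → 0ℚ ≤ x → x ≢ 0ℚ → 0ℚ < x
  0<-from {x} 0≤x x≢0 with ℚₚ.<-cmp 0ℚ x
  ... | tri< lt _ _ = lt
  ... | tri≈ _ eq _ = ⊥-elim (x≢0 (sym eq))
  ... | tri> _ _ gt = ⊥-elim (ℚₚ.<-irrefl refl (ℚₚ.≤-<-trans 0≤x gt))

  ℚOps : Ops ℚ
  ℚOps = record { _⊞_ = _+_ ; _⊠_ = _*_ ; ⊟_ = -_ ; zer = 0ℚ }

  exprℚOps : ∀ n → Ops (Expr ℚ n)
  exprℚOps n = record { _⊞_ = _⊕_ ; _⊠_ = _⊗_ ; ⊟_ = ⊝_ ; zer = Κ 0ℚ }

  Matrix : Set
  Matrix = V4 (V4 ℚ)

  vec4-≡ : {a a' b b' c c' d d' : ℚ} → a ≡ a' → b ≡ b' → c ≡ c' → d ≡ d' → ⟨ a , b , c , d ⟩ ≡ ⟨ a' , b' , c' , d' ⟩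
  vec4-≡ refl refl refl refl = refl

  -- Generalized quadratic forms over an arbitrary carrier, so that they can be evaluated symbolically.
  record GQF (A : Set) : Set where
    constructor gqf
    field a₁₁ a₁₂ a₂₂ b₁₁ b₁₂ b₂₁ b₂₂ c₁₁ c₁₂ c₂₂ : A × A

  -- The map κ embeds the rational constants: the identity over ℚ, the constant constructor over
  -- solver expressions.
  module Linear {A : Set} (ops : Ops A) (κ : ℚ → A) where
    open Ops ops

    dot : V4 ℚ → V4 A → A
    dot ⟨ a , b , c , d ⟩ ⟨ x , y , z , w ⟩ = κ a ⊠ x ⊞ κ b ⊠ y ⊞ κ c ⊠ z ⊞ κ d ⊠ w

    apply : Matrix → V4 A → V4 A
    apply ⟨ r , s , t , u ⟩ v = ⟨ dot r v , dot s v , dot t v , dot u v ⟩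

    diagonal : ℚ → ℚ → ℚ → V4 A → A
    diagonal a b c ⟨ x , y , z , w ⟩ = x ⊠ x ⊞ κ a ⊠ (y ⊠ y) ⊞ κ b ⊠ (z ⊠ z) ⊞ κ c ⊠ (w ⊠ w)

    form7 : V4 A → A
    form7 ⟨ x , y , z , w ⟩ = x ⊠ x ⊞ κ (ℤtoℚ (pos 2)) ⊠ (y ⊠ y ⊞ y ⊠ z ⊞ κ (ℤtoℚ (pos 2)) ⊠ (z ⊠ z)) ⊞ κ (ℤtoℚ (pos 7)) ⊠ (w ⊠ w)

    mulₐ : A → A × A → A × A → A × A
    mulₐ D (a , b) (c , d) = a ⊠ c ⊞ D ⊠ b ⊠ d , a ⊠ d ⊞ b ⊠ c

    _+ₐ_ : A × A → A × A → A × A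
    (a , b) +ₐ (c , d) = a ⊞ c , b ⊞ d

    τₐ : A × A → A × A
    τₐ (a , b) = a , ⊟ b

    evalₐ : A → GQF A → V4 A → A × A
    evalₐ D G ⟨ x , y , z , w ⟩ =
      m (a₁₁ G) (m z₁ z₁) +ₐ (m (a₁₂ G) (m z₁ z₂) +ₐ (m (a₂₂ G) (m z₂ z₂)
      +ₐ (m (b₁₁ G) (m z₁ (τₐ z₁)) +ₐ (m (b₁₂ G) (m z₁ (τₐ z₂))
      +ₐ (m (b₂₁ G) (m z₂ (τₐ z₁)) +ₐ (m (b₂₂ G) (m z₂ (τₐ z₂))
      +ₐ (m (c₁₁ G) (m (τₐ z₁) (τₐ z₁)) +ₐ (m (c₁₂ G) (m (τₐ z₁) (τₐ z₂))
      +ₐ m (c₂₂ G) (m (τₐ z₂) (τₐ z₂))))))))))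
      where
      open GQF
      m = mulₐ D
      z₁ z₂ : A × A
      z₁ = x , y
      z₂ = z , w

    constant : BinGQF → GQF A
    constant G = gqf (pair (α₁₁ G)) (pair (α₁₂ G)) (pair (α₂₂ G)) (pair (β₁₁ G)) (pair (β₁₂ G)) (pair (β₂₁ G)) (pair (β₂₂ G))
      (pair (γ₁₁ G)) (pair (γ₁₂ G)) (pair (γ₂₂ G))
      where
      pair : K → A × A
      pair (a , b) = κ a , κ b

  open Linear ℚOps (λ q → q)

  row-* : V4 ℚ → Matrix → V4 ℚ
  row-* ⟨ a , b , c , d ⟩ ⟨ ⟨ a₁ , b₁ , c₁ , d₁ ⟩ , ⟨ a₂ , b₂ , c₂ , d₂ ⟩ , ⟨ a₃ , b₃ , c₃ , d₃ ⟩ , ⟨ a₄ , b₄ , c₄ , d₄ ⟩ ⟩ =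
    ⟨ a * a₁ + b * a₂ + c * a₃ + d * a₄ , a * b₁ + b * b₂ + c * b₃ + d * b₄ ,
      a * c₁ + b * c₂ + c * c₃ + d * c₄ , a * d₁ + b * d₂ + c * d₃ + d * d₄ ⟩

  dot-apply : ∀ r M v → dot r (apply M v) ≡ dot (row-* r M) v
  dot-apply ⟨ a , b , c , d ⟩ ⟨ ⟨ a₁ , b₁ , c₁ , d₁ ⟩ , ⟨ a₂ , b₂ , c₂ , d₂ ⟩ , ⟨ a₃ , b₃ , c₃ , d₃ ⟩ , ⟨ a₄ , b₄ , c₄ , d₄ ⟩ ⟩ ⟨ x , y , z , w ⟩ =
    solve 24 (λ a b c d a₁ b₁ c₁ d₁ a₂ b₂ c₂ d₂ a₃ b₃ c₃ d₃ a₄ b₄ c₄ d₄ x y z w →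
      (a ⊗ (a₁ ⊗ x ⊕ b₁ ⊗ y ⊕ c₁ ⊗ z ⊕ d₁ ⊗ w) ⊕ b ⊗ (a₂ ⊗ x ⊕ b₂ ⊗ y ⊕ c₂ ⊗ z ⊕ d₂ ⊗ w)
        ⊕ c ⊗ (a₃ ⊗ x ⊕ b₃ ⊗ y ⊕ c₃ ⊗ z ⊕ d₃ ⊗ w) ⊕ d ⊗ (a₄ ⊗ x ⊕ b₄ ⊗ y ⊕ c₄ ⊗ z ⊕ d₄ ⊗ w))
      ⊜ ((a ⊗ a₁ ⊕ b ⊗ a₂ ⊕ c ⊗ a₃ ⊕ d ⊗ a₄) ⊗ x ⊕ (a ⊗ b₁ ⊕ b ⊗ b₂ ⊕ c ⊗ b₃ ⊕ d ⊗ b₄) ⊗ y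
        ⊕ (a ⊗ c₁ ⊕ b ⊗ c₂ ⊕ c ⊗ c₃ ⊕ d ⊗ c₄) ⊗ z ⊕ (a ⊗ d₁ ⊕ b ⊗ d₂ ⊕ c ⊗ d₃ ⊕ d ⊗ d₄) ⊗ w))
      refl a b c d a₁ b₁ c₁ d₁ a₂ b₂ c₂ d₂ a₃ b₃ c₃ d₃ a₄ b₄ c₄ d₄ x y z w

  _*ₘ_ : Matrix → Matrix → Matrix
  ⟨ r , s , t , u ⟩ *ₘ M = ⟨ row-* r M , row-* s M , row-* t M , row-* u M ⟩

  apply-*ₘ : ∀ L M v → apply L (apply M v) ≡ apply (L *ₘ M) v
  apply-*ₘ ⟨ r , s , t , u ⟩ M v = vec4-≡ (dot-apply r M v) (dot-apply s M v) (dot-apply t M v) (dot-apply u M v)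

  identityₘ : Matrix
  identityₘ = ⟨ ⟨ 1ℚ , 0ℚ , 0ℚ , 0ℚ ⟩ , ⟨ 0ℚ , 1ℚ , 0ℚ , 0ℚ ⟩ , ⟨ 0ℚ , 0ℚ , 1ℚ , 0ℚ ⟩ , ⟨ 0ℚ , 0ℚ , 0ℚ , 1ℚ ⟩ ⟩

  apply-identity : ∀ v → apply identityₘ v ≡ v
  apply-identity ⟨ x , y , z , w ⟩ = vec4-≡
    (solve 4 (λ x y z w → (Κ 1ℚ ⊗ x ⊕ Κ 0ℚ ⊗ y ⊕ Κ 0ℚ ⊗ z ⊕ Κ 0ℚ ⊗ w) ⊜ x) refl x y z w)
    (solve 4 (λ x y z w → (Κ 0ℚ ⊗ x ⊕ Κ 1ℚ ⊗ y ⊕ Κ 0ℚ ⊗ z ⊕ Κ 0ℚ ⊗ w) ⊜ y) refl x y z w)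
    (solve 4 (λ x y z w → (Κ 0ℚ ⊗ x ⊕ Κ 0ℚ ⊗ y ⊕ Κ 1ℚ ⊗ z ⊕ Κ 0ℚ ⊗ w) ⊜ z) refl x y z w)
    (solve 4 (λ x y z w → (Κ 0ℚ ⊗ x ⊕ Κ 0ℚ ⊗ y ⊕ Κ 0ℚ ⊗ z ⊕ Κ 1ℚ ⊗ w) ⊜ w) refl x y z w)

  inverse-apply : ∀ L M → L *ₘ M ≡ identityₘ → ∀ v → apply L (apply M v) ≡ v
  inverse-apply L M eq v = trans (apply-*ₘ L M v) (trans (cong (λ N → apply N v) eq) (apply-identity v))

  0v : V4 ℚ
  0v = ⟨ 0ℚ , 0ℚ , 0ℚ , 0ℚ ⟩

  apply-0 : ∀ M → apply M 0v ≡ 0v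
  apply-0 ⟨ r , s , t , u ⟩ = vec4-≡ (dot-0 r) (dot-0 s) (dot-0 t) (dot-0 u)
    where
    dot-0 : ∀ r → dot r 0v ≡ 0ℚ
    dot-0 ⟨ a , b , c , d ⟩ = solve 4 (λ a b c d → (a ⊗ Κ 0ℚ ⊕ b ⊗ Κ 0ℚ ⊕ c ⊗ Κ 0ℚ ⊕ d ⊗ Κ 0ℚ) ⊜ Κ 0ℚ) refl a b c d

  IsInt : ℚ → Set
  IsInt q = ∃[ k ] (q ≡ ℤtoℚ k)

  IsInt-+ : ∀ {x y} → IsInt x → IsInt y → IsInt (x + y)
  IsInt-+ (a , p) (b , q) = a ℤ.+ b , trans (cong₂ _+_ p q) (ℤtoℚ-+ a b)

  IsInt-* : ∀ {x y} → IsInt x → IsInt y → IsInt (x * y)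
  IsInt-* (a , p) (b , q) = a ℤ.* b , trans (cong₂ _*_ p q) (ℤtoℚ-* a b)

  IsInt-neg : ∀ {x} → IsInt x → IsInt (- x)
  IsInt-neg (a , p) = ℤ.- a , trans (cong -_ p) (ℤtoℚ-neg a)

  int : ∀ a → IsInt (ℤtoℚ a)
  int a = a , refl

  All4 : ∀ {A : Set} → (A → Set) → V4 A → Set
  All4 P ⟨ a , b , c , d ⟩ = P a × P b × P c × P d

  dot-int : ∀ r v → All4 IsInt r → All4 IsInt v → IsInt (dot r v)
  dot-int r v (a , b , c , d) (x , y , z , w) = IsInt-+ (IsInt-+ (IsInt-+ (IsInt-* a x) (IsInt-* b y)) (IsInt-* c z)) (IsInt-* d w)

  apply-int : ∀ M v → All4 (All4 IsInt) M → All4 IsInt v → All4 IsInt (apply M v)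
  apply-int ⟨ r , s , t , u ⟩ v (ir , is , it , iu) iv = dot-int r v ir iv , dot-int s v is iv , dot-int t v it iv , dot-int u v iu iv

  mapℚ : V4 ℤ → V4 ℚ
  mapℚ ⟨ a , b , c , d ⟩ = ⟨ ℤtoℚ a , ℤtoℚ b , ℤtoℚ c , ℤtoℚ d ⟩

  mapℚ-int : ∀ c → All4 IsInt (mapℚ c)
  mapℚ-int ⟨ a , b , c , d ⟩ = int a , int b , int c , int d

  matrix : V4 (V4 ℤ) → Matrix
  matrix ⟨ r , s , t , u ⟩ = ⟨ mapℚ r , mapℚ s , mapℚ t , mapℚ u ⟩

  matrix-int : ∀ M → All4 (All4 IsInt) (matrix M)
  matrix-int ⟨ r , s , t , u ⟩ = mapℚ-int r , mapℚ-int s , mapℚ-int t , mapℚ-int u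

  Definite : (V4 ℚ → ℚ) → Set
  Definite F = ∀ v → v ≢ 0v → 0ℚ < F v

  diagonal-definite : ∀ a b c → 0ℚ < a → 0ℚ < b → 0ℚ < c → Definite (diagonal a b c)
  diagonal-definite a b c 0<a 0<b 0<c v@(⟨ x , y , z , w ⟩) v≢0 = 0<-from (0≤+ (0≤+ (0≤+ sx sy) sz) sw) (λ eq → v≢0 (zeros eq))
    where
    sx = 0≤square x
    sy = 0≤* (ℚₚ.<⇒≤ 0<a) (0≤square y)
    sz = 0≤* (ℚₚ.<⇒≤ 0<b) (0≤square z)
    sw = 0≤* (ℚₚ.<⇒≤ 0<c) (0≤square w)
    strip : ∀ a x → 0ℚ < a → a * (x * x) ≡ 0ℚ → x ≡ 0ℚ
    strip a x 0<a eq with *≡0 a (x * x) eq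
    ... | inj₁ a≡0 = ⊥-elim (ℚₚ.<-irrefl (sym a≡0) 0<a)
    ... | inj₂ xx≡0 = square≡0 x xx≡0
    zeros : diagonal a b c v ≡ 0ℚ → v ≡ 0v
    zeros eq =
      let p₃ , w≡ = +≡0 (0≤+ (0≤+ sx sy) sz) sw eq
          p₂ , z≡ = +≡0 (0≤+ sx sy) sz p₃
          x≡ , y≡ = +≡0 sx sy p₂
      in vec4-≡ (square≡0 x x≡) (strip a y 0<a y≡) (strip b z 0<b z≡) (strip c w 0<c w≡)

  2ℚ ¼ℚ : ℚ
  2ℚ = ℤtoℚ (pos 2)
  ¼ℚ = ½ * ½

  0<2ℚ : 0ℚ < 2ℚ
  0<2ℚ = ℚₚ.positive⁻¹ 2ℚ

  -- y² + yz + 2z² = (y + z/2)² + 7 (z/2)².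
  form7-definite : Definite form7
  form7-definite v@(⟨ x , y , z , w ⟩) v≢0 = subst (0ℚ <_) (sym (square-form x y z w))
    (diagonal-definite 2ℚ (ℤtoℚ (pos 14)) (ℤtoℚ (pos 7)) 0<2ℚ (ℚₚ.positive⁻¹ (ℤtoℚ (pos 14))) (ℚₚ.positive⁻¹ (ℤtoℚ (pos 7))) ⟨ x , y + ½ * z , ½ * z , w ⟩ (λ eq → v≢0 (back eq)))
    where
    square-form : ∀ x y z w → form7 ⟨ x , y , z , w ⟩ ≡ diagonal 2ℚ (ℤtoℚ (pos 14)) (ℤtoℚ (pos 7)) ⟨ x , y + ½ * z , ½ * z , w ⟩
    square-form = solve 4 (λ x y z w → let open Linear (exprℚOps 4) Κ in
      Linear.form7 (exprℚOps 4) Κ ⟨ x , y , z , w ⟩ ⊜ Linear.diagonal (exprℚOps 4) Κ 2ℚ (ℤtoℚ (pos 14)) (ℤtoℚ (pos 7)) ⟨ x , y ⊕ Κ ½ ⊗ z , Κ ½ ⊗ z , w ⟩) refl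
    back : ⟨ x , y + ½ * z , ½ * z , w ⟩ ≡ 0v → v ≡ 0v
    back eq = vec4-≡ (cong V4.c₁ eq) y≡ z≡ (cong V4.c₄ eq)
      where
      l₁ : ∀ z → z ≡ 2ℚ * (½ * z)
      l₁ = solve 1 (λ z → z ⊜ (Κ 2ℚ ⊗ (Κ ½ ⊗ z))) refl
      l₂ : ∀ y z → y ≡ (y + ½ * z) + - (½ * z)
      l₂ = solve 2 (λ y z → y ⊜ ((y ⊕ Κ ½ ⊗ z) ⊕ ⊝ (Κ ½ ⊗ z))) refl
      z≡ : z ≡ 0ℚ
      z≡ = trans (l₁ z) (cong (2ℚ *_) (cong V4.c₃ eq))
      y≡ : y ≡ 0ℚ
      y≡ = trans (l₂ y z) (cong₂ (λ s t → s + - t) (cong V4.c₂ eq) (cong V4.c₃ eq))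

  coords : K → K → V4 ℚ
  coords (x , y) (z , w) = ⟨ x , y , z , w ⟩

  IntegerPair : ℕ → V4 ℚ → Set
  IntegerPair D ⟨ x , y , z , w ⟩ = InOK D (x , y) × InOK D (z , w)

  -- Surjectivity only asks that L⁻¹ carry ℤ⁴ into pairs of integers of K. The converse inclusion is
  -- not imposed, since it fails for D = 5; integrality of the values is a separate condition
  -- instead.
  module Build (D : ℕ) (G : BinGQF) (F : V4 ℚ → ℚ) (L L⁻¹ : Matrix)
    (eval-≡ : ∀ x y → eval D G x y ≡ ι (F (apply L (coords x y))))
    (left : L⁻¹ *ₘ L ≡ identityₘ) (right : L *ₘ L⁻¹ ≡ identityₘ)
    (definite : Definite F)
    (integral : Integral D G)
    (value-int : ∀ x y → InOK D x → InOK D y → IsInt (F (apply L (coords x y))))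
    (lattice : ∀ c → IntegerPair D (apply L⁻¹ (mapℚ c)))
    (represent : ∀ m → 1 ℕ.≤ m → ∃[ c ] (F (mapℚ c) ≡ ℕtoℚ m))
    where

    universal : ZUniversal D G
    universal = positive , integral , valued , onto
      where
      positive : PositiveDefinite D G
      positive x y xy≢0 = subst (PosK D) (sym (eval-≡ x y)) (inj₁ (definite (apply L (coords x y)) nonzero , ℚₚ.≤-refl))
        where
        nonzero : apply L (coords x y) ≢ 0v
        nonzero eq = xy≢0 (cong₂ _,_ (cong V4.c₁ zero-vec) (cong V4.c₂ zero-vec) , cong₂ _,_ (cong V4.c₃ zero-vec) (cong V4.c₄ zero-vec))
          where
          zero-vec : coords x y ≡ 0v
          zero-vec = trans (sym (inverse-apply L⁻¹ L left (coords x y))) (trans (cong (apply L⁻¹) eq) (apply-0 L⁻¹))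
      valued : ZValued D G
      valued x y ix iy = let k , eq = value-int x y ix iy in k , trans (eval-≡ x y) (cong ι eq)
      onto : ∀ m → 1 ℕ.≤ m → ∃[ x ] ∃[ y ] (InOK D x × InOK D y × eval D G x y ≡ ι (ℕtoℚ m))
      onto m 1≤m =
        let c , eq = represent m 1≤m
            v = apply L⁻¹ (mapℚ c)
            ix , iy = lattice c
        in (V4.c₁ v , V4.c₂ v) , (V4.c₃ v , V4.c₄ v) , ix , iy ,
           trans (eval-≡ (V4.c₁ v , V4.c₂ v) (V4.c₃ v , V4.c₄ v)) (cong ι (trans (cong F (inverse-apply L L⁻¹ right (mapℚ c))) eq))

  diagonal-int : ∀ a b c v → All4 IsInt v → IsInt (diagonal (ℤtoℚ a) (ℤtoℚ b) (ℤtoℚ c) v)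
  diagonal-int a b c v (x , y , z , w) =
    IsInt-+ (IsInt-+ (IsInt-+ (IsInt-* x x) (IsInt-* (int a) (IsInt-* y y))) (IsInt-* (int b) (IsInt-* z z))) (IsInt-* (int c) (IsInt-* w w))

  form7-int : ∀ v → All4 IsInt v → IsInt (form7 v)
  form7-int v (x , y , z , w) =
    IsInt-+ (IsInt-+ (IsInt-* x x) (IsInt-* (int (pos 2)) (IsInt-+ (IsInt-+ (IsInt-* y y) (IsInt-* y z)) (IsInt-* (int (pos 2)) (IsInt-* z z)))))
      (IsInt-* (int (pos 7)) (IsInt-* w w))

-- Explicit universal forms for D = 2, 3, 5, 6, 7, 10.

module Examples where
  open import Defs
  open RationalForms
  open FourSquareForms using (module Form1236)
  open SqrtMinusSeven using (module Form7)
  open Residues using (module Form12510)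
  open NormThree using (module Switching)
  open Quaternions using (V4; ⟨_,_,_,_⟩)
  open import Data.Nat as ℕ using (ℕ)
  open import Data.Integer as ℤ using (ℤ; -[1+_]) renaming (+_ to pos)
  open import Data.Rational using (ℚ; 0ℚ; 1ℚ; ½; _+_; _*_; _-_; -_; _≤_)
  import Data.Rational.Properties as ℚₚ
  open import Data.Product using (_×_; _,_; ∃-syntax; proj₁; proj₂)
  open import Relation.Binary.PropositionalEquality using (_≡_; refl; sym; trans; cong; cong₂; subst)

  open Linear ℚOps (λ q → q)
  open import Tactic.RingSolver.NonReflective ℚ-ring using (solve; _⊜_; Κ; _⊕_; _⊗_; ⊝_)

  -- D ≡ 2, 3 (mod 4): the ring of integers is ℤ[√D].
  module Sqrt (D : ℕ) (ω≡ : ω D ≡ (0ℚ , 1ℚ)) where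

    simplify₁ : ∀ m n → m + (n * 0ℚ + ℕtoℚ D * 0ℚ * 1ℚ) ≡ m
    simplify₁ m n = solve 3 (λ m n d → (m ⊕ (n ⊗ Κ 0ℚ ⊕ d ⊗ Κ 0ℚ ⊗ Κ 1ℚ)) ⊜ m) refl m n (ℕtoℚ D)

    simplify₂ : ∀ n → 0ℚ + (n * 1ℚ + 0ℚ * 0ℚ) ≡ n
    simplify₂ = solve 1 (λ n → (Κ 0ℚ ⊕ (n ⊗ Κ 1ℚ ⊕ Κ 0ℚ ⊗ Κ 0ℚ)) ⊜ n) refl

    simplify : ∀ m n → ι m +K mulK D (ι n) (ω D) ≡ (m , n)
    simplify m n = trans (cong (λ w → ι m +K mulK D (ι n) w) ω≡) (cong₂ _,_ (simplify₁ m n) (simplify₂ n))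

    inOK : ∀ {x y} → IsInt x → IsInt y → InOK D (x , y)
    inOK (m , refl) (n , refl) = m , n , sym (simplify (ℤtoℚ m) (ℤtoℚ n))

    inOK⁻¹ : ∀ {x} → InOK D x → IsInt (proj₁ x) × IsInt (proj₂ x)
    inOK⁻¹ (m , n , eq) = (m , trans (cong proj₁ eq) (cong proj₁ (simplify (ℤtoℚ m) (ℤtoℚ n)))) ,
                          (n , trans (cong proj₂ eq) (cong proj₂ (simplify (ℤtoℚ m) (ℤtoℚ n))))

    -- With γ = τα and β₂₁ = τβ₁₂ the values are traces, hence rational.
    module SymmetricForm (a₁ b₁ e₁ a₂ b₂ e₂ a b c d : ℤ) where
      G : BinGQF
      G = record
        { α₁₁ = ℤtoℚ a₁ , ℤtoℚ b₁ ; α₁₂ = ℤtoℚ a , ℤtoℚ b ; α₂₂ = ℤtoℚ a₂ , ℤtoℚ b₂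
        ; β₁₁ = ℤtoℚ e₁ , 0ℚ ; β₁₂ = ℤtoℚ c , ℤtoℚ d ; β₂₁ = ℤtoℚ c , ℤtoℚ (ℤ.- d) ; β₂₂ = ℤtoℚ e₂ , 0ℚ
        ; γ₁₁ = ℤtoℚ a₁ , ℤtoℚ (ℤ.- b₁) ; γ₁₂ = ℤtoℚ a , ℤtoℚ (ℤ.- b) ; γ₂₂ = ℤtoℚ a₂ , ℤtoℚ (ℤ.- b₂) }

      integral : Integral D G
      integral = inOK (int a₁) (int b₁) , inOK (int a) (int b) , inOK (int a₂) (int b₂) ,
        inOK (int e₁) (int ℤ.0ℤ) , inOK (int c) (int d) , inOK (int c) (int (ℤ.- d)) , inOK (int e₂) (int ℤ.0ℤ) ,
        inOK (int a₁) (int (ℤ.- b₁)) , inOK (int a) (int (ℤ.- b)) , inOK (int a₂) (int (ℤ.- b₂))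

    module IntegralBuild (F : V4 ℚ → ℚ) (M M⁻¹ : V4 (V4 ℤ))
      (F-int : ∀ v → All4 IsInt v → IsInt (F v))
      where

      L L⁻¹ : Matrix
      L = matrix M
      L⁻¹ = matrix M⁻¹

      value-int : ∀ x y → InOK D x → InOK D y → IsInt (F (apply L (coords x y)))
      value-int x y ix iy = let x₁ , x₂ = inOK⁻¹ ix ; y₁ , y₂ = inOK⁻¹ iy in
        F-int (apply L (coords x y)) (apply-int L (coords x y) (matrix-int M) (x₁ , x₂ , y₁ , y₂))

      lattice : ∀ c → IntegerPair D (apply L⁻¹ (mapℚ c))
      lattice c = let x , y , z , w = apply-int L⁻¹ (mapℚ c) (matrix-int M⁻¹) (mapℚ-int c) in inOK x y , inOK z w

  represent1236 : ∀ m → 1 ℕ.≤ m → ∃[ c ] (diagonal (ℤtoℚ (pos 2)) (ℤtoℚ (pos 3)) (ℤtoℚ (pos 6)) (mapℚ c) ≡ ℕtoℚ m)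
  represent1236 m 1≤m = convert (Form1236.universal m 1≤m)
    where
    convert : Form1236.Form (pos m) → ∃[ c ] (diagonal (ℤtoℚ (pos 2)) (ℤtoℚ (pos 3)) (ℤtoℚ (pos 6)) (mapℚ c) ≡ ℕtoℚ m)
    convert (x , y , z , w , eq) = ⟨ x , y , z , w ⟩ , trans (proj₂ (diagonal-int (pos 2) (pos 3) (pos 6) (mapℚ ⟨ x , y , z , w ⟩) (mapℚ-int ⟨ x , y , z , w ⟩))) (cong ℤtoℚ eq)

  represent12510 : ∀ m → 1 ℕ.≤ m → ∃[ c ] (diagonal (ℤtoℚ (pos 2)) (ℤtoℚ (pos 5)) (ℤtoℚ (pos 10)) (mapℚ c) ≡ ℕtoℚ m)
  represent12510 m 1≤m = convert (Switching.universal m 1≤m)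
    where
    convert : Form12510.Form (pos m) → ∃[ c ] (diagonal (ℤtoℚ (pos 2)) (ℤtoℚ (pos 5)) (ℤtoℚ (pos 10)) (mapℚ c) ≡ ℕtoℚ m)
    convert (x , y , z , w , eq) = ⟨ x , y , z , w ⟩ , trans (proj₂ (diagonal-int (pos 2) (pos 5) (pos 10) (mapℚ ⟨ x , y , z , w ⟩) (mapℚ-int ⟨ x , y , z , w ⟩))) (cong ℤtoℚ eq)

  represent7 : ∀ m → 1 ℕ.≤ m → ∃[ c ] (form7 (mapℚ c) ≡ ℕtoℚ m)
  represent7 m 1≤m = convert (Form7.universal m 1≤m)
    where
    convert : Form7.Form (pos m) → ∃[ c ] (form7 (mapℚ c) ≡ ℕtoℚ m)
    convert (x , y , z , w , eq) = ⟨ x , y , z , w ⟩ , trans (proj₂ (form7-int (mapℚ ⟨ x , y , z , w ⟩) (mapℚ-int ⟨ x , y , z , w ⟩))) (cong ℤtoℚ eq)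

  definite1236 : Definite (diagonal (ℤtoℚ (pos 2)) (ℤtoℚ (pos 3)) (ℤtoℚ (pos 6)))
  definite1236 = diagonal-definite (ℤtoℚ (pos 2)) (ℤtoℚ (pos 3)) (ℤtoℚ (pos 6)) (ℚₚ.positive⁻¹ (ℤtoℚ (pos 2))) (ℚₚ.positive⁻¹ (ℤtoℚ (pos 3))) (ℚₚ.positive⁻¹ (ℤtoℚ (pos 6)))

  definite12510 : Definite (diagonal (ℤtoℚ (pos 2)) (ℤtoℚ (pos 5)) (ℤtoℚ (pos 10)))
  definite12510 = diagonal-definite (ℤtoℚ (pos 2)) (ℤtoℚ (pos 5)) (ℤtoℚ (pos 10)) (ℚₚ.positive⁻¹ (ℤtoℚ (pos 2))) (ℚₚ.positive⁻¹ (ℤtoℚ (pos 5))) (ℚₚ.positive⁻¹ (ℤtoℚ (pos 10)))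

  -- In coordinates, `SymmetricForm` has x² coefficient 2a₁ + e₁, xy coefficient 4Db₁ and y²
  -- coefficient D(2a₁ - e₁), and similarly in z, w; the coefficients of xz, yw, xw, yz are 2(a +
  -- c), 2D(a - c), 2D(b - d), 2D(b + d). So, besides divisibility by D, there are parity
  -- conditions, such as x² coefficient plus y² coefficient over D being 0 modulo 4. The matrices
  -- here and in the next modules are unimodular changes of basis that meet all of them; here 1 +
  -- 22/2 = 12.
  module D=2 where
    open Sqrt 2 refl
    open SymmetricForm (pos 3) -[1+ 0 ] -[1+ 4 ] (pos 3) (pos 0) -[1+ 2 ] (pos 4) -[1+ 0 ] -[1+ 3 ] (pos 1)

    M M⁻¹ : V4 (V4 ℤ)
    M = ⟨ ⟨ pos 1 , -[1+ 3 ] , pos 0 , -[1+ 3 ] ⟩ , ⟨ pos 0 , pos 0 , pos 0 , pos 1 ⟩ , ⟨ pos 0 , pos 0 , pos 1 , pos 0 ⟩ , ⟨ pos 0 , pos 1 , pos 0 , pos 0 ⟩ ⟩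
    M⁻¹ = ⟨ ⟨ pos 1 , pos 4 , pos 0 , pos 4 ⟩ , ⟨ pos 0 , pos 0 , pos 0 , pos 1 ⟩ , ⟨ pos 0 , pos 0 , pos 1 , pos 0 ⟩ , ⟨ pos 0 , pos 1 , pos 0 , pos 0 ⟩ ⟩

    F : V4 ℚ → ℚ
    F = diagonal (ℤtoℚ (pos 2)) (ℤtoℚ (pos 3)) (ℤtoℚ (pos 6))

    open IntegralBuild F M M⁻¹ (diagonal-int (pos 2) (pos 3) (pos 6))

    eval-≡ : ∀ x y → eval 2 G x y ≡ ι (F (apply L (coords x y)))
    eval-≡ (x , y) (z , w) = cong₂ _,_
      (solve 4 (λ x y z w → let open Linear (exprℚOps 4) Κ using () renaming (diagonal to F′; apply to apply′; evalₐ to eval′; constant to constant′) in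
        proj₁ (eval′ (Κ (ℕtoℚ 2)) (constant′ G) ⟨ x , y , z , w ⟩) ⊜ F′ (ℤtoℚ (pos 2)) (ℤtoℚ (pos 3)) (ℤtoℚ (pos 6)) (apply′ L ⟨ x , y , z , w ⟩)) refl x y z w)
      (solve 4 (λ x y z w → let open Linear (exprℚOps 4) Κ using () renaming (evalₐ to eval′; constant to constant′) in
        proj₂ (eval′ (Κ (ℕtoℚ 2)) (constant′ G) ⟨ x , y , z , w ⟩) ⊜ Κ 0ℚ) refl x y z w)

    open Build 2 G F L L⁻¹ eval-≡ refl refl definite1236 integral value-int lattice represent1236 public

  module D=3 where
    open Sqrt 3 refl
    open SymmetricForm (pos 5) -[1+ 0 ] -[1+ 8 ] (pos 4) (pos 0) -[1+ 5 ] (pos 6) -[1+ 1 ] -[1+ 5 ] (pos 0)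

    M M⁻¹ : V4 (V4 ℤ)
    M = ⟨ ⟨ pos 1 , -[1+ 5 ] , pos 0 , -[1+ 5 ] ⟩ , ⟨ pos 0 , -[1+ 2 ] , pos 1 , pos 0 ⟩ , ⟨ pos 0 , pos 1 , pos 0 , pos 0 ⟩ , ⟨ pos 0 , pos 0 , pos 0 , -[1+ 0 ] ⟩ ⟩
    M⁻¹ = ⟨ ⟨ pos 1 , pos 0 , pos 6 , -[1+ 5 ] ⟩ , ⟨ pos 0 , pos 0 , pos 1 , pos 0 ⟩ , ⟨ pos 0 , pos 1 , pos 3 , pos 0 ⟩ , ⟨ pos 0 , pos 0 , pos 0 , -[1+ 0 ] ⟩ ⟩

    F : V4 ℚ → ℚ
    F = diagonal (ℤtoℚ (pos 2)) (ℤtoℚ (pos 3)) (ℤtoℚ (pos 6))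

    open IntegralBuild F M M⁻¹ (diagonal-int (pos 2) (pos 3) (pos 6))

    eval-≡ : ∀ x y → eval 3 G x y ≡ ι (F (apply L (coords x y)))
    eval-≡ (x , y) (z , w) = cong₂ _,_
      (solve 4 (λ x y z w → let open Linear (exprℚOps 4) Κ using () renaming (diagonal to F′; apply to apply′; evalₐ to eval′; constant to constant′) in
        proj₁ (eval′ (Κ (ℕtoℚ 3)) (constant′ G) ⟨ x , y , z , w ⟩) ⊜ F′ (ℤtoℚ (pos 2)) (ℤtoℚ (pos 3)) (ℤtoℚ (pos 6)) (apply′ L ⟨ x , y , z , w ⟩)) refl x y z w)
      (solve 4 (λ x y z w → let open Linear (exprℚOps 4) Κ using () renaming (evalₐ to eval′; constant to constant′) in
        proj₂ (eval′ (Κ (ℕtoℚ 3)) (constant′ G) ⟨ x , y , z , w ⟩) ⊜ Κ 0ℚ) refl x y z w)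

    open Build 3 G F L L⁻¹ eval-≡ refl refl definite1236 integral value-int lattice represent1236 public

  module D=6 where
    open Sqrt 6 refl
    open SymmetricForm (pos 7) -[1+ 0 ] -[1+ 12 ] (pos 4) -[1+ 0 ] -[1+ 2 ] (pos 7) -[1+ 0 ] -[1+ 6 ] (pos 0)

    M M⁻¹ : V4 (V4 ℤ)
    M = ⟨ ⟨ pos 1 , -[1+ 11 ] , pos 0 , -[1+ 5 ] ⟩ , ⟨ pos 0 , pos 0 , -[1+ 0 ] , pos 3 ⟩ , ⟨ pos 0 , -[1+ 1 ] , pos 1 , -[1+ 1 ] ⟩ , ⟨ pos 0 , pos 1 , pos 0 , pos 0 ⟩ ⟩
    M⁻¹ = ⟨ ⟨ pos 1 , pos 6 , pos 6 , pos 24 ⟩ , ⟨ pos 0 , pos 0 , pos 0 , pos 1 ⟩ , ⟨ pos 0 , pos 2 , pos 3 , pos 6 ⟩ , ⟨ pos 0 , pos 1 , pos 1 , pos 2 ⟩ ⟩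

    F : V4 ℚ → ℚ
    F = diagonal (ℤtoℚ (pos 2)) (ℤtoℚ (pos 3)) (ℤtoℚ (pos 6))

    open IntegralBuild F M M⁻¹ (diagonal-int (pos 2) (pos 3) (pos 6))

    eval-≡ : ∀ x y → eval 6 G x y ≡ ι (F (apply L (coords x y)))
    eval-≡ (x , y) (z , w) = cong₂ _,_
      (solve 4 (λ x y z w → let open Linear (exprℚOps 4) Κ using () renaming (diagonal to F′; apply to apply′; evalₐ to eval′; constant to constant′) in
        proj₁ (eval′ (Κ (ℕtoℚ 6)) (constant′ G) ⟨ x , y , z , w ⟩) ⊜ F′ (ℤtoℚ (pos 2)) (ℤtoℚ (pos 3)) (ℤtoℚ (pos 6)) (apply′ L ⟨ x , y , z , w ⟩)) refl x y z w)
      (solve 4 (λ x y z w → let open Linear (exprℚOps 4) Κ using () renaming (evalₐ to eval′; constant to constant′) in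
        proj₂ (eval′ (Κ (ℕtoℚ 6)) (constant′ G) ⟨ x , y , z , w ⟩) ⊜ Κ 0ℚ) refl x y z w)

    open Build 6 G F L L⁻¹ eval-≡ refl refl definite1236 integral value-int lattice represent1236 public

  module D=7 where
    open Sqrt 7 refl
    open SymmetricForm (pos 8) -[1+ 0 ] -[1+ 14 ] (pos 5) -[1+ 0 ] -[1+ 5 ] (pos 8) -[1+ 0 ] -[1+ 7 ] (pos 0)

    M M⁻¹ : V4 (V4 ℤ)
    M = ⟨ ⟨ pos 1 , -[1+ 13 ] , pos 0 , -[1+ 6 ] ⟩ , ⟨ pos 0 , -[1+ 0 ] , pos 0 , pos 2 ⟩ , ⟨ pos 0 , pos 2 , -[1+ 0 ] , pos 3 ⟩ , ⟨ pos 0 , pos 1 , pos 0 , -[1+ 0 ] ⟩ ⟩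
    M⁻¹ = ⟨ ⟨ pos 1 , pos 21 , pos 0 , pos 35 ⟩ , ⟨ pos 0 , pos 1 , pos 0 , pos 2 ⟩ , ⟨ pos 0 , pos 5 , -[1+ 0 ] , pos 7 ⟩ , ⟨ pos 0 , pos 1 , pos 0 , pos 1 ⟩ ⟩

    F : V4 ℚ → ℚ
    F = form7

    open IntegralBuild F M M⁻¹ form7-int

    eval-≡ : ∀ x y → eval 7 G x y ≡ ι (F (apply L (coords x y)))
    eval-≡ (x , y) (z , w) = cong₂ _,_
      (solve 4 (λ x y z w → let open Linear (exprℚOps 4) Κ using () renaming (form7 to F′; apply to apply′; evalₐ to eval′; constant to constant′) in
        proj₁ (eval′ (Κ (ℕtoℚ 7)) (constant′ G) ⟨ x , y , z , w ⟩) ⊜ F′ (apply′ L ⟨ x , y , z , w ⟩)) refl x y z w)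
      (solve 4 (λ x y z w → let open Linear (exprℚOps 4) Κ using () renaming (evalₐ to eval′; constant to constant′) in
        proj₂ (eval′ (Κ (ℕtoℚ 7)) (constant′ G) ⟨ x , y , z , w ⟩) ⊜ Κ 0ℚ) refl x y z w)

    open Build 7 G F L L⁻¹ eval-≡ refl refl form7-definite integral value-int lattice represent7 public

  module D=10 where
    open Sqrt 10 refl
    open SymmetricForm (pos 11) -[1+ 0 ] -[1+ 20 ] (pos 7) -[1+ 0 ] -[1+ 6 ] (pos 10) -[1+ 0 ] -[1+ 9 ] (pos 0)

    M M⁻¹ : V4 (V4 ℤ)
    M = ⟨ ⟨ pos 1 , -[1+ 19 ] , pos 0 , -[1+ 9 ] ⟩ , ⟨ pos 0 , pos 0 , pos 1 , -[1+ 4 ] ⟩ , ⟨ pos 0 , -[1+ 1 ] , pos 1 , -[1+ 1 ] ⟩ , ⟨ pos 0 , -[1+ 0 ] , pos 0 , pos 2 ⟩ ⟩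
    M⁻¹ = ⟨ ⟨ pos 1 , pos 50 , -[1+ 49 ] , pos 80 ⟩ , ⟨ pos 0 , pos 2 , -[1+ 1 ] , pos 3 ⟩ , ⟨ pos 0 , pos 6 , -[1+ 4 ] , pos 10 ⟩ , ⟨ pos 0 , pos 1 , -[1+ 0 ] , pos 2 ⟩ ⟩

    F : V4 ℚ → ℚ
    F = diagonal (ℤtoℚ (pos 2)) (ℤtoℚ (pos 5)) (ℤtoℚ (pos 10))

    open IntegralBuild F M M⁻¹ (diagonal-int (pos 2) (pos 5) (pos 10))

    eval-≡ : ∀ x y → eval 10 G x y ≡ ι (F (apply L (coords x y)))
    eval-≡ (x , y) (z , w) = cong₂ _,_
      (solve 4 (λ x y z w → let open Linear (exprℚOps 4) Κ using () renaming (diagonal to F′; apply to apply′; evalₐ to eval′; constant to constant′) in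
        proj₁ (eval′ (Κ (ℕtoℚ 10)) (constant′ G) ⟨ x , y , z , w ⟩) ⊜ F′ (ℤtoℚ (pos 2)) (ℤtoℚ (pos 5)) (ℤtoℚ (pos 10)) (apply′ L ⟨ x , y , z , w ⟩)) refl x y z w)
      (solve 4 (λ x y z w → let open Linear (exprℚOps 4) Κ using () renaming (evalₐ to eval′; constant to constant′) in
        proj₂ (eval′ (Κ (ℕtoℚ 10)) (constant′ G) ⟨ x , y , z , w ⟩) ⊜ Κ 0ℚ) refl x y z w)

    open Build 10 G F L L⁻¹ eval-≡ refl refl definite12510 integral value-int lattice represent12510 public

  module D=5 where
    inOK : ∀ m n → InOK 5 (ℤtoℚ m + ½ * ℤtoℚ n , ½ * ℤtoℚ n)
    inOK m n = m , n , sym (cong₂ _,_ (lem₁ (ℤtoℚ m) (ℤtoℚ n)) (lem₂ (ℤtoℚ n)))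
      where
      lem₁ : ∀ m n → m + (n * ½ + ℕtoℚ 5 * 0ℚ * ½) ≡ m + ½ * n
      lem₁ = solve 2 (λ m n → (m ⊕ (n ⊗ Κ ½ ⊕ Κ (ℕtoℚ 5) ⊗ Κ 0ℚ ⊗ Κ ½)) ⊜ (m ⊕ Κ ½ ⊗ n)) refl
      lem₂ : ∀ n → 0ℚ + (n * ½ + 0ℚ * ½) ≡ ½ * n
      lem₂ = solve 1 (λ n → (Κ 0ℚ ⊕ (n ⊗ Κ ½ ⊕ Κ 0ℚ ⊗ Κ ½)) ⊜ (Κ ½ ⊗ n)) refl

    inOK⁻¹ : ∀ {x} → InOK 5 x → ∃[ m ] ∃[ n ] (x ≡ (ℤtoℚ m + ½ * ℤtoℚ n , ½ * ℤtoℚ n))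
    inOK⁻¹ (m , n , eq) = m , n , trans eq (sym (proj₂ (proj₂ (inOK m n))))

    -- The form splits: Tr(z₁²) = 2x² + 10y², and Tr((5 + √5)/2 · z₂²) + 4 z₂ τ(z₂) = (2z)² + 5 (z +
    -- w)².
    G : BinGQF
    G = record
      { α₁₁ = 1ℚ , 0ℚ ; α₁₂ = 0K ; α₂₂ = ℤtoℚ (pos 2) + ½ , ½
      ; β₁₁ = 0K ; β₁₂ = 0K ; β₂₁ = 0K ; β₂₂ = ℤtoℚ (pos 4) , 0ℚ
      ; γ₁₁ = 1ℚ , 0ℚ ; γ₁₂ = 0K ; γ₂₂ = ℤtoℚ (pos 2) + ½ , - ½ }

    integral : Integral 5 G
    integral = inOK (pos 1) (pos 0) , inOK (pos 0) (pos 0) , inOK (pos 2) (pos 1) ,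
      inOK (pos 0) (pos 0) , inOK (pos 0) (pos 0) , inOK (pos 0) (pos 0) , inOK (pos 4) (pos 0) ,
      inOK (pos 1) (pos 0) , inOK (pos 0) (pos 0) , inOK (pos 3) -[1+ 0 ]

    classical : Classical 5 G
    classical = integral , zero₂ , zero₂ , zero₂ , zero₂ , zero₂ , (ℤtoℚ (pos 2) , 0ℚ) , inOK (pos 2) (pos 0) , refl
      where
      zero₂ : In2OK 5 0K
      zero₂ = 0K , inOK (pos 0) (pos 0) , refl

    L L⁻¹ : Matrix
    L = matrix ⟨ ⟨ pos 0 , pos 0 , pos 2 , pos 0 ⟩ , ⟨ pos 1 , pos 0 , pos 0 , pos 0 ⟩ , ⟨ pos 0 , pos 0 , pos 1 , pos 1 ⟩ , ⟨ pos 0 , pos 1 , pos 0 , pos 0 ⟩ ⟩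
    L⁻¹ = ⟨ ⟨ 0ℚ , 1ℚ , 0ℚ , 0ℚ ⟩ , ⟨ 0ℚ , 0ℚ , 0ℚ , 1ℚ ⟩ , ⟨ ½ , 0ℚ , 0ℚ , 0ℚ ⟩ , ⟨ - ½ , 0ℚ , 1ℚ , 0ℚ ⟩ ⟩

    F : V4 ℚ → ℚ
    F = diagonal (ℤtoℚ (pos 2)) (ℤtoℚ (pos 5)) (ℤtoℚ (pos 10))

    eval-≡ : ∀ x y → eval 5 G x y ≡ ι (F (apply L (coords x y)))
    eval-≡ (x , y) (z , w) = cong₂ _,_
      (solve 4 (λ x y z w → let open Linear (exprℚOps 4) Κ using () renaming (diagonal to F′; apply to apply′; evalₐ to eval′; constant to constant′) in
        proj₁ (eval′ (Κ (ℕtoℚ 5)) (constant′ G) ⟨ x , y , z , w ⟩) ⊜ F′ (ℤtoℚ (pos 2)) (ℤtoℚ (pos 5)) (ℤtoℚ (pos 10)) (apply′ L ⟨ x , y , z , w ⟩)) refl x y z w)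
      (solve 4 (λ x y z w → let open Linear (exprℚOps 4) Κ using () renaming (evalₐ to eval′; constant to constant′) in
        proj₂ (eval′ (Κ (ℕtoℚ 5)) (constant′ G) ⟨ x , y , z , w ⟩) ⊜ Κ 0ℚ) refl x y z w)

    -- The coordinates of L may be half-integers here. They combine well nevertheless: for m + nω
    -- the part 2x² + 10y² is 2m² + 2mn + 3n².
    value-int : ∀ x y → InOK 5 x → InOK 5 y → IsInt (F (apply L (coords x y)))
    value-int x y ix iy = go (inOK⁻¹ ix) (inOK⁻¹ iy)
      where
      value : ℚ → ℚ → ℚ → ℚ → ℚ
      value m n p q = (2ℚ * p + q) * (2ℚ * p + q) + (2ℚ * (m * m) + 2ℚ * (m * n) + ℤtoℚ (pos 3) * (n * n)) + ℤtoℚ (pos 5) * ((p + q) * (p + q))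
      lem : ∀ m n p q → F (apply L ⟨ m + ½ * n , ½ * n , p + ½ * q , ½ * q ⟩) ≡ value m n p q
      lem = solve 4 (λ m n p q → let open Linear (exprℚOps 4) Κ using () renaming (diagonal to F′; apply to apply′) in
        F′ (ℤtoℚ (pos 2)) (ℤtoℚ (pos 5)) (ℤtoℚ (pos 10)) (apply′ L ⟨ m ⊕ Κ ½ ⊗ n , Κ ½ ⊗ n , p ⊕ Κ ½ ⊗ q , Κ ½ ⊗ q ⟩)
          ⊜ ((Κ 2ℚ ⊗ p ⊕ q) ⊗ (Κ 2ℚ ⊗ p ⊕ q) ⊕ (Κ 2ℚ ⊗ (m ⊗ m) ⊕ Κ 2ℚ ⊗ (m ⊗ n) ⊕ Κ (ℤtoℚ (pos 3)) ⊗ (n ⊗ n)) ⊕ Κ (ℤtoℚ (pos 5)) ⊗ ((p ⊕ q) ⊗ (p ⊕ q)))) refl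
      value-integer : ∀ {m n p q} → IsInt m → IsInt n → IsInt p → IsInt q → IsInt (value m n p q)
      value-integer m n p q = IsInt-+ (IsInt-+ (IsInt-* 2p+q 2p+q) (IsInt-+ (IsInt-+ (IsInt-* two (IsInt-* m m)) (IsInt-* two (IsInt-* m n))) (IsInt-* (int (pos 3)) (IsInt-* n n))))
        (IsInt-* (int (pos 5)) (IsInt-* (IsInt-+ p q) (IsInt-+ p q)))
        where
        two = int (pos 2)
        2p+q = IsInt-+ (IsInt-* two p) q
      go : ∃[ m ] ∃[ n ] (x ≡ (ℤtoℚ m + ½ * ℤtoℚ n , ½ * ℤtoℚ n)) → ∃[ p ] ∃[ q ] (y ≡ (ℤtoℚ p + ½ * ℤtoℚ q , ½ * ℤtoℚ q)) → IsInt (F (apply L (coords x y)))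
      go (m , n , refl) (p , q , refl) = subst IsInt (sym (lem (ℤtoℚ m) (ℤtoℚ n) (ℤtoℚ p) (ℤtoℚ q))) (value-integer (int m) (int n) (int p) (int q))

    lattice : ∀ c → IntegerPair 5 (apply L⁻¹ (mapℚ c))
    lattice ⟨ a , b , c , d ⟩ =
      member (IsInt-+ (int b) (IsInt-neg (int d))) (IsInt-* (int (pos 2)) (int d)) (cong₂ _,_ (lem₁ a′ b′ c′ d′) (lem₂ a′ b′ c′ d′)) ,
      member (IsInt-+ (int a) (IsInt-neg (int c))) (IsInt-+ (IsInt-* (int (pos 2)) (int c)) (IsInt-neg (int a))) (cong₂ _,_ (lem₃ a′ b′ c′ d′) (lem₄ a′ b′ c′ d′))
      where
      a′ = ℤtoℚ a
      b′ = ℤtoℚ b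
      c′ = ℤtoℚ c
      d′ = ℤtoℚ d
      member : ∀ {x m n} → IsInt m → IsInt n → x ≡ (m + ½ * n , ½ * n) → InOK 5 x
      member (m , refl) (n , refl) refl = inOK m n
      lem₁ : ∀ a b c d → 0ℚ * a + 1ℚ * b + 0ℚ * c + 0ℚ * d ≡ (b + - d) + ½ * (2ℚ * d)
      lem₁ = solve 4 (λ a b c d → (Κ 0ℚ ⊗ a ⊕ Κ 1ℚ ⊗ b ⊕ Κ 0ℚ ⊗ c ⊕ Κ 0ℚ ⊗ d) ⊜ ((b ⊕ ⊝ d) ⊕ Κ ½ ⊗ (Κ 2ℚ ⊗ d))) refl
      lem₂ : ∀ a b c d → 0ℚ * a + 0ℚ * b + 0ℚ * c + 1ℚ * d ≡ ½ * (2ℚ * d)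
      lem₂ = solve 4 (λ a b c d → (Κ 0ℚ ⊗ a ⊕ Κ 0ℚ ⊗ b ⊕ Κ 0ℚ ⊗ c ⊕ Κ 1ℚ ⊗ d) ⊜ (Κ ½ ⊗ (Κ 2ℚ ⊗ d))) refl
      lem₃ : ∀ a b c d → ½ * a + 0ℚ * b + 0ℚ * c + 0ℚ * d ≡ (a + - c) + ½ * (2ℚ * c + - a)
      lem₃ = solve 4 (λ a b c d → (Κ ½ ⊗ a ⊕ Κ 0ℚ ⊗ b ⊕ Κ 0ℚ ⊗ c ⊕ Κ 0ℚ ⊗ d) ⊜ ((a ⊕ ⊝ c) ⊕ Κ ½ ⊗ (Κ 2ℚ ⊗ c ⊕ ⊝ a))) refl
      lem₄ : ∀ a b c d → - ½ * a + 0ℚ * b + 1ℚ * c + 0ℚ * d ≡ ½ * (2ℚ * c + - a)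
      lem₄ = solve 4 (λ a b c d → (Κ (- ½) ⊗ a ⊕ Κ 0ℚ ⊗ b ⊕ Κ 1ℚ ⊗ c ⊕ Κ 0ℚ ⊗ d) ⊜ (Κ ½ ⊗ (Κ 2ℚ ⊗ c ⊕ ⊝ a))) refl

    open Build 5 G F L L⁻¹ eval-≡ refl refl definite12510 integral value-int lattice represent12510 public

-- The bilinear form of a universal form and the bound on D.

module BilinearForms where
  open import Defs
  open RationalForms
  open GramDeterminants using (module Escalation; det-mod; det₃; gram)
  open Quaternions using (V4; ⟨_,_,_,_⟩; Ops; ℤOps)
  open import Data.Nat as ℕ using (ℕ)
  open import Data.Integer as ℤ using (ℤ) renaming (+_ to pos)
  import Data.Integer.Properties as ℤₚ
  open import Data.Rational using (ℚ; 0ℚ; 1ℚ; ½; _+_; _*_; _-_; -_; _≤_)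
  import Data.Rational.Properties as ℚₚ
  import Data.Rational.Unnormalised as ℚᵘ
  import Data.Rational.Unnormalised.Properties as ℚᵘₚ
  import Data.Integer.Divisibility.Signed as ℤ∣
  import Data.Integer.Tactic.RingSolver as ℤ-Solver
  open import Data.Product using (_×_; _,_; ∃-syntax; proj₁; proj₂)
  open import Data.Sum using (inj₁; inj₂)
  open import Data.Empty using (⊥-elim)
  open import Relation.Nullary using (¬_; Dec; yes; no)
  open import Relation.Binary.PropositionalEquality using (_≡_; refl; sym; trans; cong; cong₂; subst)

  open Linear ℚOps (λ q → q) using (evalₐ)
  open import Tactic.RingSolver.NonReflective ℚ-ring using (solve; _⊜_; Κ; _⊕_; _⊗_; ⊝_)

  -- A symmetric bilinear form in coordinates (x, y, z, w); D is factored out of the entries which involve y or w.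
  record Sym (A : Set) : Set where
    constructor sym₄
    field s t r h₁₂ h₁₄ h₂₂ h₂₃ h₂₄ h₃₄ h₄₄ : A

  module Bilinear {A : Set} (ops : Ops A) where
    open Ops ops

    pairing : A → Sym A → V4 A → V4 A → A
    pairing D (sym₄ s t r h₁₂ h₁₄ h₂₂ h₂₃ h₂₄ h₃₄ h₄₄) ⟨ x , y , z , w ⟩ ⟨ x′ , y′ , z′ , w′ ⟩ =
      s ⊠ (x ⊠ x′) ⊞ t ⊠ (x ⊠ z′ ⊞ x′ ⊠ z) ⊞ r ⊠ (z ⊠ z′)
        ⊞ D ⊠ (h₁₂ ⊠ (x ⊠ y′ ⊞ x′ ⊠ y) ⊞ h₁₄ ⊠ (x ⊠ w′ ⊞ x′ ⊠ w) ⊞ h₂₂ ⊠ (y ⊠ y′) ⊞ h₂₃ ⊠ (y ⊠ z′ ⊞ y′ ⊠ z)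
          ⊞ h₂₄ ⊠ (y ⊠ w′ ⊞ y′ ⊠ w) ⊞ h₃₄ ⊠ (z ⊠ w′ ⊞ z′ ⊠ w) ⊞ h₄₄ ⊠ (w ⊠ w′))

    combine : A → A → A → V4 A → V4 A → V4 A → V4 A
    combine i j k ⟨ x , y , z , w ⟩ ⟨ x′ , y′ , z′ , w′ ⟩ ⟨ x″ , y″ , z″ , w″ ⟩ =
      ⟨ i ⊠ x ⊞ j ⊠ x′ ⊞ k ⊠ x″ , i ⊠ y ⊞ j ⊠ y′ ⊞ k ⊠ y″ , i ⊠ z ⊞ j ⊠ z′ ⊞ k ⊠ z″ , i ⊠ w ⊞ j ⊠ w′ ⊞ k ⊠ w″ ⟩

    scale : A → V4 A → V4 A
    scale k ⟨ x , y , z , w ⟩ = ⟨ k ⊠ x , k ⊠ y , k ⊠ z , k ⊠ w ⟩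

    scaleSym : A → Sym A → Sym A
    scaleSym k (sym₄ s t r h₁₂ h₁₄ h₂₂ h₂₃ h₂₄ h₃₄ h₄₄) =
      sym₄ (k ⊠ s) (k ⊠ t) (k ⊠ r) (k ⊠ h₁₂) (k ⊠ h₁₄) (k ⊠ h₂₂) (k ⊠ h₂₃) (k ⊠ h₂₄) (k ⊠ h₃₄) (k ⊠ h₄₄)

    -- The rational and irrational parts of the bilinear form attached to a generalized quadratic form.
    module _ (½ₐ : A) where
      real : GQF A → Sym A
      real (gqf (a₁ , a₁′) (a , a′) (a₂ , a₂′) (e₁ , e₁′) (c , c′) (d , d′) (e₂ , e₂′) (g₁ , g₁′) (b , b′) (g₂ , g₂′)) = sym₄
        (a₁ ⊞ g₁ ⊞ e₁) (½ₐ ⊠ (a ⊞ b ⊞ (c ⊞ d))) (a₂ ⊞ g₂ ⊞ e₂)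
        (a₁′ ⊟ g₁′) (½ₐ ⊠ (a′ ⊟ b′ ⊟ (c′ ⊟ d′))) (a₁ ⊞ g₁ ⊟ e₁) (½ₐ ⊠ (a′ ⊟ b′ ⊞ (c′ ⊟ d′)))
        (½ₐ ⊠ (a ⊞ b ⊟ (c ⊞ d))) (a₂′ ⊟ g₂′) (a₂ ⊞ g₂ ⊟ e₂)

      imaginary : A → GQF A → Sym A
      imaginary D (gqf (a₁ , a₁′) (a , a′) (a₂ , a₂′) (e₁ , e₁′) (c , c′) (d , d′) (e₂ , e₂′) (g₁ , g₁′) (b , b′) (g₂ , g₂′)) = sym₄
        (a₁′ ⊞ g₁′ ⊞ e₁′) (½ₐ ⊠ (a′ ⊞ b′ ⊞ (c′ ⊞ d′))) (a₂′ ⊞ g₂′ ⊞ e₂′)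
        (a₁ ⊟ g₁) (½ₐ ⊠ (a ⊟ b ⊟ (c ⊟ d))) (D ⊠ (a₁′ ⊞ g₁′ ⊟ e₁′)) (½ₐ ⊠ (a ⊟ b ⊞ (c ⊟ d)))
        (D ⊠ (½ₐ ⊠ (a′ ⊞ b′ ⊟ (c′ ⊞ d′)))) (a₂ ⊟ g₂) (D ⊠ (a₂′ ⊞ g₂′ ⊟ e₂′))

  open Bilinear ℚOps

  coefficients : BinGQF → GQF ℚ
  coefficients G = gqf (α₁₁ G) (α₁₂ G) (α₂₂ G) (β₁₁ G) (β₁₂ G) (β₂₁ G) (β₂₂ G) (γ₁₁ G) (γ₁₂ G) (γ₂₂ G)

  eval-real : ∀ D G v → proj₁ (evalₐ D G v) ≡ pairing D (real ½ G) v v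
  eval-real D (gqf (a₁ , a₁′) (a , a′) (a₂ , a₂′) (e₁ , e₁′) (c , c′) (d , d′) (e₂ , e₂′) (g₁ , g₁′) (b , b′) (g₂ , g₂′)) ⟨ x , y , z , w ⟩ =
    solve 25 (λ a₁ a₁′ a a′ a₂ a₂′ e₁ e₁′ c c′ d d′ e₂ e₂′ g₁ g₁′ b b′ g₂ g₂′ D x y z w →
      let module E = Bilinear (exprℚOps 25) ; G = gqf (a₁ , a₁′) (a , a′) (a₂ , a₂′) (e₁ , e₁′) (c , c′) (d , d′) (e₂ , e₂′) (g₁ , g₁′) (b , b′) (g₂ , g₂′) in
      proj₁ (Linear.evalₐ (exprℚOps 25) Κ D G ⟨ x , y , z , w ⟩) ⊜ E.pairing D (E.real (Κ ½) G) ⟨ x , y , z , w ⟩ ⟨ x , y , z , w ⟩)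
      refl a₁ a₁′ a a′ a₂ a₂′ e₁ e₁′ c c′ d d′ e₂ e₂′ g₁ g₁′ b b′ g₂ g₂′ D x y z w

  eval-imaginary : ∀ D G v → proj₂ (evalₐ D G v) ≡ pairing 1ℚ (imaginary ½ D G) v v
  eval-imaginary D (gqf (a₁ , a₁′) (a , a′) (a₂ , a₂′) (e₁ , e₁′) (c , c′) (d , d′) (e₂ , e₂′) (g₁ , g₁′) (b , b′) (g₂ , g₂′)) ⟨ x , y , z , w ⟩ =
    solve 25 (λ a₁ a₁′ a a′ a₂ a₂′ e₁ e₁′ c c′ d d′ e₂ e₂′ g₁ g₁′ b b′ g₂ g₂′ D x y z w →
      let module E = Bilinear (exprℚOps 25) ; G = gqf (a₁ , a₁′) (a , a′) (a₂ , a₂′) (e₁ , e₁′) (c , c′) (d , d′) (e₂ , e₂′) (g₁ , g₁′) (b , b′) (g₂ , g₂′) in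
      proj₂ (Linear.evalₐ (exprℚOps 25) Κ D G ⟨ x , y , z , w ⟩) ⊜ E.pairing (Κ 1ℚ) (E.imaginary (Κ ½) D G) ⟨ x , y , z , w ⟩ ⟨ x , y , z , w ⟩)
      refl a₁ a₁′ a a′ a₂ a₂′ e₁ e₁′ c c′ d d′ e₂ e₂′ g₁ g₁′ b b′ g₂ g₂′ D x y z w

  -- One factor k clears the denominators of the entries and one those of each vector, while the
  -- factored D stays untouched.
  pairing-scale : ∀ k D g u v → k * (k * (k * pairing D g u v)) ≡ pairing D (scaleSym k g) (scale k u) (scale k v)
  pairing-scale k D (sym₄ s t r h₁₂ h₁₄ h₂₂ h₂₃ h₂₄ h₃₄ h₄₄) ⟨ x , y , z , w ⟩ ⟨ x′ , y′ , z′ , w′ ⟩ =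
    solve 20 (λ k D s t r h₁₂ h₁₄ h₂₂ h₂₃ h₂₄ h₃₄ h₄₄ x y z w x′ y′ z′ w′ →
      let module E = Bilinear (exprℚOps 20) ; g = sym₄ s t r h₁₂ h₁₄ h₂₂ h₂₃ h₂₄ h₃₄ h₄₄ in
      (k ⊗ (k ⊗ (k ⊗ E.pairing D g ⟨ x , y , z , w ⟩ ⟨ x′ , y′ , z′ , w′ ⟩)))
        ⊜ E.pairing D (E.scaleSym k g) (E.scale k ⟨ x , y , z , w ⟩) (E.scale k ⟨ x′ , y′ , z′ , w′ ⟩))
      refl k D s t r h₁₂ h₁₄ h₂₂ h₂₃ h₂₄ h₃₄ h₄₄ x y z w x′ y′ z′ w′

  gramℚ : (a b c p q r x y z : ℚ) → ℚ
  gramℚ a b c p q r x y z = a * (x * x) + b * (y * y) + c * (z * z) + 2ℚ * (p * (x * y) + q * (x * z) + r * (y * z))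

  pairing-combine : ∀ D g i j k u v t → let c = combine i j k u v t in
    pairing D g c c ≡ gramℚ (pairing D g u u) (pairing D g v v) (pairing D g t t) (pairing D g u v) (pairing D g u t) (pairing D g v t) i j k
  pairing-combine D (sym₄ s t r h₁₂ h₁₄ h₂₂ h₂₃ h₂₄ h₃₄ h₄₄) i j k ⟨ x , y , z , w ⟩ ⟨ x′ , y′ , z′ , w′ ⟩ ⟨ x″ , y″ , z″ , w″ ⟩ =
    solve 26 (λ D s t r h₁₂ h₁₄ h₂₂ h₂₃ h₂₄ h₃₄ h₄₄ i j k x y z w x′ y′ z′ w′ x″ y″ z″ w″ →
      let module E = Bilinear (exprℚOps 26) ; B = E.pairing D (sym₄ s t r h₁₂ h₁₄ h₂₂ h₂₃ h₂₄ h₃₄ h₄₄)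
          u = ⟨ x , y , z , w ⟩ ; v = ⟨ x′ , y′ , z′ , w′ ⟩ ; q = ⟨ x″ , y″ , z″ , w″ ⟩ ; c = E.combine i j k u v q in
      B c c ⊜ (B u u ⊗ (i ⊗ i) ⊕ B v v ⊗ (j ⊗ j) ⊕ B q q ⊗ (k ⊗ k) ⊕ Κ 2ℚ ⊗ (B u v ⊗ (i ⊗ j) ⊕ B u q ⊗ (i ⊗ k) ⊕ B v q ⊗ (j ⊗ k))))
      refl D s t r h₁₂ h₁₄ h₂₂ h₂₃ h₂₄ h₃₄ h₄₄ i j k x y z w x′ y′ z′ w′ x″ y″ z″ w″

  module Polar {A : Set} (ops : Ops A) (κ : ℚ → A) where
    open Linear ops κ using (mulₐ; _+ₐ_; τₐ)

    -- The bilinear form attached to double D G; a classical form over the ring of integers is of this kind.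
    polar : A → GQF A → V4 A → V4 A → A × A
    polar D G ⟨ x , y , z , w ⟩ ⟨ x′ , y′ , z′ , w′ ⟩ =
      m (a₁₁ G) (m z₁ y₁) +ₐ (m (a₂₂ G) (m z₂ y₂) +ₐ (m (c₁₁ G) (m (τₐ z₁) (τₐ y₁)) +ₐ (m (c₂₂ G) (m (τₐ z₂) (τₐ y₂))
      +ₐ (m (b₁₁ G) (m z₁ (τₐ y₁) +ₐ m y₁ (τₐ z₁)) +ₐ (m (b₂₂ G) (m z₂ (τₐ y₂) +ₐ m y₂ (τₐ z₂))
      +ₐ (m (a₁₂ G) (m z₁ y₂ +ₐ m y₁ z₂) +ₐ (m (c₁₂ G) (m (τₐ z₁) (τₐ y₂) +ₐ m (τₐ y₁) (τₐ z₂))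
      +ₐ (m (b₁₂ G) (m z₁ (τₐ y₂) +ₐ m y₁ (τₐ z₂)) +ₐ m (b₂₁ G) (m z₂ (τₐ y₁) +ₐ m y₂ (τₐ z₁))))))))))
      where
      open GQF
      m = mulₐ D
      z₁ z₂ y₁ y₂ : A × A
      z₁ = x , y
      z₂ = z , w
      y₁ = x′ , y′
      y₂ = z′ , w′

    double : A → GQF A → GQF A
    double D (gqf a₁₁ a₁₂ a₂₂ b₁₁ b₁₂ b₂₁ b₂₂ c₁₁ c₁₂ c₂₂) =
      gqf a₁₁ (two a₁₂) a₂₂ (two b₁₁) (two b₁₂) (two b₂₁) (two b₂₂) c₁₁ (two c₁₂) c₂₂
      where
      two : A × A → A × A
      two = mulₐ D (κ 2ℚ , κ 0ℚ)

  open Polar ℚOps (λ q → q) using (polar; double)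

  polar-real : ∀ D G u v → proj₁ (polar D G u v) ≡ pairing D (real ½ (double D G)) u v
  polar-real D (gqf (a , a′) (b , b′) (c , c′) (d , d′) (e , e′) (f , f′) (g , g′) (h , h′) (i , i′) (j , j′)) ⟨ x , y , z , w ⟩ ⟨ p , q , r , s ⟩ =
    solve 29 (λ a a′ b b′ c c′ d d′ e e′ f f′ g g′ h h′ i i′ j j′ D x y z w p q r s →
      let module E = Bilinear (exprℚOps 29)
          G = gqf (a , a′) (b , b′) (c , c′) (d , d′) (e , e′) (f , f′) (g , g′) (h , h′) (i , i′) (j , j′) in
      proj₁ (Polar.polar (exprℚOps 29) Κ D G ⟨ x , y , z , w ⟩ ⟨ p , q , r , s ⟩) ⊜ E.pairing D (E.real (Κ ½) (Polar.double (exprℚOps 29) Κ D G)) ⟨ x , y , z , w ⟩ ⟨ p , q , r , s ⟩)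
      refl a a′ b b′ c c′ d d′ e e′ f f′ g g′ h h′ i i′ j j′ D x y z w p q r s

  polar-imaginary : ∀ D G u v → proj₂ (polar D G u v) ≡ pairing 1ℚ (imaginary ½ D (double D G)) u v
  polar-imaginary D (gqf (a , a′) (b , b′) (c , c′) (d , d′) (e , e′) (f , f′) (g , g′) (h , h′) (i , i′) (j , j′)) ⟨ x , y , z , w ⟩ ⟨ p , q , r , s ⟩ =
    solve 29 (λ a a′ b b′ c c′ d d′ e e′ f f′ g g′ h h′ i i′ j j′ D x y z w p q r s →
      let module E = Bilinear (exprℚOps 29)
          G = gqf (a , a′) (b , b′) (c , c′) (d , d′) (e , e′) (f , f′) (g , g′) (h , h′) (i , i′) (j , j′) in
      proj₂ (Polar.polar (exprℚOps 29) Κ D G ⟨ x , y , z , w ⟩ ⟨ p , q , r , s ⟩) ⊜ E.pairing (Κ 1ℚ) (E.imaginary (Κ ½) D (Polar.double (exprℚOps 29) Κ D G)) ⟨ x , y , z , w ⟩ ⟨ p , q , r , s ⟩)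
      refl a a′ b b′ c c′ d d′ e e′ f f′ g g′ h h′ i i′ j j′ D x y z w p q r s

  All10 : (ℚ → Set) → Sym ℚ → Set
  All10 P g = P s × P t × P r × P h₁₂ × P h₁₄ × P h₂₂ × P h₂₃ × P h₂₄ × P h₃₄ × P h₄₄
    where open Sym g

  pairingℤ : ℤ → Sym ℤ → V4 ℤ → V4 ℤ → ℤ
  pairingℤ = Bilinear.pairing ℤOps

  symℚ : Sym ℤ → Sym ℚ
  symℚ (sym₄ s t r h₁₂ h₁₄ h₂₂ h₂₃ h₂₄ h₃₄ h₄₄) =
    sym₄ (ℤtoℚ s) (ℤtoℚ t) (ℤtoℚ r) (ℤtoℚ h₁₂) (ℤtoℚ h₁₄) (ℤtoℚ h₂₂) (ℤtoℚ h₂₃) (ℤtoℚ h₂₄) (ℤtoℚ h₃₄) (ℤtoℚ h₄₄)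

  integral-sym : ∀ g → All10 IsInt g → ∃[ g′ ] (g ≡ symℚ g′)
  integral-sym (sym₄ _ _ _ _ _ _ _ _ _ _) ((s , refl) , (t , refl) , (r , refl) , (h₁₂ , refl) , (h₁₄ , refl) , (h₂₂ , refl) , (h₂₃ , refl) , (h₂₄ , refl) , (h₃₄ , refl) , (h₄₄ , refl)) =
    sym₄ s t r h₁₂ h₁₄ h₂₂ h₂₃ h₂₄ h₃₄ h₄₄ , refl

  integral-vec : ∀ v → All4 IsInt v → ∃[ v′ ] (v ≡ mapℚ v′)
  integral-vec _ ((x , refl) , (y , refl) , (z , refl) , (w , refl)) = ⟨ x , y , z , w ⟩ , refl

  pairing-int : ∀ D g u v → pairing (ℤtoℚ D) (symℚ g) (mapℚ u) (mapℚ v) ≡ ℤtoℚ (pairingℤ D g u v)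
  pairing-int D (sym₄ s t r h₁₂ h₁₄ h₂₂ h₂₃ h₂₄ h₃₄ h₄₄) ⟨ x , y , z , w ⟩ ⟨ x′ , y′ , z′ , w′ ⟩ = proj₂ (
    int s ⊛ (int x ⊛ int x′) ⊞ int t ⊛ (int x ⊛ int z′ ⊞ int x′ ⊛ int z) ⊞ int r ⊛ (int z ⊛ int z′)
      ⊞ int D ⊛ (int h₁₂ ⊛ (int x ⊛ int y′ ⊞ int x′ ⊛ int y) ⊞ int h₁₄ ⊛ (int x ⊛ int w′ ⊞ int x′ ⊛ int w) ⊞ int h₂₂ ⊛ (int y ⊛ int y′)
        ⊞ int h₂₃ ⊛ (int y ⊛ int z′ ⊞ int y′ ⊛ int z) ⊞ int h₂₄ ⊛ (int y ⊛ int w′ ⊞ int y′ ⊛ int w) ⊞ int h₃₄ ⊛ (int z ⊛ int w′ ⊞ int z′ ⊛ int w) ⊞ int h₄₄ ⊛ (int w ⊛ int w′)))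
    where
    infixl 6 _⊞_
    infixl 7 _⊛_
    _⊞_ = IsInt-+
    _⊛_ = IsInt-*

  0≤ℤtoℚ⇒0≤ : ∀ {a} → 0ℚ ≤ ℤtoℚ a → ℤ.0ℤ ℤ.≤ a
  0≤ℤtoℚ⇒0≤ {a} le with ℚᵘₚ.≤-respʳ-≃ (toℚᵘ-ℤtoℚ a) (ℚₚ.toℚᵘ-mono-≤ le)
  ... | ℚᵘ.*≤* l = subst (ℤ.0ℤ ℤ.≤_) (ℤₚ.*-identityʳ a) l

  module Integers (D : ℕ) where
    private
      d p q : ℚ
      d = ℕtoℚ D
      p = proj₁ (ω D)
      q = proj₂ (ω D)

    fromCoordinates : ℚ → ℚ → K
    fromCoordinates m n = ι m +K mulK D (ι n) (ω D)

    inOK-combine : ∀ i j k {x y z} → InOK D x → InOK D y → InOK D z →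
      InOK D (ℤtoℚ i * proj₁ x + ℤtoℚ j * proj₁ y + ℤtoℚ k * proj₁ z , ℤtoℚ i * proj₂ x + ℤtoℚ j * proj₂ y + ℤtoℚ k * proj₂ z)
    inOK-combine i j k (m , n , refl) (m′ , n′ , refl) (m″ , n″ , refl) =
      member (IsInt-+ (IsInt-+ (IsInt-* (int i) (int m)) (IsInt-* (int j) (int m′))) (IsInt-* (int k) (int m″)))
             (IsInt-+ (IsInt-+ (IsInt-* (int i) (int n)) (IsInt-* (int j) (int n′))) (IsInt-* (int k) (int n″)))
             (cong₂ _,_ (real-part (ℤtoℚ i) (ℤtoℚ j) (ℤtoℚ k) (ℤtoℚ m) (ℤtoℚ n) (ℤtoℚ m′) (ℤtoℚ n′) (ℤtoℚ m″) (ℤtoℚ n″) p q d)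
                        (imaginary-part (ℤtoℚ i) (ℤtoℚ j) (ℤtoℚ k) (ℤtoℚ n) (ℤtoℚ n′) (ℤtoℚ n″) p q))
      where
      member : ∀ {x m n} → IsInt m → IsInt n → x ≡ fromCoordinates m n → InOK D x
      member (m , refl) (n , refl) eq = m , n , eq
      real-part : ∀ i j k m n m′ n′ m″ n″ p q d →
        i * (m + (n * p + d * 0ℚ * q)) + j * (m′ + (n′ * p + d * 0ℚ * q)) + k * (m″ + (n″ * p + d * 0ℚ * q))
          ≡ (i * m + j * m′ + k * m″) + ((i * n + j * n′ + k * n″) * p + d * 0ℚ * q)
      real-part = solve 12 (λ i j k m n m′ n′ m″ n″ p q d →
        (i ⊗ (m ⊕ (n ⊗ p ⊕ d ⊗ Κ 0ℚ ⊗ q)) ⊕ j ⊗ (m′ ⊕ (n′ ⊗ p ⊕ d ⊗ Κ 0ℚ ⊗ q)) ⊕ k ⊗ (m″ ⊕ (n″ ⊗ p ⊕ d ⊗ Κ 0ℚ ⊗ q)))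
          ⊜ ((i ⊗ m ⊕ j ⊗ m′ ⊕ k ⊗ m″) ⊕ ((i ⊗ n ⊕ j ⊗ n′ ⊕ k ⊗ n″) ⊗ p ⊕ d ⊗ Κ 0ℚ ⊗ q))) refl
      imaginary-part : ∀ i j k n n′ n″ p q →
        i * (0ℚ + (n * q + 0ℚ * p)) + j * (0ℚ + (n′ * q + 0ℚ * p)) + k * (0ℚ + (n″ * q + 0ℚ * p)) ≡ 0ℚ + ((i * n + j * n′ + k * n″) * q + 0ℚ * p)
      imaginary-part = solve 8 (λ i j k n n′ n″ p q →
        (i ⊗ (Κ 0ℚ ⊕ (n ⊗ q ⊕ Κ 0ℚ ⊗ p)) ⊕ j ⊗ (Κ 0ℚ ⊕ (n′ ⊗ q ⊕ Κ 0ℚ ⊗ p)) ⊕ k ⊗ (Κ 0ℚ ⊕ (n″ ⊗ q ⊕ Κ 0ℚ ⊗ p)))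
          ⊜ (Κ 0ℚ ⊕ ((i ⊗ n ⊕ j ⊗ n′ ⊕ k ⊗ n″) ⊗ q ⊕ Κ 0ℚ ⊗ p))) refl

    record Point : Set where
      constructor point
      field
        z₁ z₂ : K
        z₁∈ : InOK D z₁
        z₂∈ : InOK D z₂

      vector : V4 ℚ
      vector = coords z₁ z₂

    open Point public using (vector)

    combination : ℤ → ℤ → ℤ → Point → Point → Point → Point
    combination i j k u v t = point _ _ (inOK-combine i j k (z₁∈ u) (z₁∈ v) (z₁∈ t)) (inOK-combine i j k (z₂∈ u) (z₂∈ v) (z₂∈ t))
      where open Point

    module Necessity (G : BinGQF) (positive : PositiveDefinite D G) (valued : ZValued D G)
      (onto : ∀ (m : ℕ) → 1 ℕ.≤ m → ∃[ x ] ∃[ y ] (InOK D x × InOK D y × eval D G x y ≡ ι (ℕtoℚ m)))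
      where

      g gᵢ : Sym ℚ
      g = real ½ (coefficients G)
      gᵢ = imaginary ½ d (coefficients G)

      value : ∀ u → ∃[ k ] (pairing d g (vector u) (vector u) ≡ ℤtoℚ k)
      value (point x y x∈ y∈) = let k , eq = valued x y x∈ y∈ in
        k , trans (sym (eval-real d (coefficients G) (coords x y))) (cong proj₁ eq)

      imaginary-zero : ∀ u → pairing 1ℚ gᵢ (vector u) (vector u) ≡ 0ℚ
      imaginary-zero (point x y x∈ y∈) = trans (sym (eval-imaginary d (coefficients G) (coords x y))) (cong proj₂ (proj₂ (valued x y x∈ y∈)))

      -- Polarisation: the irrational part of the values vanishes at u, v and u + v. The ternary
      -- identity is used with v repeated and coefficient 0.
      imaginary-polar : ∀ u v → pairing 1ℚ gᵢ (vector u) (vector v) ≡ 0ℚ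
      imaginary-polar u v = trans (half (pairing 1ℚ gᵢ (vector u) (vector v))) (trans (cong (½ *_) doubled) (ℚₚ.*-zeroʳ ½))
        where
        half : ∀ x → x ≡ ½ * (2ℚ * x)
        half = solve 1 (λ x → x ⊜ (Κ ½ ⊗ (Κ 2ℚ ⊗ x))) refl
        B = pairing 1ℚ gᵢ
        lem : ∀ a b c p q r → 2ℚ * p ≡ gramℚ a b c p q r 1ℚ 1ℚ 0ℚ + - a + - b
        lem = solve 6 (λ a b c p q r → (Κ 2ℚ ⊗ p) ⊜ (a ⊗ (Κ 1ℚ ⊗ Κ 1ℚ) ⊕ b ⊗ (Κ 1ℚ ⊗ Κ 1ℚ) ⊕ c ⊗ (Κ 0ℚ ⊗ Κ 0ℚ)
          ⊕ Κ 2ℚ ⊗ (p ⊗ (Κ 1ℚ ⊗ Κ 1ℚ) ⊕ q ⊗ (Κ 1ℚ ⊗ Κ 0ℚ) ⊕ r ⊗ (Κ 1ℚ ⊗ Κ 0ℚ)) ⊕ ⊝ a ⊕ ⊝ b)) refl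
        sum : gramℚ (B (vector u) (vector u)) (B (vector v) (vector v)) (B (vector v) (vector v)) (B (vector u) (vector v)) (B (vector u) (vector v)) (B (vector v) (vector v)) 1ℚ 1ℚ 0ℚ ≡ 0ℚ
        sum = trans (sym (pairing-combine 1ℚ gᵢ 1ℚ 1ℚ 0ℚ (vector u) (vector v) (vector v))) (imaginary-zero (combination (pos 1) (pos 1) (pos 0) u v v))
        doubled : 2ℚ * B (vector u) (vector v) ≡ 0ℚ
        doubled = trans (lem (B (vector u) (vector u)) (B (vector v) (vector v)) (B (vector v) (vector v)) (B (vector u) (vector v)) (B (vector u) (vector v)) (B (vector v) (vector v)))
          (cong₂ (λ s t → s + t) (cong₂ (λ s t → s + - t) sum (imaginary-zero u)) (cong -_ (imaginary-zero v)))

      -- Values at integral points are rational, which refutes the three alternatives of `PosK` with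
      -- a nonzero coefficient of √D. The zero vector is treated apart.
      value≥0 : ∀ u → 0ℚ ≤ pairing d g (vector u) (vector u)
      value≥0 u@(point x y x∈ y∈) = decide (proj₁ x ℚₚ.≟ 0ℚ) (proj₂ x ℚₚ.≟ 0ℚ) (proj₁ y ℚₚ.≟ 0ℚ) (proj₂ y ℚₚ.≟ 0ℚ)
        where
        fromPos : ∀ {k} → PosK D (ι (ℤtoℚ k)) → 0ℚ ≤ ℤtoℚ k
        fromPos (inj₁ (0<k , _)) = ℚₚ.<⇒≤ 0<k
        fromPos (inj₂ (inj₁ (_ , 0<0))) = ⊥-elim (ℚₚ.<-irrefl refl 0<0)
        fromPos (inj₂ (inj₂ (inj₁ (_ , 0<0 , _)))) = ⊥-elim (ℚₚ.<-irrefl refl 0<0)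
        fromPos (inj₂ (inj₂ (inj₂ (_ , 0<0 , _)))) = ⊥-elim (ℚₚ.<-irrefl refl 0<0)
        nonzero : ¬ (x ≡ 0K × y ≡ 0K) → 0ℚ ≤ pairing d g (vector u) (vector u)
        nonzero xy≢0 = subst (0ℚ ≤_) (sym (proj₂ (value u)))
          (fromPos {proj₁ (valued x y x∈ y∈)} (subst (PosK D) (proj₂ (valued x y x∈ y∈)) (positive x y xy≢0)))
        decide : Dec (proj₁ x ≡ 0ℚ) → Dec (proj₂ x ≡ 0ℚ) → Dec (proj₁ y ≡ 0ℚ) → Dec (proj₂ y ≡ 0ℚ) → 0ℚ ≤ pairing d g (vector u) (vector u)
        decide (no ¬p) _ _ _ = nonzero (λ eq → ¬p (cong proj₁ (proj₁ eq)))
        decide _ (no ¬p) _ _ = nonzero (λ eq → ¬p (cong proj₂ (proj₁ eq)))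
        decide _ _ (no ¬p) _ = nonzero (λ eq → ¬p (cong proj₁ (proj₂ eq)))
        decide _ _ _ (no ¬p) = nonzero (λ eq → ¬p (cong proj₂ (proj₂ eq)))
        decide (yes x₁) (yes x₂) (yes y₁) (yes y₂) =
          ℚₚ.≤-reflexive (sym (trans (cong (λ v → pairing d g v v) (vec4-≡ x₁ x₂ y₁ y₂)) (at-zero d g)))
          where
          at-zero : ∀ d g → pairing d g 0v 0v ≡ 0ℚ
          at-zero d (sym₄ s t r h₁₂ h₁₄ h₂₂ h₂₃ h₂₄ h₃₄ h₄₄) = solve 11 (λ d s t r h₁₂ h₁₄ h₂₂ h₂₃ h₂₄ h₃₄ h₄₄ →
            let o = ⟨ Κ 0ℚ , Κ 0ℚ , Κ 0ℚ , Κ 0ℚ ⟩ in Bilinear.pairing (exprℚOps 11) d (sym₄ s t r h₁₂ h₁₄ h₂₂ h₂₃ h₂₄ h₃₄ h₄₄) o o ⊜ Κ 0ℚ)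
            refl d s t r h₁₂ h₁₄ h₂₂ h₂₃ h₂₄ h₃₄ h₄₄

      -- The number κ is a common denominator that can be cancelled modulo D: 1 when the integers of
      -- K are ℤ[√D], and 2, with D odd, when half-integers occur.
      module Bound (κ : ℤ) (cancel : ∀ x → pos D ℤ∣.∣ κ ℤ.* x → pos D ℤ∣.∣ x)
        (scaled-g : All10 IsInt (scaleSym (ℤtoℚ κ) g))
        (scaled-vector : ∀ u → All4 IsInt (scale (ℤtoℚ κ) (vector u)))
        (pairing-integral : ∀ u v → IsInt (pairing d g (vector u) (vector v)))
        where

        B : Point → Point → ℤ
        B u v = proj₁ (pairing-integral u v)

        B≡ : ∀ u v → pairing d g (vector u) (vector v) ≡ ℤtoℚ (B u v)
        B≡ u v = proj₂ (pairing-integral u v)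

        psd : ∀ u v t i j k → ℤ.0ℤ ℤ.≤ gram (B u u) (B v v) (B t t) (B u v) (B u t) (B v t) i j k
        psd u v t i j k = 0≤ℤtoℚ⇒0≤ (subst (0ℚ ≤_) eq (value≥0 (combination i j k u v t)))
          where
          infixl 6 _⊞_
          infixl 7 _⊛_
          _⊞_ = IsInt-+
          _⊛_ = IsInt-*
          uu = pairing-integral u u
          vv = pairing-integral v v
          tt = pairing-integral t t
          uv = pairing-integral u v
          ut = pairing-integral u t
          vt = pairing-integral v t
          eq : pairing d g (vector (combination i j k u v t)) (vector (combination i j k u v t)) ≡ ℤtoℚ (gram (B u u) (B v v) (B t t) (B u v) (B u t) (B v t) i j k)
          eq = trans (pairing-combine d g (ℤtoℚ i) (ℤtoℚ j) (ℤtoℚ k) (vector u) (vector v) (vector t))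
            (proj₂ (uu ⊛ (int i ⊛ int i) ⊞ vv ⊛ (int j ⊛ int j) ⊞ tt ⊛ (int k ⊛ int k)
              ⊞ int (pos 2) ⊛ (uv ⊛ (int i ⊛ int j) ⊞ ut ⊛ (int i ⊛ int k) ⊞ vt ⊛ (int j ⊛ int k))))

        ĝ : Sym ℤ
        ĝ = proj₁ (integral-sym (scaleSym (ℤtoℚ κ) g) scaled-g)

        hat : Point → V4 ℤ
        hat u = proj₁ (integral-vec (scale (ℤtoℚ κ) (vector u)) (scaled-vector u))

        B-scaled : ∀ u v → κ ℤ.* (κ ℤ.* (κ ℤ.* B u v)) ≡ pairingℤ (pos D) ĝ (hat u) (hat v)
        B-scaled u v = ℤtoℚ-injective (trans (sym (proj₂ (IsInt-* (int κ) (IsInt-* (int κ) (IsInt-* (int κ) (pairing-integral u v))))))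
          (trans (pairing-scale (ℤtoℚ κ) d g (vector u) (vector v))
            (trans (cong₂ (λ g u → pairing d g u (scale (ℤtoℚ κ) (vector v))) (proj₂ (integral-sym (scaleSym (ℤtoℚ κ) g) scaled-g))
                                                    (proj₂ (integral-vec (scale (ℤtoℚ κ) (vector u)) (scaled-vector u))))
              (trans (cong (pairing d (symℚ ĝ) (mapℚ (hat u))) (proj₂ (integral-vec (scale (ℤtoℚ κ) (vector v)) (scaled-vector v))))
                (pairing-int (pos D) ĝ (hat u) (hat v))))))

        det-hat : ∀ g u v t → let P = pairingℤ (pos D) g in pos D ℤ∣.∣ det₃ (P u u) (P v v) (P t t) (P u v) (P u t) (P v t)
        det-hat (sym₄ s t r h₁₂ h₁₄ h₂₂ h₂₃ h₂₄ h₃₄ h₄₄) ⟨ x , y , z , w ⟩ ⟨ x′ , y′ , z′ , w′ ⟩ ⟨ x″ , y″ , z″ , w″ ⟩ =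
          det-mod (pos D) s t r x z x′ z′ x″ z″ (C x y z w x y z w) (C x′ y′ z′ w′ x′ y′ z′ w′) (C x″ y″ z″ w″ x″ y″ z″ w″)
            (C x y z w x′ y′ z′ w′) (C x y z w x″ y″ z″ w″) (C x′ y′ z′ w′ x″ y″ z″ w″)
          where
          open Ops ℤOps
          C : (x y z w x′ y′ z′ w′ : ℤ) → ℤ
          C x y z w x′ y′ z′ w′ = h₁₂ ⊠ (x ⊠ y′ ⊞ x′ ⊠ y) ⊞ h₁₄ ⊠ (x ⊠ w′ ⊞ x′ ⊠ w) ⊞ h₂₂ ⊠ (y ⊠ y′) ⊞ h₂₃ ⊠ (y ⊠ z′ ⊞ y′ ⊠ z)
            ⊞ h₂₄ ⊠ (y ⊠ w′ ⊞ y′ ⊠ w) ⊞ h₃₄ ⊠ (z ⊠ w′ ⊞ z′ ⊠ w) ⊞ h₄₄ ⊠ (w ⊠ w′)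

        det-scaled : ∀ k a b c p q r → det₃ (k ℤ.* a) (k ℤ.* b) (k ℤ.* c) (k ℤ.* p) (k ℤ.* q) (k ℤ.* r) ≡ k ℤ.* (k ℤ.* (k ℤ.* det₃ a b c p q r))
        det-scaled = lem
          where
          lem : ∀ k a b c p q r → k ℤ.* a ℤ.* (k ℤ.* b) ℤ.* (k ℤ.* c) ℤ.+ pos 2 ℤ.* (k ℤ.* p ℤ.* (k ℤ.* q) ℤ.* (k ℤ.* r)) ℤ.- k ℤ.* a ℤ.* (k ℤ.* r ℤ.* (k ℤ.* r)) ℤ.- k ℤ.* b ℤ.* (k ℤ.* q ℤ.* (k ℤ.* q)) ℤ.- k ℤ.* c ℤ.* (k ℤ.* p ℤ.* (k ℤ.* p))
            ≡ k ℤ.* (k ℤ.* (k ℤ.* (a ℤ.* b ℤ.* c ℤ.+ pos 2 ℤ.* (p ℤ.* q ℤ.* r) ℤ.- a ℤ.* (r ℤ.* r) ℤ.- b ℤ.* (q ℤ.* q) ℤ.- c ℤ.* (p ℤ.* p))))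
          lem = ℤ-Solver.solve-∀

        cancel³ : ∀ x → pos D ℤ∣.∣ κ ℤ.* (κ ℤ.* (κ ℤ.* x)) → pos D ℤ∣.∣ x
        cancel³ x e = cancel x (cancel (κ ℤ.* x) (cancel (κ ℤ.* (κ ℤ.* x)) e))

        -- Each entry times κ³ is a pairing of integral vectors, so D divides κ⁹ times the
        -- determinant. Each `strip` removes one κ from every entry, that is κ³ from the
        -- determinant.
        degenerate : ∀ u v t → pos D ℤ∣.∣ det₃ (B u u) (B v v) (B t t) (B u v) (B u t) (B v t)
        degenerate u v t = descend (B u u) (B v v) (B t t) (B u v) (B u t) (B v t)
          (B-scaled u u) (B-scaled v v) (B-scaled t t) (B-scaled u v) (B-scaled u t) (B-scaled v t) (det-hat ĝ (hat u) (hat v) (hat t))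
          where
          κ³ : ℤ → ℤ
          κ³ x = κ ℤ.* (κ ℤ.* (κ ℤ.* x))
          strip : ∀ a b c p q r → pos D ℤ∣.∣ det₃ (κ ℤ.* a) (κ ℤ.* b) (κ ℤ.* c) (κ ℤ.* p) (κ ℤ.* q) (κ ℤ.* r) → pos D ℤ∣.∣ det₃ a b c p q r
          strip a b c p q r e = cancel³ (det₃ a b c p q r) (subst (pos D ℤ∣.∣_) (det-scaled κ a b c p q r) e)
          descend : ∀ a b c p q r {a′ b′ c′ p′ q′ r′} → κ³ a ≡ a′ → κ³ b ≡ b′ → κ³ c ≡ c′ → κ³ p ≡ p′ → κ³ q ≡ q′ → κ³ r ≡ r′ →
            pos D ℤ∣.∣ det₃ a′ b′ c′ p′ q′ r′ → pos D ℤ∣.∣ det₃ a b c p q r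
          descend a b c p q r refl refl refl refl refl refl e = strip a b c p q r
            (strip (κ ℤ.* a) (κ ℤ.* b) (κ ℤ.* c) (κ ℤ.* p) (κ ℤ.* q) (κ ℤ.* r)
              (strip (κ ℤ.* (κ ℤ.* a)) (κ ℤ.* (κ ℤ.* b)) (κ ℤ.* (κ ℤ.* c)) (κ ℤ.* (κ ℤ.* p)) (κ ℤ.* (κ ℤ.* q)) (κ ℤ.* (κ ℤ.* r)) e))

        represents : ∀ m → 1 ℕ.≤ m → ∃[ v ] (B v v ≡ pos m)
        represents m 1≤m = from (onto m 1≤m)
          where
          from : ∃[ x ] ∃[ y ] (InOK D x × InOK D y × eval D G x y ≡ ι (ℕtoℚ m)) → ∃[ v ] (B v v ≡ pos m)
          from (x , y , x∈ , y∈ , eq) = point x y x∈ y∈ , ℤtoℚ-injective {B (point x y x∈ y∈) (point x y x∈ y∈)} {pos m}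
            (trans (sym (B≡ (point x y x∈ y∈) (point x y x∈ y∈))) (trans (sym (eval-real d (coefficients G) (coords x y))) (cong proj₁ eq)))

        D≤10 : D ℕ.≤ 10
        D≤10 = Escalation.D≤10 D Point B psd degenerate represents

-- The bound on D when the ring of integers is ℤ[√D].

module CaseTwoThree where
  open import Defs
  open RationalForms
  open BilinearForms
  open Examples
  open Quaternions using (V4; ⟨_,_,_,_⟩)
  open import Data.Nat as ℕ using (ℕ; s≤s; z≤n)
  open import Data.Integer using () renaming (+_ to pos)
  import Data.Integer.Properties as ℤₚ
  open import Data.Rational using (ℚ; 0ℚ; 1ℚ; ½; _+_; _*_; _-_; -_; _≤_)
  import Data.Rational.Properties as ℚₚ
  import Data.Integer.Divisibility.Signed as ℤ∣
  open import Data.Nat using (_%_)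
  import Data.Nat.Properties as ℕₚ
  open import Data.Product using (_×_; _,_; ∃-syntax; proj₁; proj₂)
  open import Data.Sum using (_⊎_; inj₁; inj₂)
  open import Data.Empty using (⊥-elim)
  open import Relation.Binary.PropositionalEquality using (_≡_; _≢_; refl; sym; trans; cong; subst)


  open import Tactic.RingSolver.NonReflective ℚ-ring using (solve; _⊜_; Κ; _⊕_; _⊗_; ⊝_)
  open Linear ℚOps (λ q → q) using (mulₐ; _+ₐ_; τₐ)
  open Bilinear ℚOps
  open Polar ℚOps (λ q → q) using (polar; double)

  ω-1 : ∀ D → D % 4 ≡ 1 → ω D ≡ (½ , ½)
  ω-1 D eq with D % 4 | eq
  ... | _ | refl = refl

  ω-2 : ∀ D → D % 4 ≡ 2 → ω D ≡ (0ℚ , 1ℚ)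
  ω-2 D eq with D % 4 | eq
  ... | _ | refl = refl

  ω-3 : ∀ D → D % 4 ≡ 3 → ω D ≡ (0ℚ , 1ℚ)
  ω-3 D eq with D % 4 | eq
  ... | _ | refl = refl

  e₁ e₂ e₃ e₄ : V4 ℚ
  e₁ = ⟨ 1ℚ , 0ℚ , 0ℚ , 0ℚ ⟩
  e₂ = ⟨ 0ℚ , 1ℚ , 0ℚ , 0ℚ ⟩
  e₃ = ⟨ 0ℚ , 0ℚ , 1ℚ , 0ℚ ⟩
  e₄ = ⟨ 0ℚ , 0ℚ , 0ℚ , 1ℚ ⟩

  entry-t : ∀ g → pairing 1ℚ g e₁ e₃ ≡ Sym.t g
  entry-t (sym₄ s t r h₁₂ h₁₄ h₂₂ h₂₃ h₂₄ h₃₄ h₄₄) = solve 10 (λ s t r h₁₂ h₁₄ h₂₂ h₂₃ h₂₄ h₃₄ h₄₄ →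
    Bilinear.pairing (exprℚOps 10) (Κ 1ℚ) (sym₄ s t r h₁₂ h₁₄ h₂₂ h₂₃ h₂₄ h₃₄ h₄₄) ⟨ Κ 1ℚ , Κ 0ℚ , Κ 0ℚ , Κ 0ℚ ⟩ ⟨ Κ 0ℚ , Κ 0ℚ , Κ 1ℚ , Κ 0ℚ ⟩ ⊜ t)
    refl s t r h₁₂ h₁₄ h₂₂ h₂₃ h₂₄ h₃₄ h₄₄

  entry-h₂₄ : ∀ g → pairing 1ℚ g e₂ e₄ ≡ Sym.h₂₄ g
  entry-h₂₄ (sym₄ s t r h₁₂ h₁₄ h₂₂ h₂₃ h₂₄ h₃₄ h₄₄) = solve 10 (λ s t r h₁₂ h₁₄ h₂₂ h₂₃ h₂₄ h₃₄ h₄₄ →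
    Bilinear.pairing (exprℚOps 10) (Κ 1ℚ) (sym₄ s t r h₁₂ h₁₄ h₂₂ h₂₃ h₂₄ h₃₄ h₄₄) ⟨ Κ 0ℚ , Κ 1ℚ , Κ 0ℚ , Κ 0ℚ ⟩ ⟨ Κ 0ℚ , Κ 0ℚ , Κ 0ℚ , Κ 1ℚ ⟩ ⊜ h₂₄)
    refl s t r h₁₂ h₁₄ h₂₂ h₂₃ h₂₄ h₃₄ h₄₄

  entry-h₁₄ : ∀ g → pairing 1ℚ g e₁ e₄ ≡ Sym.h₁₄ g
  entry-h₁₄ (sym₄ s t r h₁₂ h₁₄ h₂₂ h₂₃ h₂₄ h₃₄ h₄₄) = solve 10 (λ s t r h₁₂ h₁₄ h₂₂ h₂₃ h₂₄ h₃₄ h₄₄ →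
    Bilinear.pairing (exprℚOps 10) (Κ 1ℚ) (sym₄ s t r h₁₂ h₁₄ h₂₂ h₂₃ h₂₄ h₃₄ h₄₄) ⟨ Κ 1ℚ , Κ 0ℚ , Κ 0ℚ , Κ 0ℚ ⟩ ⟨ Κ 0ℚ , Κ 0ℚ , Κ 0ℚ , Κ 1ℚ ⟩ ⊜ h₁₄)
    refl s t r h₁₂ h₁₄ h₂₂ h₂₃ h₂₄ h₃₄ h₄₄

  entry-h₂₃ : ∀ g → pairing 1ℚ g e₂ e₃ ≡ Sym.h₂₃ g
  entry-h₂₃ (sym₄ s t r h₁₂ h₁₄ h₂₂ h₂₃ h₂₄ h₃₄ h₄₄) = solve 10 (λ s t r h₁₂ h₁₄ h₂₂ h₂₃ h₂₄ h₃₄ h₄₄ →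
    Bilinear.pairing (exprℚOps 10) (Κ 1ℚ) (sym₄ s t r h₁₂ h₁₄ h₂₂ h₂₃ h₂₄ h₃₄ h₄₄) ⟨ Κ 0ℚ , Κ 1ℚ , Κ 0ℚ , Κ 0ℚ ⟩ ⟨ Κ 0ℚ , Κ 0ℚ , Κ 1ℚ , Κ 0ℚ ⟩ ⊜ h₂₃)
    refl s t r h₁₂ h₁₄ h₂₂ h₂₃ h₂₄ h₃₄ h₄₄

  IsInt-- : ∀ {x y} → IsInt x → IsInt y → IsInt (x - y)
  IsInt-- p q = IsInt-+ p (IsInt-neg q)

  int-up-to : ∀ {x y z} → IsInt y → z ≡ 0ℚ → x ≡ y - z → IsInt x
  int-up-to {y = y} (k , y≡) z≡0 eq = k , trans eq (trans (cong (λ z → y - z) z≡0) (trans (ℚₚ.+-identityʳ y) y≡))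

  ℕtoℚ-nonzero : ∀ D → 2 ℕ.≤ D → ℕtoℚ D ≢ 0ℚ
  ℕtoℚ-nonzero D 2≤D eq = ℕₚ.<⇒≢ (ℕₚ.≤-trans (s≤s z≤n) 2≤D) (sym (ℤₚ.+-injective (ℤtoℚ-injective {pos D} {pos 0} eq)))

  real-s : ∀ G → let open GQF G in Sym.s (real ½ G) ≡ proj₁ a₁₁ + proj₁ c₁₁ + proj₁ b₁₁
  real-s (gqf (a₁ , a₁′) (a , a′) (a₂ , a₂′) (e₁ , e₁′) (c , c′) (d , d′) (e₂ , e₂′) (g₁ , g₁′) (b , b′) (g₂ , g₂′)) = solve 3 (λ a₁ g₁ e₁ → (a₁ ⊕ g₁ ⊕ e₁) ⊜ (a₁ ⊕ g₁ ⊕ e₁)) refl a₁ g₁ e₁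

  real-r : ∀ G → let open GQF G in Sym.r (real ½ G) ≡ proj₁ a₂₂ + proj₁ c₂₂ + proj₁ b₂₂
  real-r (gqf (a₁ , a₁′) (a , a′) (a₂ , a₂′) (e₁ , e₁′) (c , c′) (d , d′) (e₂ , e₂′) (g₁ , g₁′) (b , b′) (g₂ , g₂′)) = solve 3 (λ a₂ g₂ e₂ → (a₂ ⊕ g₂ ⊕ e₂) ⊜ (a₂ ⊕ g₂ ⊕ e₂)) refl a₂ g₂ e₂

  real-h₁₂ : ∀ G → let open GQF G in Sym.h₁₂ (real ½ G) ≡ proj₂ a₁₁ - proj₂ c₁₁
  real-h₁₂ (gqf (a₁ , a₁′) (a , a′) (a₂ , a₂′) (e₁ , e₁′) (c , c′) (d , d′) (e₂ , e₂′) (g₁ , g₁′) (b , b′) (g₂ , g₂′)) = solve 2 (λ a₁′ g₁′ → (a₁′ ⊕ ⊝ g₁′) ⊜ (a₁′ ⊕ ⊝ g₁′)) refl a₁′ g₁′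

  real-h₂₂ : ∀ G → let open GQF G in Sym.h₂₂ (real ½ G) ≡ proj₁ a₁₁ + proj₁ c₁₁ - proj₁ b₁₁
  real-h₂₂ (gqf (a₁ , a₁′) (a , a′) (a₂ , a₂′) (e₁ , e₁′) (c , c′) (d , d′) (e₂ , e₂′) (g₁ , g₁′) (b , b′) (g₂ , g₂′)) = solve 3 (λ a₁ g₁ e₁ → (a₁ ⊕ g₁ ⊕ ⊝ e₁) ⊜ (a₁ ⊕ g₁ ⊕ ⊝ e₁)) refl a₁ g₁ e₁

  real-h₃₄ : ∀ G → let open GQF G in Sym.h₃₄ (real ½ G) ≡ proj₂ a₂₂ - proj₂ c₂₂
  real-h₃₄ (gqf (a₁ , a₁′) (a , a′) (a₂ , a₂′) (e₁ , e₁′) (c , c′) (d , d′) (e₂ , e₂′) (g₁ , g₁′) (b , b′) (g₂ , g₂′)) = solve 2 (λ a₂′ g₂′ → (a₂′ ⊕ ⊝ g₂′) ⊜ (a₂′ ⊕ ⊝ g₂′)) refl a₂′ g₂′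

  real-h₄₄ : ∀ G → let open GQF G in Sym.h₄₄ (real ½ G) ≡ proj₁ a₂₂ + proj₁ c₂₂ - proj₁ b₂₂
  real-h₄₄ (gqf (a₁ , a₁′) (a , a′) (a₂ , a₂′) (e₁ , e₁′) (c , c′) (d , d′) (e₂ , e₂′) (g₁ , g₁′) (b , b′) (g₂ , g₂′)) = solve 3 (λ a₂ g₂ e₂ → (a₂ ⊕ g₂ ⊕ ⊝ e₂) ⊜ (a₂ ⊕ g₂ ⊕ ⊝ e₂)) refl a₂ g₂ e₂

  -- The factor ½ in the entry is absorbed by an entry of the irrational form that is known to
  -- vanish, leaving a sum of two integral coefficients. The other off-diagonal entries follow the
  -- same pattern.
  real-t : ∀ D G → let open GQF G in Sym.t (real ½ G) ≡ (proj₁ a₁₂ + proj₁ b₁₂) - Sym.h₂₃ (imaginary ½ D G)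
  real-t D (gqf (a₁ , a₁′) (a , a′) (a₂ , a₂′) (e₁ , e₁′) (c , c′) (d , d′) (e₂ , e₂′) (g₁ , g₁′) (b , b′) (g₂ , g₂′)) =
    solve 9 (λ a a′ c c′ d d′ b b′ D → (Κ ½ ⊗ (a ⊕ b ⊕ (c ⊕ d))) ⊜ ((a ⊕ c) ⊕ ⊝ (Κ ½ ⊗ (a ⊕ ⊝ b ⊕ (c ⊕ ⊝ d))))) refl a a′ c c′ d d′ b b′ D

  -- The vanishing entry available here pairs the two coordinates along √D and so carries a factor
  -- D, which is cancelled later by D ≠ 0.
  real-h₁₄ : ∀ D G → let open GQF G in D * ((proj₂ a₁₂ - proj₂ b₁₂) - Sym.h₁₄ (real ½ G)) ≡ Sym.h₂₄ (imaginary ½ D G)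
  real-h₁₄ D (gqf (a₁ , a₁′) (a , a′) (a₂ , a₂′) (e₁ , e₁′) (c , c′) (d , d′) (e₂ , e₂′) (g₁ , g₁′) (b , b′) (g₂ , g₂′)) =
    solve 9 (λ a a′ c c′ d d′ b b′ D → (D ⊗ ((a′ ⊕ ⊝ c′) ⊕ ⊝ (Κ ½ ⊗ (a′ ⊕ ⊝ b′ ⊕ ⊝ (c′ ⊕ ⊝ d′))))) ⊜ (D ⊗ (Κ ½ ⊗ (a′ ⊕ b′ ⊕ ⊝ (c′ ⊕ d′))))) refl a a′ c c′ d d′ b b′ D

  real-h₂₃ : ∀ D G → let open GQF G in Sym.h₂₃ (real ½ G) ≡ (proj₂ a₁₂ + proj₂ b₁₂) - Sym.t (imaginary ½ D G)
  real-h₂₃ D (gqf (a₁ , a₁′) (a , a′) (a₂ , a₂′) (e₁ , e₁′) (c , c′) (d , d′) (e₂ , e₂′) (g₁ , g₁′) (b , b′) (g₂ , g₂′)) =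
    solve 9 (λ a a′ c c′ d d′ b b′ D → (Κ ½ ⊗ (a′ ⊕ ⊝ b′ ⊕ (c′ ⊕ ⊝ d′))) ⊜ ((a′ ⊕ c′) ⊕ ⊝ (Κ ½ ⊗ (a′ ⊕ b′ ⊕ (c′ ⊕ d′))))) refl a a′ c c′ d d′ b b′ D

  real-h₂₄ : ∀ D G → let open GQF G in Sym.h₂₄ (real ½ G) ≡ (proj₁ a₁₂ - proj₁ b₁₂) - Sym.h₁₄ (imaginary ½ D G)
  real-h₂₄ D (gqf (a₁ , a₁′) (a , a′) (a₂ , a₂′) (e₁ , e₁′) (c , c′) (d , d′) (e₂ , e₂′) (g₁ , g₁′) (b , b′) (g₂ , g₂′)) =
    solve 9 (λ a a′ c c′ d d′ b b′ D → (Κ ½ ⊗ (a ⊕ b ⊕ ⊝ (c ⊕ d))) ⊜ ((a ⊕ ⊝ c) ⊕ ⊝ (Κ ½ ⊗ (a ⊕ ⊝ b ⊕ ⊝ (c ⊕ ⊝ d))))) refl a a′ c c′ d d′ b b′ D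

  sub≡0 : ∀ {x y} → x - y ≡ 0ℚ → x ≡ y
  sub≡0 {x} {y} eq = trans (lem x y) (trans (cong (_+ y) eq) (ℚₚ.+-identityˡ y))
    where
    lem : ∀ x y → x ≡ x - y + y
    lem = solve 2 (λ x y → x ⊜ (x ⊕ ⊝ y ⊕ y)) refl

  IntPair : ℚ × ℚ → Set
  IntPair (x , y) = IsInt x × IsInt y

  real-int : ∀ D G → D ≢ 0ℚ → let open GQF G in IntPair a₁₁ → IntPair a₁₂ → IntPair a₂₂ → IntPair b₁₁ → IntPair b₁₂ → IntPair b₂₂ → IntPair c₁₁ → IntPair c₂₂ →
    Sym.t (imaginary ½ D G) ≡ 0ℚ → Sym.h₁₄ (imaginary ½ D G) ≡ 0ℚ → Sym.h₂₃ (imaginary ½ D G) ≡ 0ℚ → Sym.h₂₄ (imaginary ½ D G) ≡ 0ℚ →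
    All10 IsInt (real ½ G)
  real-int D G D≢0 (a₁-int , a₁′-int) (a-int , a′-int) (a₂-int , a₂′-int) (e₁-int , _) (c-int , c′-int) (e₂-int , _) (g₁-int , g₁′-int) (g₂-int , g₂′-int) t≡0 h₁₄≡0 h₂₃≡0 h₂₄≡0 =
    subst IsInt (sym (real-s G)) (IsInt-+ (IsInt-+ a₁-int g₁-int) e₁-int) , int-up-to (IsInt-+ a-int c-int) h₂₃≡0 (real-t D G) , subst IsInt (sym (real-r G)) (IsInt-+ (IsInt-+ a₂-int g₂-int) e₂-int) ,
    subst IsInt (sym (real-h₁₂ G)) (IsInt-- a₁′-int g₁′-int) , subst IsInt h₁₄≡ (IsInt-- a′-int c′-int) , subst IsInt (sym (real-h₂₂ G)) (IsInt-- (IsInt-+ a₁-int g₁-int) e₁-int) ,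
    int-up-to (IsInt-+ a′-int c′-int) t≡0 (real-h₂₃ D G) , int-up-to (IsInt-- a-int c-int) h₁₄≡0 (real-h₂₄ D G) ,
    subst IsInt (sym (real-h₃₄ G)) (IsInt-- a₂′-int g₂′-int) , subst IsInt (sym (real-h₄₄ G)) (IsInt-- (IsInt-+ a₂-int g₂-int) e₂-int)
    where
    open GQF G
    h₁₄≡ : proj₂ a₁₂ - proj₂ b₁₂ ≡ Sym.h₁₄ (real ½ G)
    h₁₄≡ = from (*≡0 D ((proj₂ a₁₂ - proj₂ b₁₂) - Sym.h₁₄ (real ½ G)) (trans (real-h₁₄ D G) h₂₄≡0))
      where
      from : D ≡ 0ℚ ⊎ (proj₂ a₁₂ - proj₂ b₁₂) - Sym.h₁₄ (real ½ G) ≡ 0ℚ → proj₂ a₁₂ - proj₂ b₁₂ ≡ Sym.h₁₄ (real ½ G)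
      from (inj₁ D≡0) = ⊥-elim (D≢0 D≡0)
      from (inj₂ eq) = sub≡0 {proj₂ a₁₂ - proj₂ b₁₂} {Sym.h₁₄ (real ½ G)} eq

  one-int : ∀ g → All10 IsInt g → All10 IsInt (scaleSym (ℤtoℚ (pos 1)) g)
  one-int (sym₄ _ _ _ _ _ _ _ _ _ _) (s , t , r , h₁ , h₂ , h₃ , h₄ , h₅ , h₆ , h₇) =
    one s , one t , one r , one h₁ , one h₂ , one h₃ , one h₄ , one h₅ , one h₆ , one h₇
    where
    one : ∀ {x} → IsInt x → IsInt (ℤtoℚ (pos 1) * x)
    one = IsInt-* (int (pos 1))

  one-vec-int : ∀ v → All4 IsInt v → All4 IsInt (scale (ℤtoℚ (pos 1)) v)
  one-vec-int ⟨ _ , _ , _ , _ ⟩ (x , y , z , w) = one x , one y , one z , one w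
    where
    one : ∀ {x} → IsInt x → IsInt (ℤtoℚ (pos 1) * x)
    one = IsInt-* (int (pos 1))

  integral-pairing : ∀ D g u v → All10 IsInt g → All4 IsInt u → All4 IsInt v → IsInt (pairing (ℤtoℚ D) g u v)
  integral-pairing D g u v g-int u-int v-int = go (integral-sym g g-int) (integral-vec u u-int) (integral-vec v v-int)
    where
    go : ∃[ g′ ] (g ≡ symℚ g′) → ∃[ u′ ] (u ≡ mapℚ u′) → ∃[ v′ ] (v ≡ mapℚ v′) → IsInt (pairing (ℤtoℚ D) g u v)
    go (g′ , refl) (u′ , refl) (v′ , refl) = pairingℤ D g′ u′ v′ , pairing-int D g′ u′ v′

  -- D ≡ 2, 3 (mod 4): since the form is ℤ-valued, γ₁₂ = τ α₁₂ and β₂₁ = τ β₁₂, which makes the bilinear form integral.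
  module Case23 (D : ℕ) (2≤D : 2 ℕ.≤ D) (ω≡ : ω D ≡ (0ℚ , 1ℚ)) (G : BinGQF) (universal : ZUniversal D G) where
    open Sqrt D ω≡
    open Integers D
    open Necessity G (proj₁ universal) (proj₁ (proj₂ (proj₂ universal))) (proj₂ (proj₂ (proj₂ universal)))

    private
      d : ℚ
      d = ℕtoℚ D

      at : ∀ x y z w → IsInt x → IsInt y → IsInt z → IsInt w → Point
      at x y z w ix iy iz iw = point (x , y) (z , w) (inOK ix iy) (inOK iz iw)

      i0 : IsInt 0ℚ
      i0 = pos 0 , refl
      i1 : IsInt 1ℚ
      i1 = pos 1 , refl
      p₁ p₂ p₃ p₄ : Point
      p₁ = at 1ℚ 0ℚ 0ℚ 0ℚ i1 i0 i0 i0
      p₂ = at 0ℚ 1ℚ 0ℚ 0ℚ i0 i1 i0 i0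
      p₃ = at 0ℚ 0ℚ 1ℚ 0ℚ i0 i0 i1 i0
      p₄ = at 0ℚ 0ℚ 0ℚ 1ℚ i0 i0 i0 i1

      vanish : ∀ u v {e e′} → vector u ≡ e → vector v ≡ e′ → pairing 1ℚ gᵢ e e′ ≡ 0ℚ
      vanish u v refl refl = imaginary-polar u v

    g-int : All10 IsInt g
    g-int = let iα₁₁ , iα₁₂ , iα₂₂ , iβ₁₁ , iβ₁₂ , _ , iβ₂₂ , iγ₁₁ , _ , iγ₂₂ = proj₁ (proj₂ universal) in
      real-int d (coefficients G) (ℕtoℚ-nonzero D 2≤D)
        (inOK⁻¹ iα₁₁) (inOK⁻¹ iα₁₂) (inOK⁻¹ iα₂₂) (inOK⁻¹ iβ₁₁) (inOK⁻¹ iβ₁₂) (inOK⁻¹ iβ₂₂) (inOK⁻¹ iγ₁₁) (inOK⁻¹ iγ₂₂)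
        (trans (sym (entry-t gᵢ)) (vanish p₁ p₃ {e₁} {e₃} refl refl))
        (trans (sym (entry-h₁₄ gᵢ)) (vanish p₁ p₄ {e₁} {e₄} refl refl))
        (trans (sym (entry-h₂₃ gᵢ)) (vanish p₂ p₃ {e₂} {e₃} refl refl))
        (trans (sym (entry-h₂₄ gᵢ)) (vanish p₂ p₄ {e₂} {e₄} refl refl))

    vector-int : ∀ u → All4 IsInt (vector u)
    vector-int (point _ _ x∈ y∈) = let x , y = inOK⁻¹ x∈ ; z , w = inOK⁻¹ y∈ in x , y , z , w

    D≤10 : D ℕ.≤ 10
    D≤10 = Bound.D≤10 (pos 1) (λ x → subst (pos D ℤ∣.∣_) (ℤₚ.*-identityˡ x)) (one-int g g-int) (λ u → one-vec-int (vector u) (vector-int u))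
      (λ u v → integral-pairing (pos D) g (vector u) (vector v) g-int (vector-int u) (vector-int v))

-- The bound on D for classical forms when D ≡ 1 modulo 4.

module CaseOne where
  open import Defs
  open RationalForms
  open BilinearForms
  open CaseTwoThree
  open Examples
  open Quaternions using (⟨_,_,_,_⟩)
  open import Data.Nat as ℕ using (ℕ)
  open import Data.Integer as ℤ using (ℤ) renaming (+_ to pos)
  import Data.Integer.Properties as ℤₚ
  open import Data.Rational using (ℚ; 0ℚ; 1ℚ; ½; _+_; _*_; _-_; -_; _≤_)
  import Data.Rational.Properties as ℚₚ
  import Data.Integer.Divisibility.Signed as ℤ∣
  open import Data.Nat using (_%_; _/_)
  open import Data.Nat.DivMod using (m≡m%n+[m/n]*n)
  import Data.Nat.Properties as ℕₚ
  import Data.Integer.Tactic.RingSolver as ℤ-Solver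
  open import Data.Product using (_×_; _,_; ∃-syntax; proj₁; proj₂)
  open import Relation.Binary.PropositionalEquality using (_≡_; refl; sym; trans; cong; cong₂; subst)


  open import Tactic.RingSolver.NonReflective ℚ-ring using (solve; _⊜_; Κ; _⊕_; _⊗_; ⊝_)
  open Linear ℚOps (λ q → q) using (mulₐ; _+ₐ_; τₐ)
  open Bilinear ℚOps
  open Polar ℚOps (λ q → q) using (polar; double)

  twice-s : ∀ G → let open GQF G in Sym.s (scaleSym 2ℚ (real ½ G)) ≡ 2ℚ * proj₁ a₁₁ + 2ℚ * proj₁ c₁₁ + 2ℚ * proj₁ b₁₁
  twice-s (gqf (a₁ , a₁′) (a , a′) (a₂ , a₂′) (e₁ , e₁′) (c , c′) (d , d′) (e₂ , e₂′) (g₁ , g₁′) (b , b′) (g₂ , g₂′)) = solve 3 (λ a₁ g₁ e₁ → (Κ 2ℚ ⊗ (a₁ ⊕ g₁ ⊕ e₁)) ⊜ (Κ 2ℚ ⊗ a₁ ⊕ Κ 2ℚ ⊗ g₁ ⊕ Κ 2ℚ ⊗ e₁)) refl a₁ g₁ e₁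

  twice-t : ∀ G → let open GQF G in Sym.t (scaleSym 2ℚ (real ½ G)) ≡ proj₁ a₁₂ + proj₁ c₁₂ + (proj₁ b₁₂ + proj₁ b₂₁)
  twice-t (gqf (a₁ , a₁′) (a , a′) (a₂ , a₂′) (e₁ , e₁′) (c , c′) (d , d′) (e₂ , e₂′) (g₁ , g₁′) (b , b′) (g₂ , g₂′)) = solve 4 (λ a b c d → (Κ 2ℚ ⊗ (Κ ½ ⊗ (a ⊕ b ⊕ (c ⊕ d)))) ⊜ (a ⊕ b ⊕ (c ⊕ d))) refl a b c d

  twice-r : ∀ G → let open GQF G in Sym.r (scaleSym 2ℚ (real ½ G)) ≡ 2ℚ * proj₁ a₂₂ + 2ℚ * proj₁ c₂₂ + 2ℚ * proj₁ b₂₂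
  twice-r (gqf (a₁ , a₁′) (a , a′) (a₂ , a₂′) (e₁ , e₁′) (c , c′) (d , d′) (e₂ , e₂′) (g₁ , g₁′) (b , b′) (g₂ , g₂′)) = solve 3 (λ a₂ g₂ e₂ → (Κ 2ℚ ⊗ (a₂ ⊕ g₂ ⊕ e₂)) ⊜ (Κ 2ℚ ⊗ a₂ ⊕ Κ 2ℚ ⊗ g₂ ⊕ Κ 2ℚ ⊗ e₂)) refl a₂ g₂ e₂

  twice-h₁₂ : ∀ G → let open GQF G in Sym.h₁₂ (scaleSym 2ℚ (real ½ G)) ≡ 2ℚ * proj₂ a₁₁ - 2ℚ * proj₂ c₁₁
  twice-h₁₂ (gqf (a₁ , a₁′) (a , a′) (a₂ , a₂′) (e₁ , e₁′) (c , c′) (d , d′) (e₂ , e₂′) (g₁ , g₁′) (b , b′) (g₂ , g₂′)) = solve 2 (λ a₁′ g₁′ → (Κ 2ℚ ⊗ (a₁′ ⊕ ⊝ g₁′)) ⊜ (Κ 2ℚ ⊗ a₁′ ⊕ ⊝ (Κ 2ℚ ⊗ g₁′))) refl a₁′ g₁′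

  twice-h₁₄ : ∀ G → let open GQF G in Sym.h₁₄ (scaleSym 2ℚ (real ½ G)) ≡ proj₂ a₁₂ - proj₂ c₁₂ - (proj₂ b₁₂ - proj₂ b₂₁)
  twice-h₁₄ (gqf (a₁ , a₁′) (a , a′) (a₂ , a₂′) (e₁ , e₁′) (c , c′) (d , d′) (e₂ , e₂′) (g₁ , g₁′) (b , b′) (g₂ , g₂′)) = solve 4 (λ a′ b′ c′ d′ → (Κ 2ℚ ⊗ (Κ ½ ⊗ (a′ ⊕ ⊝ b′ ⊕ ⊝ (c′ ⊕ ⊝ d′)))) ⊜ (a′ ⊕ ⊝ b′ ⊕ ⊝ (c′ ⊕ ⊝ d′))) refl a′ b′ c′ d′

  twice-h₂₂ : ∀ G → let open GQF G in Sym.h₂₂ (scaleSym 2ℚ (real ½ G)) ≡ 2ℚ * proj₁ a₁₁ + 2ℚ * proj₁ c₁₁ - 2ℚ * proj₁ b₁₁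
  twice-h₂₂ (gqf (a₁ , a₁′) (a , a′) (a₂ , a₂′) (e₁ , e₁′) (c , c′) (d , d′) (e₂ , e₂′) (g₁ , g₁′) (b , b′) (g₂ , g₂′)) = solve 3 (λ a₁ g₁ e₁ → (Κ 2ℚ ⊗ (a₁ ⊕ g₁ ⊕ ⊝ e₁)) ⊜ (Κ 2ℚ ⊗ a₁ ⊕ Κ 2ℚ ⊗ g₁ ⊕ ⊝ (Κ 2ℚ ⊗ e₁))) refl a₁ g₁ e₁

  twice-h₂₃ : ∀ G → let open GQF G in Sym.h₂₃ (scaleSym 2ℚ (real ½ G)) ≡ proj₂ a₁₂ - proj₂ c₁₂ + (proj₂ b₁₂ - proj₂ b₂₁)
  twice-h₂₃ (gqf (a₁ , a₁′) (a , a′) (a₂ , a₂′) (e₁ , e₁′) (c , c′) (d , d′) (e₂ , e₂′) (g₁ , g₁′) (b , b′) (g₂ , g₂′)) = solve 4 (λ a′ b′ c′ d′ → (Κ 2ℚ ⊗ (Κ ½ ⊗ (a′ ⊕ ⊝ b′ ⊕ (c′ ⊕ ⊝ d′)))) ⊜ (a′ ⊕ ⊝ b′ ⊕ (c′ ⊕ ⊝ d′))) refl a′ b′ c′ d′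

  twice-h₂₄ : ∀ G → let open GQF G in Sym.h₂₄ (scaleSym 2ℚ (real ½ G)) ≡ proj₁ a₁₂ + proj₁ c₁₂ - (proj₁ b₁₂ + proj₁ b₂₁)
  twice-h₂₄ (gqf (a₁ , a₁′) (a , a′) (a₂ , a₂′) (e₁ , e₁′) (c , c′) (d , d′) (e₂ , e₂′) (g₁ , g₁′) (b , b′) (g₂ , g₂′)) = solve 4 (λ a b c d → (Κ 2ℚ ⊗ (Κ ½ ⊗ (a ⊕ b ⊕ ⊝ (c ⊕ d)))) ⊜ (a ⊕ b ⊕ ⊝ (c ⊕ d))) refl a b c d

  twice-h₃₄ : ∀ G → let open GQF G in Sym.h₃₄ (scaleSym 2ℚ (real ½ G)) ≡ 2ℚ * proj₂ a₂₂ - 2ℚ * proj₂ c₂₂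
  twice-h₃₄ (gqf (a₁ , a₁′) (a , a′) (a₂ , a₂′) (e₁ , e₁′) (c , c′) (d , d′) (e₂ , e₂′) (g₁ , g₁′) (b , b′) (g₂ , g₂′)) = solve 2 (λ a₂′ g₂′ → (Κ 2ℚ ⊗ (a₂′ ⊕ ⊝ g₂′)) ⊜ (Κ 2ℚ ⊗ a₂′ ⊕ ⊝ (Κ 2ℚ ⊗ g₂′))) refl a₂′ g₂′

  twice-h₄₄ : ∀ G → let open GQF G in Sym.h₄₄ (scaleSym 2ℚ (real ½ G)) ≡ 2ℚ * proj₁ a₂₂ + 2ℚ * proj₁ c₂₂ - 2ℚ * proj₁ b₂₂
  twice-h₄₄ (gqf (a₁ , a₁′) (a , a′) (a₂ , a₂′) (e₁ , e₁′) (c , c′) (d , d′) (e₂ , e₂′) (g₁ , g₁′) (b , b′) (g₂ , g₂′)) = solve 3 (λ a₂ g₂ e₂ → (Κ 2ℚ ⊗ (a₂ ⊕ g₂ ⊕ ⊝ e₂)) ⊜ (Κ 2ℚ ⊗ a₂ ⊕ Κ 2ℚ ⊗ g₂ ⊕ ⊝ (Κ 2ℚ ⊗ e₂))) refl a₂ g₂ e₂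

  TwiceInt : ℚ × ℚ → Set
  TwiceInt (x , y) = IsInt (2ℚ * x) × IsInt (2ℚ * y)

  twice-real-int : ∀ G → let open GQF G in TwiceInt a₁₁ → TwiceInt a₂₂ → TwiceInt b₁₁ → TwiceInt b₂₂ → TwiceInt c₁₁ → TwiceInt c₂₂ →
    IntPair a₁₂ → IntPair b₁₂ → IntPair b₂₁ → IntPair c₁₂ → All10 IsInt (scaleSym 2ℚ (real ½ G))
  twice-real-int G (a₁ , a₁′) (a₂ , a₂′) (e₁ , _) (e₂ , _) (g₁ , g₁′) (g₂ , g₂′) (a , a′) (c , c′) (d , d′) (b , b′) =
    subst IsInt (sym (twice-s G)) (a₁ ⊞ g₁ ⊞ e₁) , subst IsInt (sym (twice-t G)) (a ⊞ b ⊞ (c ⊞ d)) , subst IsInt (sym (twice-r G)) (a₂ ⊞ g₂ ⊞ e₂) ,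
    subst IsInt (sym (twice-h₁₂ G)) (IsInt-- a₁′ g₁′) , subst IsInt (sym (twice-h₁₄ G)) (IsInt-- (IsInt-- a′ b′) (IsInt-- c′ d′)) ,
    subst IsInt (sym (twice-h₂₂ G)) (IsInt-- (a₁ ⊞ g₁) e₁) , subst IsInt (sym (twice-h₂₃ G)) (IsInt-- a′ b′ ⊞ IsInt-- c′ d′) ,
    subst IsInt (sym (twice-h₂₄ G)) (IsInt-- (a ⊞ b) (c ⊞ d)) , subst IsInt (sym (twice-h₃₄ G)) (IsInt-- a₂′ g₂′) , subst IsInt (sym (twice-h₄₄ G)) (IsInt-- (a₂ ⊞ g₂) e₂)
    where
    infixl 6 _⊞_
    _⊞_ = IsInt-+

  -- Elements m + nω of the ring of integers when ω = (1 + √D)/2.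
  Half : ℚ × ℚ → Set
  Half x = ∃[ m ] ∃[ n ] (IsInt m × IsInt n × x ≡ (m + ½ * n , ½ * n))

  half-+ : ∀ {x y} → Half x → Half y → Half (x +ₐ y)
  half-+ (m , n , mi , ni , refl) (m′ , n′ , mi′ , ni′ , refl) = m + m′ , n + n′ , IsInt-+ mi mi′ , IsInt-+ ni ni′ , cong₂ _,_ (l₁ m n m′ n′) (l₂ n n′)
    where
    l₁ : ∀ m n m′ n′ → (m + ½ * n) + (m′ + ½ * n′) ≡ (m + m′) + ½ * (n + n′)
    l₁ = solve 4 (λ m n m′ n′ → ((m ⊕ Κ ½ ⊗ n) ⊕ (m′ ⊕ Κ ½ ⊗ n′)) ⊜ ((m ⊕ m′) ⊕ Κ ½ ⊗ (n ⊕ n′))) refl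
    l₂ : ∀ n n′ → ½ * n + ½ * n′ ≡ ½ * (n + n′)
    l₂ = solve 2 (λ n n′ → (Κ ½ ⊗ n ⊕ Κ ½ ⊗ n′) ⊜ (Κ ½ ⊗ (n ⊕ n′))) refl

  half-τ : ∀ {x} → Half x → Half (τₐ x)
  half-τ (m , n , mi , ni , refl) = m + n , - n , IsInt-+ mi ni , IsInt-neg ni , cong₂ _,_ (l₁ m n) (l₂ n)
    where
    l₁ : ∀ m n → m + ½ * n ≡ (m + n) + ½ * - n
    l₁ = solve 2 (λ m n → (m ⊕ Κ ½ ⊗ n) ⊜ ((m ⊕ n) ⊕ Κ ½ ⊗ ⊝ n)) refl
    l₂ : ∀ n → - (½ * n) ≡ ½ * - n
    l₂ = solve 1 (λ n → (⊝ (Κ ½ ⊗ n)) ⊜ (Κ ½ ⊗ ⊝ n)) refl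

  -- For D = 1 + 4δ the generator satisfies ω² = ω + δ.
  half-* : ∀ δ → IsInt δ → ∀ {x y} → Half x → Half y → Half (mulₐ (1ℚ + ℤtoℚ (pos 4) * δ) x y)
  half-* δ δi (m , n , mi , ni , refl) (m′ , n′ , mi′ , ni′ , refl) =
    m * m′ + δ * (n * n′) , m * n′ + m′ * n + n * n′ , IsInt-+ (IsInt-* mi mi′) (IsInt-* δi (IsInt-* ni ni′)) ,
    IsInt-+ (IsInt-+ (IsInt-* mi ni′) (IsInt-* mi′ ni)) (IsInt-* ni ni′) , cong₂ _,_ (l₁ m n m′ n′ δ) (l₂ m n m′ n′)
    where
    l₁ : ∀ m n m′ n′ δ → (m + ½ * n) * (m′ + ½ * n′) + (1ℚ + ℤtoℚ (pos 4) * δ) * (½ * n) * (½ * n′) ≡ (m * m′ + δ * (n * n′)) + ½ * (m * n′ + m′ * n + n * n′)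
    l₁ = solve 5 (λ m n m′ n′ δ → ((m ⊕ Κ ½ ⊗ n) ⊗ (m′ ⊕ Κ ½ ⊗ n′) ⊕ (Κ 1ℚ ⊕ Κ (ℤtoℚ (pos 4)) ⊗ δ) ⊗ (Κ ½ ⊗ n) ⊗ (Κ ½ ⊗ n′))
      ⊜ ((m ⊗ m′ ⊕ δ ⊗ (n ⊗ n′)) ⊕ Κ ½ ⊗ (m ⊗ n′ ⊕ m′ ⊗ n ⊕ n ⊗ n′))) refl
    l₂ : ∀ m n m′ n′ → (m + ½ * n) * (½ * n′) + (½ * n) * (m′ + ½ * n′) ≡ ½ * (m * n′ + m′ * n + n * n′)
    l₂ = solve 4 (λ m n m′ n′ → ((m ⊕ Κ ½ ⊗ n) ⊗ (Κ ½ ⊗ n′) ⊕ (Κ ½ ⊗ n) ⊗ (m′ ⊕ Κ ½ ⊗ n′)) ⊜ (Κ ½ ⊗ (m ⊗ n′ ⊕ m′ ⊗ n ⊕ n ⊗ n′))) refl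

  half-twice : ∀ x → Half x → TwiceInt x
  half-twice _ (m , n , mi , ni , refl) = subst IsInt (sym (l₁ m n)) (IsInt-+ (IsInt-* (int (pos 2)) mi) ni) , subst IsInt (sym (l₂ n)) ni
    where
    l₁ : ∀ m n → 2ℚ * (m + ½ * n) ≡ 2ℚ * m + n
    l₁ = solve 2 (λ m n → (Κ 2ℚ ⊗ (m ⊕ Κ ½ ⊗ n)) ⊜ (Κ 2ℚ ⊗ m ⊕ n)) refl
    l₂ : ∀ n → 2ℚ * (½ * n) ≡ n
    l₂ = solve 1 (λ n → (Κ 2ℚ ⊗ (Κ ½ ⊗ n)) ⊜ n) refl

  -- In m + nω the rational part exceeds m by n/2, which is also the coefficient of √D.
  half-rational : ∀ x y → Half (x , y) → y ≡ 0ℚ → IsInt x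
  half-rational _ _ (m , n , (k , m≡) , ni , refl) half≡0 = k , trans (cong (m +_) half≡0) (trans (ℚₚ.+-identityʳ m) m≡)

  module _ (δ : ℚ) (δi : IsInt δ) where
    private
      d : ℚ
      d = 1ℚ + ℤtoℚ (pos 4) * δ

    -- The bilinear form is built from sums, products and τ alone, without division by 2, so it
    -- stays in the ring of integers.
    half-polar : ∀ G → let open GQF G in Half a₁₁ → Half a₁₂ → Half a₂₂ → Half b₁₁ → Half b₁₂ → Half b₂₁ → Half b₂₂ → Half c₁₁ → Half c₁₂ → Half c₂₂ →
      ∀ x y z w x′ y′ z′ w′ → Half (x , y) → Half (z , w) → Half (x′ , y′) → Half (z′ , w′) → Half (polar d G ⟨ x , y , z , w ⟩ ⟨ x′ , y′ , z′ , w′ ⟩)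
    half-polar (gqf a₁₁ a₁₂ a₂₂ b₁₁ b₁₂ b₂₁ b₂₂ c₁₁ c₁₂ c₂₂) ha₁₁ ha₁₂ ha₂₂ hb₁₁ hb₁₂ hb₂₁ hb₂₂ hc₁₁ hc₁₂ hc₂₂ x y z w x′ y′ z′ w′ z₁ z₂ y₁ y₂ =
      m ha₁₁ (m z₁ y₁) ⊞ (m ha₂₂ (m z₂ y₂) ⊞ (m hc₁₁ (m (t z₁) (t y₁)) ⊞ (m hc₂₂ (m (t z₂) (t y₂))
        ⊞ (m hb₁₁ (m z₁ (t y₁) ⊞ m y₁ (t z₁)) ⊞ (m hb₂₂ (m z₂ (t y₂) ⊞ m y₂ (t z₂))
        ⊞ (m ha₁₂ (m z₁ y₂ ⊞ m y₁ z₂) ⊞ (m hc₁₂ (m (t z₁) (t y₂) ⊞ m (t y₁) (t z₂))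
        ⊞ (m hb₁₂ (m z₁ (t y₂) ⊞ m y₁ (t z₂)) ⊞ m hb₂₁ (m z₂ (t y₁) ⊞ m y₂ (t z₁))))))))))
      where
      infixr 5 _⊞_
      _⊞_ : ∀ {x y} → Half x → Half y → Half (x +ₐ y)
      _⊞_ {x} {y} = half-+ {x} {y}
      m : ∀ {x y} → Half x → Half y → Half (mulₐ d x y)
      m {x} {y} = half-* δ δi {x} {y}
      t : ∀ {x} → Half x → Half (τₐ x)
      t {x} = half-τ {x}

  mulK≡mulₐ : ∀ D x y → mulK D x y ≡ mulₐ (ℕtoℚ D) x y
  mulK≡mulₐ D (a , b) (c , d) = refl

  gqf-≡ : ∀ {A : Set} {a₁₁ a₁₂ a₂₂ b₁₁ b₁₂ b₂₁ b₂₂ c₁₁ c₁₂ c₂₂ a₁₂′ b₁₁′ b₁₂′ b₂₁′ b₂₂′ c₁₂′ : A × A} →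
    a₁₂ ≡ a₁₂′ → b₁₁ ≡ b₁₁′ → b₁₂ ≡ b₁₂′ → b₂₁ ≡ b₂₁′ → b₂₂ ≡ b₂₂′ → c₁₂ ≡ c₁₂′ →
    gqf a₁₁ a₁₂ a₂₂ b₁₁ b₁₂ b₂₁ b₂₂ c₁₁ c₁₂ c₂₂ ≡ gqf a₁₁ a₁₂′ a₂₂ b₁₁′ b₁₂′ b₂₁′ b₂₂′ c₁₁ c₁₂′ c₂₂
  gqf-≡ refl refl refl refl refl refl = refl

  -- If 2x = qD then x = xD - e · 2x = (x - eq) D.
  odd-cancel : ∀ D e x → D ≡ pos 2 ℤ.* e ℤ.+ ℤ.1ℤ → D ℤ∣.∣ pos 2 ℤ.* x → D ℤ∣.∣ x
  odd-cancel _ e x refl (ℤ∣.divides q eq) = ℤ∣.divides (x ℤ.- e ℤ.* q) (ℤₚ.*-cancelˡ-≡ (pos 2) x _ (trans eq (trans (lem₁ q e) (trans (cong (λ t → (t ℤ.- pos 2 ℤ.* (e ℤ.* q)) ℤ.* (pos 2 ℤ.* e ℤ.+ ℤ.1ℤ)) (sym eq)) (lem₂ x q e)))))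
    where
    lem₁ : ∀ q e → q ℤ.* (pos 2 ℤ.* e ℤ.+ ℤ.1ℤ) ≡ (q ℤ.* (pos 2 ℤ.* e ℤ.+ ℤ.1ℤ) ℤ.- pos 2 ℤ.* (e ℤ.* q)) ℤ.* (pos 2 ℤ.* e ℤ.+ ℤ.1ℤ)
    lem₁ = ℤ-Solver.solve-∀
    lem₂ : ∀ x q e → (pos 2 ℤ.* x ℤ.- pos 2 ℤ.* (e ℤ.* q)) ℤ.* (pos 2 ℤ.* e ℤ.+ ℤ.1ℤ) ≡ pos 2 ℤ.* ((x ℤ.- e ℤ.* q) ℤ.* (pos 2 ℤ.* e ℤ.+ ℤ.1ℤ))
    lem₂ = ℤ-Solver.solve-∀

  -- D ≡ 1 (mod 4): the bilinear form of a classical form takes values in the ring of integers, and they are rational.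
  module Case1 (D : ℕ) (D%4 : D % 4 ≡ 1) (G : BinGQF) (classical : Classical D G) (universal : ZUniversal D G) where
    open Integers D
    open Necessity G (proj₁ universal) (proj₁ (proj₂ (proj₂ universal))) (proj₂ (proj₂ (proj₂ universal)))

    private
      d δ : ℚ
      d = ℕtoℚ D
      δ = ℕtoℚ (D / 4)

    pos-D : pos D ≡ ℤ.1ℤ ℤ.+ pos 4 ℤ.* pos (D / 4)
    pos-D = trans (cong pos (trans (m≡m%n+[m/n]*n D 4) (cong₂ ℕ._+_ D%4 (ℕₚ.*-comm (D / 4) 4)))) (cong (λ t → ℤ.1ℤ ℤ.+ t) (ℤₚ.pos-* 4 (D / 4)))

    d≡ : d ≡ 1ℚ + ℤtoℚ (pos 4) * δ
    d≡ = trans (cong ℤtoℚ pos-D) (sym (proj₂ (IsInt-+ (int (pos 1)) (IsInt-* (int (pos 4)) (int (pos (D / 4)))))))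

    inOK⇒half : ∀ {x} → InOK D x → Half x
    inOK⇒half (m , n , eq) = ℤtoℚ m , ℤtoℚ n , int m , int n ,
      trans eq (trans (cong (λ w → ι (ℤtoℚ m) +K mulK D (ι (ℤtoℚ n)) w) (ω-1 D D%4)) (cong₂ _,_ (l₁ (ℤtoℚ m) (ℤtoℚ n) d) (l₂ (ℤtoℚ n))))
      where
      l₁ : ∀ m n d → m + (n * ½ + d * 0ℚ * ½) ≡ m + ½ * n
      l₁ = solve 3 (λ m n d → (m ⊕ (n ⊗ Κ ½ ⊕ d ⊗ Κ 0ℚ ⊗ Κ ½)) ⊜ (m ⊕ Κ ½ ⊗ n)) refl
      l₂ : ∀ n → 0ℚ + (n * ½ + 0ℚ * ½) ≡ ½ * n
      l₂ = solve 1 (λ n → (Κ 0ℚ ⊕ (n ⊗ Κ ½ ⊕ Κ 0ℚ ⊗ Κ ½)) ⊜ (Κ ½ ⊗ n)) refl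

    in2OK⇒int : ∀ {x} → In2OK D x → IntPair x
    in2OK⇒int ((p , q) , y∈ , eq) = from (half-twice (p , q) (inOK⇒half y∈))
      where
      l₁ : ∀ p q d → 2ℚ * p + d * 0ℚ * q ≡ 2ℚ * p
      l₁ = solve 3 (λ p q d → (Κ 2ℚ ⊗ p ⊕ d ⊗ Κ 0ℚ ⊗ q) ⊜ (Κ 2ℚ ⊗ p)) refl
      l₂ : ∀ p q → 2ℚ * q + 0ℚ * p ≡ 2ℚ * q
      l₂ = solve 2 (λ p q → (Κ 2ℚ ⊗ q ⊕ Κ 0ℚ ⊗ p) ⊜ (Κ 2ℚ ⊗ q)) refl
      from : TwiceInt (p , q) → IntPair _
      from (pi , qi) = subst IsInt (sym (trans (cong proj₁ eq) (l₁ p q d))) pi , subst IsInt (sym (trans (cong proj₂ eq) (l₂ p q))) qi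

    in2OK⇒twice : ∀ {x} → In2OK D x → TwiceInt x
    in2OK⇒twice x∈ = let a , b = in2OK⇒int x∈ in IsInt-* (int (pos 2)) a , IsInt-* (int (pos 2)) b

    -- Polarising zᵢ² already produces an even cross term, so α₁₁, α₂₂, γ₁₁, γ₂₂ stay. The term z
    -- τ(z) polarises to z τ(y) + y τ(z) without a factor 2, which is why all the β are halved along
    -- with α₁₂ and γ₁₂.
    halved : GQF ℚ
    halved = let _ , α₁₂′ , γ₁₂′ , β₁₁′ , β₁₂′ , β₂₁′ , β₂₂′ = classical in
      gqf (α₁₁ G) (proj₁ α₁₂′) (α₂₂ G) (proj₁ β₁₁′) (proj₁ β₁₂′) (proj₁ β₂₁′) (proj₁ β₂₂′) (γ₁₁ G) (proj₁ γ₁₂′) (γ₂₂ G)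

    coefficients≡ : coefficients G ≡ double d halved
    coefficients≡ = let _ , α₁₂′ , γ₁₂′ , β₁₁′ , β₁₂′ , β₂₁′ , β₂₂′ = classical in
      gqf-≡ (two α₁₂′) (two β₁₁′) (two β₁₂′) (two β₂₁′) (two β₂₂′) (two γ₁₂′)
      where
      two : ∀ {x} (x∈ : In2OK D x) → x ≡ mulₐ d (2ℚ , 0ℚ) (proj₁ x∈)
      two (y , _ , eq) = trans eq (mulK≡mulₐ D (2ℚ , 0ℚ) y)

    polar-half : ∀ u v → Half (polar d halved (vector u) (vector v))
    polar-half (point (x , y) (z , w) h₁ h₂) (point (x′ , y′) (z′ , w′) h₃ h₄) =
      let (iα₁₁ , _ , iα₂₂ , _ , _ , _ , _ , iγ₁₁ , _ , iγ₂₂) , (_ , iα₁₂ , _) , (_ , iγ₁₂ , _) , (_ , iβ₁₁ , _) , (_ , iβ₁₂ , _) , (_ , iβ₂₁ , _) , (_ , iβ₂₂ , _) = classical in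
      subst (λ d → Half (polar d halved ⟨ x , y , z , w ⟩ ⟨ x′ , y′ , z′ , w′ ⟩)) (sym d≡)
        (half-polar δ (int (pos (D / 4))) halved (inOK⇒half iα₁₁) (inOK⇒half iα₁₂) (inOK⇒half iα₂₂) (inOK⇒half iβ₁₁) (inOK⇒half iβ₁₂) (inOK⇒half iβ₂₁) (inOK⇒half iβ₂₂)
          (inOK⇒half iγ₁₁) (inOK⇒half iγ₁₂) (inOK⇒half iγ₂₂) x y z w x′ y′ z′ w′ (inOK⇒half h₁) (inOK⇒half h₂) (inOK⇒half h₃) (inOK⇒half h₄))

    pairing-integral : ∀ u v → IsInt (pairing d g (vector u) (vector v))
    pairing-integral u v = subst IsInt real≡ (half-rational (proj₁ P) (proj₂ P) (polar-half u v) imaginary≡)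
      where
      P = polar d halved (vector u) (vector v)
      real≡ : proj₁ P ≡ pairing d g (vector u) (vector v)
      real≡ = trans (polar-real d halved (vector u) (vector v)) (cong (λ G → pairing d (real ½ G) (vector u) (vector v)) (sym coefficients≡))
      imaginary≡ : proj₂ P ≡ 0ℚ
      imaginary≡ = trans (polar-imaginary d halved (vector u) (vector v))
        (trans (cong (λ G → pairing 1ℚ (imaginary ½ d G) (vector u) (vector v)) (sym coefficients≡)) (imaginary-polar u v))

    scaled-g : All10 IsInt (scaleSym 2ℚ g)
    scaled-g = let (iα₁₁ , _ , iα₂₂ , _ , _ , _ , _ , iγ₁₁ , _ , iγ₂₂) , iα₁₂ , iγ₁₂ , iβ₁₁ , iβ₁₂ , iβ₂₁ , iβ₂₂ = classical in
      twice-real-int (coefficients G) (half-twice (α₁₁ G) (inOK⇒half iα₁₁)) (half-twice (α₂₂ G) (inOK⇒half iα₂₂)) (in2OK⇒twice iβ₁₁) (in2OK⇒twice iβ₂₂)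
        (half-twice (γ₁₁ G) (inOK⇒half iγ₁₁)) (half-twice (γ₂₂ G) (inOK⇒half iγ₂₂)) (in2OK⇒int iα₁₂) (in2OK⇒int iβ₁₂) (in2OK⇒int iβ₂₁) (in2OK⇒int iγ₁₂)

    scaled-vector : ∀ u → All4 IsInt (scale 2ℚ (vector u))
    scaled-vector (point z₁ z₂ h₁ h₂) = let x , y = half-twice z₁ (inOK⇒half h₁) ; z , w = half-twice z₂ (inOK⇒half h₂) in x , y , z , w

    D≤10 : D ℕ.≤ 10
    D≤10 = Bound.D≤10 (pos 2) (λ x → odd-cancel (pos D) (pos 2 ℤ.* pos (D / 4)) x (trans pos-D (lem (pos (D / 4))))) scaled-g scaled-vector pairing-integral
      where
      lem : ∀ e → ℤ.1ℤ ℤ.+ pos 4 ℤ.* e ≡ pos 2 ℤ.* (pos 2 ℤ.* e) ℤ.+ ℤ.1ℤ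
      lem = ℤ-Solver.solve-∀

-- The values of D up to 10 and the two equivalences.

open Examples
open BilinearForms
open CaseTwoThree
open CaseOne
open import Defs
open import Data.Nat using (ℕ; _≤_; _%_; suc; s≤s)
open import Data.Nat.Divisibility using (divides)
open import Data.Product using (_×_; ∃-syntax; _,_)
open import Data.Sum using (_⊎_; inj₁; inj₂)
open import Relation.Binary.PropositionalEquality using (_≡_; refl)
open import Function.Bundles using (_⇔_; mk⇔)

bounded-23 : ∀ D → 2 ≤ D → D ≤ 10 → (D % 4 ≡ 2) ⊎ (D % 4 ≡ 3) → D ≡ 2 ⊎ D ≡ 3 ⊎ D ≡ 6 ⊎ D ≡ 7 ⊎ D ≡ 10
bounded-23 1 (s≤s ()) _ _
bounded-23 2 _ _ _ = inj₁ refl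
bounded-23 3 _ _ _ = inj₂ (inj₁ refl)
bounded-23 4 _ _ (inj₁ ())
bounded-23 4 _ _ (inj₂ ())
bounded-23 5 _ _ (inj₁ ())
bounded-23 5 _ _ (inj₂ ())
bounded-23 6 _ _ _ = inj₂ (inj₂ (inj₁ refl))
bounded-23 7 _ _ _ = inj₂ (inj₂ (inj₂ (inj₁ refl)))
bounded-23 8 _ _ (inj₁ ())
bounded-23 8 _ _ (inj₂ ())
bounded-23 9 _ _ (inj₁ ())
bounded-23 9 _ _ (inj₂ ())
bounded-23 10 _ _ _ = inj₂ (inj₂ (inj₂ (inj₂ refl)))
bounded-23 (suc (suc (suc (suc (suc (suc (suc (suc (suc (suc (suc D))))))))))) _ (s≤s (s≤s (s≤s (s≤s (s≤s (s≤s (s≤s (s≤s (s≤s (s≤s ())))))))))) _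

-- Besides 5, only 9 in this range is 1 modulo 4, and it is divisible by 3².
bounded-1 : ∀ D → 2 ≤ D → D ≤ 10 → SquareFree D → D % 4 ≡ 1 → D ≡ 5
bounded-1 1 (s≤s ()) _ _ _
bounded-1 2 _ _ _ ()
bounded-1 3 _ _ _ ()
bounded-1 4 _ _ _ ()
bounded-1 5 _ _ _ _ = refl
bounded-1 6 _ _ _ ()
bounded-1 7 _ _ _ ()
bounded-1 8 _ _ _ ()
bounded-1 9 _ _ squarefree _ with squarefree 3 (divides 1 refl)
... | ()
bounded-1 10 _ _ _ ()
bounded-1 (suc (suc (suc (suc (suc (suc (suc (suc (suc (suc (suc D))))))))))) _ (s≤s (s≤s (s≤s (s≤s (s≤s (s≤s (s≤s (s≤s (s≤s (s≤s ())))))))))) _ _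

theorem1p2 : ∀ (D : ℕ) → 2 ≤ D → SquareFree D →
    (((D % 4 ≡ 2) ⊎ (D % 4 ≡ 3)) →
    ((∃[ G ] ZUniversal D G) ⇔
    (D ≡ 2 ⊎ D ≡ 3 ⊎ D ≡ 6 ⊎ D ≡ 7 ⊎ D ≡ 10)))
    × ((D % 4 ≡ 1) →
    ((∃[ G ] (Classical D G × ZUniversal D G)) ⇔ (D ≡ 5)))
theorem1p2 D 2≤D squarefree =
  (λ D%4 → mk⇔ (λ where (G , universal) → bounded-23 D 2≤D (Case23.D≤10 D 2≤D (ω-23 D%4) G universal) D%4) exists-23) ,
  (λ D%4 → mk⇔ (λ where (G , classical , universal) → bounded-1 D 2≤D (Case1.D≤10 D D%4 G classical universal) squarefree D%4) exists-1)
  where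
  ω-23 : (D % 4 ≡ 2) ⊎ (D % 4 ≡ 3) → _
  ω-23 (inj₁ eq) = ω-2 D eq
  ω-23 (inj₂ eq) = ω-3 D eq
  exists-23 : D ≡ 2 ⊎ D ≡ 3 ⊎ D ≡ 6 ⊎ D ≡ 7 ⊎ D ≡ 10 → ∃[ G ] ZUniversal D G
  exists-23 (inj₁ refl) = _ , D=2.universal
  exists-23 (inj₂ (inj₁ refl)) = _ , D=3.universal
  exists-23 (inj₂ (inj₂ (inj₁ refl))) = _ , D=6.universal
  exists-23 (inj₂ (inj₂ (inj₂ (inj₁ refl)))) = _ , D=7.universal
  exists-23 (inj₂ (inj₂ (inj₂ (inj₂ refl)))) = _ , D=10.universal
  exists-1 : D ≡ 5 → ∃[ G ] (Classical D G × ZUniversal D G)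
  exists-1 refl = _ , D=5.classical , D=5.universal
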